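{- Let $B\ge 2$ and $d\ge 1$ be integers, and let $L\in\mathbb{C}^{1\times d}$, $A_0,\dots,A_{B-1}\in\mathbb{C}^{d\times d}$, $C\in\mathbb{C}^{d}$ be a linear representation. Put $Q=A_0+\dots+A_{B-1}$. Assume: (ADT) there are $V\in\mathbb{C}^d\setminus\{0\}$, complex sequences $(R(K))$, $(R'(K))$ with $R(K)\neq 0$ for all large $K$, and numbers $\rho>0$, $\omega\in\mathbb{C}$ with $|\omega|=1$ such that, as $K\to+\infty$, $Q^KC=R(K)V+O(R'(K))$, $\;R(K+1)/R(K)=\rho\omega\,(1+O(1/K))$ and $R'(K)=R(K)\,O(1/K)$; (JSR) the joint spectral radius $\lambda_*$ of the family $(A_r)_{0\le r<B}$ satisfies $\lambda_*<\rho$. Then the basic dilation equation associated with $(A_r)$, $\rho\omega$ and $V$ has a unique continuous solution $\mathbf F:[0,1]\to\mathbb{C}^d$, and the sequence of functions $\mathbf F_K(x)=\mathbf S_K(x)/R(K)$ (defined for $K$ large) converges to $\mathbf F$ uniformly on $[0,1]$ as $K\to+\infty$.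
   Context: Words $w=w_1\cdots w_K$ are over the alphabet $\{0,\dots,B-1\}$, $|w|=K$ is the length, $A_w=A_{w_1}\cdots A_{w_K}$ (identity for the empty word), and $(0.w)_B=\sum_{i=1}^K w_iB^{ -i}$. The running sum is $\mathbf S_K(x)=\sum_{|w|=K,\ (0.w)_B\le x}A_wC$ for $x\in[0,1]$. The basic dilation equation associated with $(A_r)$, $\rho\omega$, $V$ is the following system for an unknown function $\Phi:[0,1]\to\mathbb{C}^d$: $\Phi(0)=0$, $\Phi(1)=V$, and for every $r\in\{0,\dots,B-1\}$ and every $x\in[r/B,(r+1)/B)$, $$\Phi(x)=\frac1{\rho\omega}\sum_{0\le s<r}A_sV+\frac1{\rho\omega}A_r\,\Phi(Bx-r).$$ The joint spectral radius of $(A_r)_{0\le r<B}$ is $\lambda_*=\lim_{T\to\infty}\lambda_T$, where $\lambda_T=\max_{|w|=T}\|A_w\|^{1/T}$ for any induced matrix norm; it does not depend on the norm. -}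

module Defs where

open import Algebra.Bundles using (CommutativeRing; Semiring)
open import Algebra.Bundles.Raw using (RawMonoid; RawRing)
import Algebra.Construct.NaturalChoice.Max as Max
import Algebra.Definitions.RawMonoid as RawMonoidDefs
import Algebra.Definitions.RawSemiring as RawSemiringDefs
open import Axiom.ExcludedMiddle using (ExcludedMiddle)
open import Data.Bool.Base using (if_then_else_)
open import Data.Fin.Base using (Fin; Fin′; toℕ; inject)
open import Data.Fin.Properties using (_≟_)
open import Data.Nat.Base as ℕ using (ℕ; zero; suc)
open import Data.Product.Base using (Σ; ∃; _×_; _,_; proj₁; proj₂)
open import Data.Vec.Base using (Vec; []; _∷_; lookup)
open import Data.Vec.Functional using (Vector)
open import Level using (0ℓ) renaming (suc to lsuc)
open import Relation.Binary.Bundles using (TotalOrder)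
open import Relation.Binary.Core using (Rel)
open import Relation.Binary.Structures using (IsTotalOrder)
import Relation.Binary.Construct.NonStrictToStrict as Strict
open import Relation.Nullary using (¬_; yes; no; does)
open import Relation.Nullary.Decidable using (_×-dec_)

-- The real numbers are axiomatised as a Dedekind-complete ordered field; in
-- the presence of excluded middle this determines them up to isomorphism.
record CompleteOrderedField : Set (lsuc 0ℓ) where
  field
    commutativeRing : CommutativeRing 0ℓ 0ℓ

  open CommutativeRing commutativeRing public
    using (_≈_; _≉_; _+_; _*_; -_; _-_; 0#; 1#; semiring)
    renaming (Carrier to ℝ)

  infix 4 _≤_
  field
    _≤_          : Rel ℝ 0ℓ
    isTotalOrder : IsTotalOrder _≈_ _≤_
    0≉1          : 0# ≉ 1#
    invertible   : ∀ x → x ≉ 0# → ∃ λ y → x * y ≈ 1#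
    +-monoˡ-≤    : ∀ z {x y} → x ≤ y → x + z ≤ y + z
    *-nonNeg     : ∀ {x y} → 0# ≤ x → 0# ≤ y → 0# ≤ x * y

  IsUpperBound : (ℝ → Set) → ℝ → Set
  IsUpperBound P u = ∀ x → P x → x ≤ u

  IsSupremum : (ℝ → Set) → ℝ → Set
  IsSupremum P s = IsUpperBound P s × (∀ u → IsUpperBound P u → s ≤ u)

  field
    complete : ∀ (P : ℝ → Set) → ∃ P → ∃ (IsUpperBound P) → ∃ (IsSupremum P)

  totalOrder : TotalOrder 0ℓ 0ℓ 0ℓ
  totalOrder = record { isTotalOrder = isTotalOrder }

  open Strict _≈_ _≤_ public using (_<_)
  open Max totalOrder public using (_⊔_)
  open RawSemiringDefs (Semiring.rawSemiring semiring) public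
    using (_^_; sum) renaming (_×_ to _×ᴿ_)

module Analysis (em : ExcludedMiddle 0ℓ) (𝐑 : CompleteOrderedField) where

  open CompleteOrderedField 𝐑 public

  ι : ℕ → ℝ
  ι n = n ×ᴿ 1#

  -- Total inverse: 0 ⁻¹ = 0.
  infix 9 _⁻¹
  _⁻¹ : ℝ → ℝ
  x ⁻¹ with em {x ≈ 0#}
  ... | yes _   = 0#
  ... | no x≉0 = proj₁ (invertible x x≉0)

  ∣_∣ : ℝ → ℝ
  ∣ x ∣ = x ⊔ (- x)

  -- Total supremum: 0 when P is empty or unbounded above.  This default value
  -- is never reached by root n a for n ≥ 1 and a ≥ 0, nor by the induced norm
  -- and the maximum over words below.
  Sup : (ℝ → Set) → ℝ
  Sup P with em {∃ P} ×-dec em {∃ (IsUpperBound P)}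
  ... | yes (nonempty , bounded) = proj₁ (complete P nonempty bounded)
  ... | no _                     = 0#

  -- The non-negative n-th root a^{1/n}, for n ≥ 1 and a ≥ 0.
  root : ℕ → ℝ → ℝ
  root n a = Sup λ y → 0# ≤ y × y ^ n ≤ a

  Eventually : (ℕ → Set) → Set
  Eventually P = ∃ λ N → ∀ K → N ℕ.≤ K → P K

  infix 4 _⟶_ _=O_
  _⟶_ : (ℕ → ℝ) → ℝ → Set
  f ⟶ l = ∀ ε → 0# < ε → Eventually λ K → ∣ f K - l ∣ < ε

  -- Stated for non-negative sequences (moduli, norms and 1/K).
  _=O_ : (ℕ → ℝ) → (ℕ → ℝ) → Set
  f =O g = ∃ λ M → Eventually λ K → f K ≤ M * g K

  infix 4 _+i_
  record ℂ : Set where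
    constructor _+i_
    field
      re im : ℝ
  open ℂ public

  ℂ-rawRing : RawRing 0ℓ 0ℓ
  ℂ-rawRing = record
    { Carrier = ℂ
    ; _≈_ = λ z w → re z ≈ re w × im z ≈ im w
    ; _+_ = λ z w → (re z + re w) +i (im z + im w)
    ; _*_ = λ z w → (re z * re w - im z * im w) +i (re z * im w + im z * re w)
    ; -_  = λ z → (- re z) +i (- im z)
    ; 0#  = 0# +i 0#
    ; 1#  = 1# +i 0#
    }

  open RawRing ℂ-rawRing public
    using () renaming
    ( _≈_ to _≈ᶜ_; _≉_ to _≉ᶜ_; _+_ to _+ᶜ_; _*_ to _*ᶜ_; -_ to -ᶜ_
    ; 0# to 0ᶜ; 1# to 1ᶜ; rawSemiring to ℂ-rawSemiring )
  open RawSemiringDefs ℂ-rawSemiring public using () renaming (sum to sumᶜ)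

  fromℝ : ℝ → ℂ
  fromℝ x = x +i 0#

  normSq : ℂ → ℝ
  normSq z = re z * re z + im z * im z

  ∣_∣ᶜ : ℂ → ℝ
  ∣ z ∣ᶜ = root 2 (normSq z)

  infix 9 _⁻¹ᶜ
  _⁻¹ᶜ : ℂ → ℂ
  z ⁻¹ᶜ = (re z * normSq z ⁻¹) +i (- im z * normSq z ⁻¹)

  ℂ^ : ℕ → Set
  ℂ^ d = Vector ℂ d

  ℂ^-rawMonoid : ℕ → RawMonoid 0ℓ 0ℓ
  ℂ^-rawMonoid d = record
    { Carrier = ℂ^ d
    ; _≈_ = λ v w → ∀ i → v i ≈ᶜ w i
    ; _∙_ = λ v w i → v i +ᶜ w i
    ; ε   = λ _ → 0ᶜ
    }

  module _ {d : ℕ} where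
    open RawMonoid (ℂ^-rawMonoid d) public
      using () renaming (_≈_ to _≈ᵛ_; _∙_ to _+ᵛ_; ε to 0ᵛ)
    open RawMonoidDefs (ℂ^-rawMonoid d) public
      using () renaming (sum to sumᵛ)

  infixr 8 _•_
  _•_ : ∀ {d} → ℂ → ℂ^ d → ℂ^ d
  (c • v) i = c *ᶜ v i

  infixl 6 _-ᵛ_
  _-ᵛ_ : ∀ {d} → ℂ^ d → ℂ^ d → ℂ^ d
  (v -ᵛ w) i = v i +ᶜ (-ᶜ w i)

  Matrix : ℕ → Set
  Matrix d = Fin d → Fin d → ℂ

  Matrix-rawRing : ℕ → RawRing 0ℓ 0ℓ
  Matrix-rawRing d = record
    { Carrier = Matrix d
    ; _≈_ = λ M N → ∀ i j → M i j ≈ᶜ N i j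
    ; _+_ = λ M N i j → M i j +ᶜ N i j
    ; _*_ = λ M N i j → sumᶜ λ k → M i k *ᶜ N k j
    ; -_  = λ M i j → -ᶜ M i j
    ; 0#  = λ _ _ → 0ᶜ
    ; 1#  = λ i j → if does (i ≟ j) then 1ᶜ else 0ᶜ
    }

  module _ {d : ℕ} where
    open RawSemiringDefs (RawRing.rawSemiring (Matrix-rawRing d)) public
      using () renaming (sum to sumᴹ; product to productᴹ; _^_ to _^ᴹ_)

  infixr 8 _·_
  _·_ : ∀ {d} → Matrix d → ℂ^ d → ℂ^ d
  (M · v) i = sumᶜ λ k → M i k *ᶜ v k

  record Norm (d : ℕ) : Set where
    field
      ‖_‖         : ℂ^ d → ℝ
      cong        : ∀ {v w} → v ≈ᵛ w → ‖ v ‖ ≈ ‖ w ‖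
      definite    : ∀ v → ‖ v ‖ ≈ 0# → v ≈ᵛ 0ᵛ
      homogeneous : ∀ c v → ‖ c • v ‖ ≈ ∣ c ∣ᶜ * ‖ v ‖
      triangle    : ∀ v w → ‖ v +ᵛ w ‖ ≤ ‖ v ‖ + ‖ w ‖

    inducedNorm : Matrix d → ℝ
    inducedNorm M = Sup λ t → ∃ λ v → ‖ v ‖ ≤ 1# × t ≈ ‖ M · v ‖

  record LinearRepresentation (B d : ℕ) : Set where
    field
      L : Vector ℂ d
      A : Fin B → Matrix d
      C : ℂ^ d

    Q : Matrix d
    Q = sumᴹ A

  Word : ℕ → ℕ → Set
  Word B K = Vec (Fin B) K

  -- (0.w)_B; the index i starts from 0 here.
  radix : ∀ {B K} → Word B K → ℝ
  radix {B} w = sum λ i → ι (toℕ (lookup w i)) * (ι B ⁻¹) ^ suc (toℕ i)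

  matrixOf : ∀ {B d K} → (Fin B → Matrix d) → Word B K → Matrix d
  matrixOf A w = productᴹ λ i → A (lookup w i)

  sumWords : ∀ {B d} K → (Word B K → ℂ^ d) → ℂ^ d
  sumWords zero    f = f []
  sumWords (suc K) f = sumᵛ λ r → sumWords K λ w → f (r ∷ w)

  [0,1] : Set
  [0,1] = Σ ℝ λ x → 0# ≤ x × x ≤ 1#

  runningSum : ∀ {B d} → LinearRepresentation B d → ℕ → [0,1] → ℂ^ d
  runningSum rep K (x , _) =
    sumWords K λ w → if does (em {radix w ≤ x}) then matrixOf A w · C else 0ᵛ
    where open LinearRepresentation rep

  -- The supremum is a maximum, there being finitely many words of length T.
  λ[_] : ∀ {B d} → ℕ → Norm d → (Fin B → Matrix d) → ℝ
  λ[_] {B} T ν A =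
    root T (Sup λ t → ∃ λ (w : Word B T) → t ≈ inducedNorm (matrixOf A w))
    where open Norm ν

  IsJointSpectralRadius : ∀ {B d} → Norm d → (Fin B → Matrix d) → ℝ → Set
  IsJointSpectralRadius ν A λ* = (λ T → λ[ T ] ν A) ⟶ λ*

  -- Elements of [0,1] carry their bounds, so evaluation at the points 0, 1 and
  -- B x - r is written by quantifying over the elements of [0,1] equal to them.
  record SolvesDilation {B d} (A : Fin B → Matrix d) (ρω : ℂ) (V : ℂ^ d)
                        (Φ : [0,1] → ℂ^ d) : Set where
    field
      at-0     : ∀ x → proj₁ x ≈ 0# → Φ x ≈ᵛ 0ᵛ
      at-1     : ∀ x → proj₁ x ≈ 1# → Φ x ≈ᵛ V
      dilation : ∀ (r : Fin B) (x y : [0,1]) →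
                 ι (toℕ r) * ι B ⁻¹ ≤ proj₁ x →
                 proj₁ x < ι (suc (toℕ r)) * ι B ⁻¹ →
                 proj₁ y ≈ ι B * proj₁ x - ι (toℕ r) →
                 Φ x ≈ᵛ (ρω ⁻¹ᶜ • sumᵛ (λ (s : Fin′ r) → A (inject s) · V))
                        +ᵛ (ρω ⁻¹ᶜ • (A r · Φ y))

  -- Continuity makes Φ independent of the bounds carried by its argument and
  -- compatible with _≈_.
  Continuous : ∀ {d} → Norm d → ([0,1] → ℂ^ d) → Set
  Continuous ν Φ =
    ∀ x ε → 0# < ε → ∃ λ δ → 0# < δ ×
      (∀ y → ∣ proj₁ y - proj₁ x ∣ < δ → ‖ Φ y -ᵛ Φ x ‖ < ε)
    where open Norm ν

  -- The functions Φₖ only need to be meaningful for large K.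
  ConvergesUniformly : ∀ {d} → Norm d →
                       (ℕ → [0,1] → ℂ^ d) → ([0,1] → ℂ^ d) → Set
  ConvergesUniformly ν Φₖ Φ =
    ∀ ε → 0# < ε → Eventually λ K → ∀ x → ‖ Φₖ K x -ᵛ Φ x ‖ < ε
    where open Norm ν

module Submission where

-- The joint spectral radius hypothesis provides a norm for which every single A_r
-- has norm at most some q < ρ.  For that norm, the right-hand side of the dilation
-- equation is a contraction of ratio q/ρ, so its iterates from x ↦ x V, which are
-- continuous because Q V = ρω V makes the pieces fit together, converge uniformly
-- to a solution F.  Splitting off the first letter of w gives
-- S_{K+1}(x) = Σ_{s<r} A_s Q^K C + A_r S_K(Bx - r), a perturbation of the dilation
-- equation; hence the uniform distance u_K between F_K and F satisfies
-- u_{K+1} ≤ a u_K + o(1) with a < 1 and tends to 0.  Uniqueness holds because a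
-- solution is determined at the B-adic points, which are dense.

-- In the given norm no single letter need contract: λ* < ρ only controls long products. The remedy
-- is the weighted sum Σ_{s<T} q^(T-1-s) max_{|w|=s} ‖A_w v‖, for which a single length T with λ_T <
-- q < ρ suffices. Continuity and convergence are still asked for in the given norm, so the
-- equivalence of norms on ℂ^d has to be proved; it is proved once, for seminorms, and also supplies
-- the operator bounds. The equation lives on half-open intervals, while continuity is decided at
-- their common endpoints. Hence the fixed-point argument uses closed branches and shows that two
-- branches through the same x agree: the r-th piece ends at (A_0 + ... + A_r)V/(ρω), where the next
-- one begins, and the last ends at QV/(ρω) = V. The eigenvector equation is not assumed; it is the
-- limit of Q^(K+1)C = Q(Q^K C) after division by R(K+1). F_K is not an iterate of the contraction,
-- since R(K)/R(K+1) only tends to 1/(ρω). Its factor q/ρ is therefore relaxed to some a′ < 1, and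
-- what remains of the discrepancy joins the error term.

open import Algebra.Bundles using (CommutativeRing)
open import Algebra.Bundles.Raw using (RawRing)
import Algebra.Construct.NaturalChoice.Max as Max
import Algebra.Properties.AbelianGroup as AbelianGroupProperties
import Algebra.Properties.Ring as RingProperties
import Algebra.Properties.Semiring.Mult.TCOptimised as Multiples
import Algebra.Properties.Semiring.Sum as SemiringSum
import Algebra.Solver.Ring as RingSolver
open import Algebra.Solver.Ring.AlmostCommutativeRing using (fromCommutativeRing; _-Raw-AlmostCommutative⟶_)
open import Axiom.ExcludedMiddle using (ExcludedMiddle)
open import Data.Bool.Base using (if_then_else_)
open import Data.Fin.Base using (Fin; zero; suc; toℕ; fromℕ; fromℕ<; inject; Fin′)
import Data.Fin.Properties as Fin
open import Data.Integer.Base as ℤ using (ℤ)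
import Data.Integer.Properties as ℤ
open import Data.Maybe.Base using (Maybe; just; nothing)
open import Data.Nat.Base as ℕ using (ℕ; zero; suc)
import Data.Nat.Properties as ℕ
open import Data.Product.Base using (∃; _×_; _,_; proj₁; proj₂)
import Data.Sign.Base as Sign
open import Data.Sum.Base using (_⊎_; inj₁; inj₂)
import Data.Vec.Base as Vec
import Data.Vec.Functional as Vector
open import Function.Base using (_∘_)
open import Level using (0ℓ)
open import Relation.Binary.Bundles using (TotalOrder)
import Relation.Binary.Construct.NonStrictToStrict as Strict
open import Relation.Binary.Definitions using (tri<; tri≈; tri>)
open import Relation.Binary.PropositionalEquality.Core as ≡ using (_≡_)
import Relation.Binary.Reasoning.PartialOrder as PartialOrderReasoning
import Relation.Binary.Reasoning.Setoid as SetoidReasoning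
open import Relation.Nullary using (¬_; yes; no; does)
open import Relation.Nullary.Decidable using (_×-dec_)
open import Relation.Nullary.Negation using (contradiction)
open import Defs

-- Unlike the standard solver with coefficients in R itself, integer coefficients
-- allow terms to cancel although equality in R is not decided by computation.
module IntegerSolver (R : CommutativeRing 0ℓ 0ℓ) where
  open CommutativeRing R
  open import Data.Integer.Base using (+_; -[1+_]; _⊖_; _◃_)
  open Multiples semiring renaming (_×_ to _×′_)
  open RingProperties ring
  open AbelianGroupProperties +-abelianGroup
  open SetoidReasoning setoid

  -- With the optimised multiples `fromℤ (+ 1)` computes to `1#` itself rather than to `1# + 0#`, so
  -- the solver constant `:1` meets a literal `1#` of a goal definitionally.
  fromℤ : ℤ → Carrier
  fromℤ (+ n)    = n ×′ 1#
  fromℤ -[1+ n ] = - (suc n ×′ 1#)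

  cancel-common : ∀ x y → (1# + x) - (1# + y) ≈ x - y
  cancel-common x y = begin
    (1# + x) + - (1# + y)       ≈⟨ +-congˡ (⁻¹-∙-comm 1# y) ⟨
    (1# + x) + (- 1# + - y)     ≈⟨ +-congʳ (+-comm 1# x) ⟩
    (x + 1#) + (- 1# + - y)     ≈⟨ +-assoc x 1# _ ⟩
    x + (1# + (- 1# + - y))     ≈⟨ +-congˡ (+-assoc 1# (- 1#) (- y)) ⟨
    x + ((1# + - 1#) + - y)     ≈⟨ +-congˡ (+-congʳ (-‿inverseʳ 1#)) ⟩
    x + (0# + - y)              ≈⟨ +-congˡ (+-identityˡ (- y)) ⟩
    x - y                       ∎

  fromℤ-⊖ : ∀ m n → fromℤ (m ⊖ n) ≈ m ×′ 1# - n ×′ 1#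
  fromℤ-⊖ zero    zero    = sym (-‿inverseʳ 0#)
  fromℤ-⊖ zero    (suc n) = sym (+-identityˡ _)
  fromℤ-⊖ (suc m) zero    = sym (trans (+-congˡ ε⁻¹≈ε) (+-identityʳ _))
  fromℤ-⊖ (suc m) (suc n) = begin
    fromℤ (suc m ⊖ suc n)              ≡⟨ ≡.cong fromℤ (ℤ.[1+m]⊖[1+n]≡m⊖n m n) ⟩
    fromℤ (m ⊖ n)                      ≈⟨ fromℤ-⊖ m n ⟩
    m ×′ 1# - n ×′ 1#                    ≈⟨ cancel-common _ _ ⟨
    (1# + m ×′ 1#) - (1# + n ×′ 1#)      ≈⟨ +-cong (1+× m 1#) (-‿cong (1+× n 1#)) ⟨
    suc m ×′ 1# - suc n ×′ 1#            ∎

  fromℤ-+ : ∀ i j → fromℤ (i ℤ.+ j) ≈ fromℤ i + fromℤ j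
  fromℤ-+ (+ m)    (+ n)    = ×-homo-+ 1# m n
  fromℤ-+ (+ m)    -[1+ n ] = fromℤ-⊖ m (suc n)
  fromℤ-+ -[1+ m ] (+ n)    = trans (fromℤ-⊖ n (suc m)) (+-comm _ _)
  fromℤ-+ -[1+ m ] -[1+ n ] = begin
    - ((2 ℕ.+ (m ℕ.+ n)) ×′ 1#)         ≡⟨ ≡.cong (λ k → - (suc k ×′ 1#)) (ℕ.+-suc m n) ⟨
    - ((suc m ℕ.+ suc n) ×′ 1#)         ≈⟨ -‿cong (×-homo-+ 1# (suc m) (suc n)) ⟩
    - (suc m ×′ 1# + suc n ×′ 1#)        ≈⟨ ⁻¹-∙-comm _ _ ⟨
    - (suc m ×′ 1#) - suc n ×′ 1#        ∎

  fromℤ-‿ : ∀ i → fromℤ (ℤ.- i) ≈ - fromℤ i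
  fromℤ-‿ (+ zero)  = sym ε⁻¹≈ε
  fromℤ-‿ (+ suc n) = refl
  fromℤ-‿ -[1+ n ]  = sym (⁻¹-involutive _)

  fromℤ-◃⁻ : ∀ n → fromℤ (Sign.- ◃ n) ≈ - (n ×′ 1#)
  fromℤ-◃⁻ zero    = sym ε⁻¹≈ε
  fromℤ-◃⁻ (suc n) = refl

  fromℤ-◃⁺ : ∀ n → fromℤ (Sign.+ ◃ n) ≈ n ×′ 1#
  fromℤ-◃⁺ zero    = refl
  fromℤ-◃⁺ (suc n) = refl

  fromℤ-* : ∀ i j → fromℤ (i ℤ.* j) ≈ fromℤ i * fromℤ j
  fromℤ-* (+ m)    (+ n)    = trans (fromℤ-◃⁺ (m ℕ.* n)) (×1-homo-* m n)
  fromℤ-* (+ m)    -[1+ n ] = begin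
    fromℤ (Sign.- ◃ m ℕ.* suc n)       ≈⟨ fromℤ-◃⁻ (m ℕ.* suc n) ⟩
    - ((m ℕ.* suc n) ×′ 1#)             ≈⟨ -‿cong (×1-homo-* m (suc n)) ⟩
    - (m ×′ 1# * suc n ×′ 1#)            ≈⟨ -‿distribʳ-* _ _ ⟩
    m ×′ 1# * - (suc n ×′ 1#)            ∎
  fromℤ-* -[1+ m ] (+ n)    = begin
    fromℤ (Sign.- ◃ suc m ℕ.* n)       ≈⟨ fromℤ-◃⁻ (suc m ℕ.* n) ⟩
    - ((suc m ℕ.* n) ×′ 1#)             ≈⟨ -‿cong (×1-homo-* (suc m) n) ⟩
    - (suc m ×′ 1# * n ×′ 1#)            ≈⟨ -‿distribˡ-* _ _ ⟩
    - (suc m ×′ 1#) * n ×′ 1#            ∎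
  fromℤ-* -[1+ m ] -[1+ n ] = begin
    fromℤ (Sign.+ ◃ suc m ℕ.* suc n)   ≈⟨ fromℤ-◃⁺ (suc m ℕ.* suc n) ⟩
    (suc m ℕ.* suc n) ×′ 1#             ≈⟨ ×1-homo-* (suc m) (suc n) ⟩
    suc m ×′ 1# * suc n ×′ 1#            ≈⟨ ⁻¹-involutive _ ⟨
    - (- (suc m ×′ 1# * suc n ×′ 1#))    ≈⟨ -‿cong (-‿distribˡ-* _ _) ⟩
    - (- (suc m ×′ 1#) * suc n ×′ 1#)    ≈⟨ -‿distribʳ-* _ _ ⟩
    - (suc m ×′ 1#) * - (suc n ×′ 1#)    ∎

  ℤ-rawRing : RawRing 0ℓ 0ℓ
  ℤ-rawRing = record
    { Carrier = ℤ ; _≈_ = _≡_ ; _+_ = ℤ._+_ ; _*_ = ℤ._*_ ; -_ = ℤ.-_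
    ; 0# = + 0 ; 1# = + 1 }

  fromℤ-homomorphism : ℤ-rawRing -Raw-AlmostCommutative⟶ fromCommutativeRing R
  fromℤ-homomorphism = record
    { ⟦_⟧ = fromℤ ; +-homo = fromℤ-+ ; *-homo = fromℤ-* ; -‿homo = fromℤ-‿
    ; 0-homo = refl ; 1-homo = refl }

  equalCoefficients? : ∀ i j → Maybe (fromℤ i ≈ fromℤ j)
  equalCoefficients? i j with i ℤ.≟ j
  ... | yes i≡j = just (reflexive (≡.cong fromℤ i≡j))
  ... | no _    = nothing

  open RingSolver ℤ-rawRing (fromCommutativeRing R) fromℤ-homomorphism equalCoefficients? public
    using (Polynomial; solve; con; _:=_; _:+_; _:*_; _:-_; :-_)

  :0 :1 : ∀ {n} → Polynomial n
  :0 = con (+ 0)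
  :1 = con (+ 1)

-- Ordered-field arithmetic, suprema and null sequences.

module RealAnalysis (em : ExcludedMiddle 0ℓ) (𝐑 : CompleteOrderedField) where
  open Analysis em 𝐑
  open CommutativeRing commutativeRing public
    using (refl; sym; trans; reflexive; +-cong; +-congˡ; +-congʳ; *-cong; *-congˡ; *-congʳ;
           -‿cong; +-comm; *-comm; *-assoc; +-identityˡ; +-identityʳ; *-identityˡ;
           *-identityʳ; zeroˡ; zeroʳ; -‿inverseʳ; distribˡ)
  open TotalOrder totalOrder public
    using (poset; antisym; total)
    renaming (refl to ≤-refl; reflexive to ≤-reflexive; trans to ≤-trans;
              ≤-respˡ-≈ to ≤-respˡ; ≤-respʳ-≈ to ≤-respʳ)
  open IntegerSolver commutativeRing public
  open PartialOrderReasoning poset public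

  <⇒≤ : ∀ {x y} → x < y → x ≤ y
  <⇒≤ = proj₁

  <-≤-trans : ∀ {x y z} → x < y → y ≤ z → x < z
  <-≤-trans = Strict.<-≤-trans _≈_ _≤_ sym ≤-trans antisym ≤-respʳ

  ≤-<-trans : ∀ {x y z} → x ≤ y → y < z → x < z
  ≤-<-trans = Strict.≤-<-trans _≈_ _≤_ ≤-trans antisym ≤-respˡ

  <⇒≱ : ∀ {x y} → x < y → ¬ (y ≤ x)
  <⇒≱ = Strict.<⇒≱ _≈_ _≤_ antisym

  <-respʳ : ∀ {x y z} → y ≈ z → x < y → x < z
  <-respʳ y≈z x<y = <-≤-trans x<y (≤-reflexive y≈z)

  ≤⊎> : ∀ x y → x ≤ y ⊎ y < x
  ≤⊎> x y with em {x ≤ y}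
  ... | yes x≤y = inj₁ x≤y
  ... | no x≰y with total x y
  ...   | inj₁ x≤y = contradiction x≤y x≰y
  ...   | inj₂ y≤x = inj₂ (y≤x , λ y≈x → x≰y (≤-reflexive (sym y≈x)))

  ≯⇒≤ : ∀ {x y} → ¬ (y < x) → x ≤ y
  ≯⇒≤ {x} {y} y≮x with ≤⊎> x y
  ... | inj₁ x≤y = x≤y
  ... | inj₂ y<x = contradiction y<x y≮x

  +-mono-≤ : ∀ {x y u v} → x ≤ y → u ≤ v → x + u ≤ y + v
  +-mono-≤ {x} {y} {u} {v} x≤y u≤v = begin
    x + u   ≤⟨ +-monoˡ-≤ u x≤y ⟩
    y + u   ≈⟨ +-comm y u ⟩
    u + y   ≤⟨ +-monoˡ-≤ y u≤v ⟩
    v + y   ≈⟨ +-comm v y ⟩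
    y + v   ∎

  x≤y⇒0≤y-x : ∀ {x y} → x ≤ y → 0# ≤ y - x
  x≤y⇒0≤y-x {x} {y} x≤y = ≤-respˡ (-‿inverseʳ x) (+-monoˡ-≤ (- x) x≤y)

  -- The usual way to an inequality below: the ring solver identifies the difference of the two
  -- sides with an expression of known sign.
  ≤-by : ∀ {x y c} → 0# ≤ c → y - x ≈ c → x ≤ y
  ≤-by {x} {y} {c} 0≤c y-x≈c = begin
    x             ≈⟨ +-identityˡ x ⟨
    0# + x        ≤⟨ +-monoˡ-≤ x (≤-respʳ (sym y-x≈c) 0≤c) ⟩
    y - x + x     ≈⟨ solve 2 (λ x y → y :- x :+ x := y) refl x y ⟩
    y             ∎

  x<y⇒0<y-x : ∀ {x y} → x < y → 0# < y - x
  x<y⇒0<y-x {x} {y} (x≤y , x≉y) = x≤y⇒0≤y-x x≤y , λ 0≈y-x → x≉y (begin-equality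
    x             ≈⟨ +-identityˡ x ⟨
    0# + x        ≈⟨ +-congʳ 0≈y-x ⟩
    y - x + x     ≈⟨ solve 2 (λ x y → y :- x :+ x := y) refl x y ⟩
    y             ∎)

  <-by : ∀ {x y c} → 0# < c → y - x ≈ c → x < y
  <-by {x} {y} {c} 0<c y-x≈c = ≤-by (<⇒≤ 0<c) y-x≈c , λ x≈y → proj₂ 0<c (begin-equality
    0#      ≈⟨ -‿inverseʳ x ⟨
    x - x   ≈⟨ +-congʳ x≈y ⟩
    y - x   ≈⟨ y-x≈c ⟩
    c       ∎)

  +-mono-<-≤ : ∀ {x y u v} → x < y → u ≤ v → x + u < y + v
  +-mono-<-≤ {x} {y} {u} {v} x<y u≤v = <-≤-trans
    (<-by (x<y⇒0<y-x x<y) (solve 3 (λ x y u → (y :+ u) :- (x :+ u) := y :- x) refl x y u))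
    (+-mono-≤ ≤-refl u≤v)

  0≤-+ : ∀ {x y} → 0# ≤ x → 0# ≤ y → 0# ≤ x + y
  0≤-+ 0≤x 0≤y = ≤-respˡ (+-identityˡ 0#) (+-mono-≤ 0≤x 0≤y)

  0<-+ : ∀ {x y} → 0# < x → 0# ≤ y → 0# < x + y
  0<-+ 0<x 0≤y = ≤-<-trans (≤-reflexive (sym (+-identityˡ 0#))) (+-mono-<-≤ 0<x 0≤y)

  *-monoˡ-≤ : ∀ {x y z} → 0# ≤ z → x ≤ y → z * x ≤ z * y
  *-monoˡ-≤ {x} {y} {z} 0≤z x≤y = ≤-by (*-nonNeg 0≤z (x≤y⇒0≤y-x x≤y))
    (solve 3 (λ x y z → z :* y :- z :* x := z :* (y :- x)) refl x y z)

  *-monoʳ-≤ : ∀ {x y z} → 0# ≤ z → x ≤ y → x * z ≤ y * z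
  *-monoʳ-≤ {x} {y} {z} 0≤z x≤y =
    ≤-respˡ (*-comm z x) (≤-respʳ (*-comm z y) (*-monoˡ-≤ 0≤z x≤y))

  *-mono-≤ : ∀ {x y u v} → 0# ≤ y → 0# ≤ u → x ≤ y → u ≤ v → x * u ≤ y * v
  *-mono-≤ 0≤y 0≤u x≤y u≤v = ≤-trans (*-monoʳ-≤ 0≤u x≤y) (*-monoˡ-≤ 0≤y u≤v)

  0≤x² : ∀ x → 0# ≤ x * x
  0≤x² x with total 0# x
  ... | inj₁ 0≤x = *-nonNeg 0≤x 0≤x
  ... | inj₂ x≤0 = ≤-respʳ (solve 1 (λ x → (:0 :- x) :* (:0 :- x) := x :* x) refl x)
                     (*-nonNeg (x≤y⇒0≤y-x x≤0) (x≤y⇒0≤y-x x≤0))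

  0<1 : 0# < 1#
  0<1 = ≤-respʳ (*-identityˡ 1#) (0≤x² 1#) , 0≉1

  0≤1 : 0# ≤ 1#
  0≤1 = <⇒≤ 0<1

  ⁻¹-inverseʳ : ∀ {x} → x ≉ 0# → x * x ⁻¹ ≈ 1#
  ⁻¹-inverseʳ {x} x≉0 with em {x ≈ 0#}
  ... | yes x≈0 = contradiction x≈0 x≉0
  ... | no x≉0′ = proj₂ (invertible x x≉0′)

  0<⇒≉0 : ∀ {x} → 0# < x → x ≉ 0#
  0<⇒≉0 (_ , 0≉x) x≈0 = 0≉x (sym x≈0)

  x*x⁻¹≈1 : ∀ {x} → 0# < x → x * x ⁻¹ ≈ 1#
  x*x⁻¹≈1 = ⁻¹-inverseʳ ∘ 0<⇒≉0

  -- In the case `y ≤ x`, monotonicity turns the hypothesis into an equality, which the inverse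
  -- cancels whatever its sign.
  *-cancelˡ-≤ : ∀ {x y z} → 0# < z → z * x ≤ z * y → x ≤ y
  *-cancelˡ-≤ {x} {y} {z} 0<z zx≤zy with total x y
  ... | inj₁ x≤y = x≤y
  ... | inj₂ y≤x = ≤-reflexive (begin-equality
    x                 ≈⟨ *-identityˡ x ⟨
    1# * x            ≈⟨ *-congʳ (x*x⁻¹≈1 0<z) ⟨
    z * z ⁻¹ * x      ≈⟨ solve 3 (λ x z i → z :* i :* x := i :* (z :* x)) refl x z (z ⁻¹) ⟩
    z ⁻¹ * (z * x)    ≈⟨ *-congˡ (antisym zx≤zy (*-monoˡ-≤ (<⇒≤ 0<z) y≤x)) ⟩
    z ⁻¹ * (z * y)    ≈⟨ solve 3 (λ y z i → i :* (z :* y) := z :* i :* y) refl y z (z ⁻¹) ⟩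
    z * z ⁻¹ * y      ≈⟨ *-congʳ (x*x⁻¹≈1 0<z) ⟩
    1# * y            ≈⟨ *-identityˡ y ⟩
    y                 ∎)

  0<-* : ∀ {x y} → 0# < x → 0# < y → 0# < x * y
  0<-* {x} {y} 0<x 0<y = *-nonNeg (<⇒≤ 0<x) (<⇒≤ 0<y) , λ 0≈xy →
    <⇒≱ 0<y (*-cancelˡ-≤ 0<x (≤-reflexive (trans (sym 0≈xy) (sym (zeroʳ x)))))

  0<x⁻¹ : ∀ {x} → 0# < x → 0# < x ⁻¹
  0<x⁻¹ {x} 0<x with ≤⊎> (x ⁻¹) 0#
  ... | inj₂ 0<x⁻¹ = 0<x⁻¹
  ... | inj₁ x⁻¹≤0 = contradiction
    (begin
      1#         ≈⟨ x*x⁻¹≈1 0<x ⟨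
      x * x ⁻¹   ≤⟨ *-monoˡ-≤ (<⇒≤ 0<x) x⁻¹≤0 ⟩
      x * 0#     ≈⟨ zeroʳ x ⟩
      0#         ∎)
    (<⇒≱ 0<1)

  ½ : ℝ
  ½ = (1# + 1#) ⁻¹

  0<2 : 0# < 1# + 1#
  0<2 = 0<-+ 0<1 0≤1

  0<x½ : ∀ {x} → 0# < x → 0# < x * ½
  0<x½ 0<x = 0<-* 0<x (0<x⁻¹ 0<2)

  x½+x½≈x : ∀ x → x * ½ + x * ½ ≈ x
  x½+x½≈x x = begin-equality
    x * ½ + x * ½        ≈⟨ solve 2 (λ x h → x :* h :+ x :* h := x :* ((:1 :+ :1) :* h)) refl x ½ ⟩
    x * ((1# + 1#) * ½)  ≈⟨ *-congˡ (x*x⁻¹≈1 0<2) ⟩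
    x * 1#               ≈⟨ *-identityʳ x ⟩
    x                    ∎

  x½<x : ∀ {x} → 0# < x → x * ½ < x
  x½<x {x} 0<x = <-by (0<x½ 0<x) (begin-equality
    x - x * ½                 ≈⟨ +-congʳ (x½+x½≈x x) ⟨
    x * ½ + x * ½ - x * ½     ≈⟨ solve 1 (λ h → h :+ h :- h := h) refl (x * ½) ⟩
    x * ½                     ∎)

  midpoint : ∀ {x y} → x < y → ∃ λ z → x < z × z < y
  midpoint {x} {y} x<y = x + (y - x) * ½
    , <-by h>0 (solve 2 (λ x h → x :+ h :- x := h) refl x _)
    , <-by h>0 (begin-equality
        y - (x + h)               ≈⟨ solve 3 (λ x y h → y :- (x :+ h) := (y :- x) :- h) refl x y h ⟩
        (y - x) - h               ≈⟨ +-congʳ (x½+x½≈x (y - x)) ⟨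
        (h + h) - h               ≈⟨ solve 1 (λ h → h :+ h :- h := h) refl h ⟩
        h                         ∎)
    where
    h = (y - x) * ½
    h>0 = 0<x½ (x<y⇒0<y-x x<y)

  ≤-from-ε : ∀ {x y} → (∀ ε → 0# < ε → x ≤ y + ε) → x ≤ y
  ≤-from-ε {x} {y} x≤y+ε with ≤⊎> x y
  ... | inj₁ x≤y = x≤y
  ... | inj₂ y<x = let z , y<z , z<x = midpoint y<x in contradiction
    (≤-respʳ (solve 2 (λ y z → y :+ (z :- y) := z) refl y z)
      (x≤y+ε (z - y) (x<y⇒0<y-x y<z)))
    (<⇒≱ z<x)

  open Max totalOrder public
    using (x≤x⊔y; x≤y⊔x; ⊔-lub; ⊔-sel)

  ⊔-< : ∀ {x y z} → x < z → y < z → x ⊔ y < z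
  ⊔-< {x} {y} x<z y<z with ⊔-sel x y
  ... | inj₁ eq = ≤-<-trans (≤-reflexive eq) x<z
  ... | inj₂ eq = ≤-<-trans (≤-reflexive eq) y<z

  x≤∣x∣ : ∀ x → x ≤ ∣ x ∣
  x≤∣x∣ x = x≤x⊔y x (- x)

  -x≤∣x∣ : ∀ x → - x ≤ ∣ x ∣
  -x≤∣x∣ x = x≤y⊔x x (- x)

  ∣x∣≤ : ∀ {x c} → x ≤ c → - x ≤ c → ∣ x ∣ ≤ c
  ∣x∣≤ = ⊔-lub

  0≤∣x∣ : ∀ x → 0# ≤ ∣ x ∣
  0≤∣x∣ x with total 0# x
  ... | inj₁ 0≤x = ≤-trans 0≤x (x≤∣x∣ x)
  ... | inj₂ x≤0 = ≤-trans (≤-respʳ (+-identityˡ (- x)) (x≤y⇒0≤y-x x≤0)) (-x≤∣x∣ x)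

  0≤x⇒∣x∣≈x : ∀ {x} → 0# ≤ x → ∣ x ∣ ≈ x
  0≤x⇒∣x∣≈x {x} 0≤x = antisym
    (∣x∣≤ ≤-refl (≤-by (0≤-+ 0≤x 0≤x) (solve 1 (λ x → x :- (:- x) := x :+ x) refl x)))
    (x≤∣x∣ x)

  Sup-isSupremum : ∀ {P} → ∃ P → ∃ (IsUpperBound P) → IsSupremum P (Sup P)
  Sup-isSupremum {P} nonempty bounded with em {∃ P} ×-dec em {∃ (IsUpperBound P)}
  ... | yes (nonempty′ , bounded′) = proj₂ (complete P nonempty′ bounded′)
  ... | no none                    = contradiction (nonempty , bounded) none

  0≤Sup : ∀ {P} → (∀ x → P x → 0# ≤ x) → 0# ≤ Sup P
  0≤Sup {P} nonNeg with em {∃ P} ×-dec em {∃ (IsUpperBound P)}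
  ... | yes ((x , Px) , bounded) =
    ≤-trans (nonNeg x Px) (proj₁ (proj₂ (complete P (x , Px) bounded)) x Px)
  ... | no none                  = ≤-refl

  -- `0# ≤ u` covers the default value: an empty `P` has `Sup P` equal to 0, whatever its upper
  -- bounds are.
  Sup≤ : ∀ {P u} → 0# ≤ u → IsUpperBound P u → Sup P ≤ u
  Sup≤ {P} {u} 0≤u upper with em {∃ P} ×-dec em {∃ (IsUpperBound P)}
  ... | yes (nonempty , bounded) = proj₂ (proj₂ (complete P nonempty bounded)) u upper
  ... | no none                  = 0≤u

  x≤Sup : ∀ {P x} → ∃ (IsUpperBound P) → P x → x ≤ Sup P
  x≤Sup {P} {x} bounded Px = proj₁ (Sup-isSupremum (x , Px) bounded) x Px

  0≤ι : ∀ n → 0# ≤ ι n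
  0≤ι zero    = ≤-refl
  0≤ι (suc n) = 0≤-+ 0≤1 (0≤ι n)

  ι-mono : ∀ {m n} → m ℕ.≤ n → ι m ≤ ι n
  ι-mono {n = n} ℕ.z≤n = 0≤ι n
  ι-mono (ℕ.s≤s m≤n)   = +-mono-≤ ≤-refl (ι-mono m≤n)

  0<ι : ∀ {n} → 1 ℕ.≤ n → 0# < ι n
  0<ι {suc n} _ = 0<-+ 0<1 (0≤ι n)

  -- Otherwise the naturals are bounded by `x` and have a supremum `s`. As every `ι (suc n)` is at
  -- most `s`, already `s - 1#` is an upper bound, smaller than the least one.
  archimedean : ∀ x → ∃ λ n → x ≤ ι n
  archimedean x with em {∃ λ n → x ≤ ι n}
  ... | yes found = found
  ... | no ∄n = contradiction s≤s-1 (<⇒≱ s-1<s)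
    where
    P : ℝ → Set
    P y = ∃ λ n → y ≈ ι n

    ι≤x : IsUpperBound P x
    ι≤x y (n , y≈ιn) with total x (ι n)
    ... | inj₁ x≤ιn = contradiction (n , x≤ιn) ∄n
    ... | inj₂ ιn≤x = ≤-respˡ (sym y≈ιn) ιn≤x

    s = proj₁ (complete P (0# , 0 , refl) (x , ι≤x))
    s-isSup = proj₂ (complete P (0# , 0 , refl) (x , ι≤x))

    s-1<s : s - 1# < s
    s-1<s = <-by 0<1 (solve 1 (λ s → s :- (s :- :1) := :1) refl s)

    s≤s-1 : s ≤ s - 1#
    s≤s-1 = proj₂ s-isSup (s - 1#) λ y (n , y≈ιn) → ≤-respˡ (sym y≈ιn)
      (≤-by (x≤y⇒0≤y-x (proj₁ s-isSup (ι (suc n)) (suc n , refl)))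
        (solve 2 (λ s i → (s :- :1) :- i := s :- (:1 :+ i)) refl s (ι n)))

  Eventually-map : ∀ {P Q : ℕ → Set} → (∀ K → P K → Q K) → Eventually P → Eventually Q
  Eventually-map f (N , p) = N , λ K N≤K → f K (p K N≤K)

  Eventually-zip : ∀ {P Q R : ℕ → Set} → (∀ K → P K → Q K → R K) →
                   Eventually P → Eventually Q → Eventually R
  Eventually-zip f (M , p) (N , q) = M ℕ.⊔ N , λ K M⊔N≤K →
    f K (p K (ℕ.m⊔n≤o⇒m≤o M N M⊔N≤K)) (q K (ℕ.m⊔n≤o⇒n≤o M N M⊔N≤K))

  Eventually-const : ∀ {P : Set} → Eventually (λ _ → P) → P
  Eventually-const (N , p) = p N ℕ.≤-refl

  Eventually-suc : ∀ {P : ℕ → Set} → Eventually P → Eventually (P ∘ suc)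
  Eventually-suc (N , p) = N , λ K N≤K → p (suc K) (ℕ.m≤n⇒m≤1+n N≤K)

  -- Meant for non-negative sequences: there is no lower bound on u K.
  Null : (ℕ → ℝ) → Set
  Null u = ∀ ε → 0# < ε → Eventually λ K → u K ≤ ε

  Null-≤ : ∀ {u v} → Eventually (λ K → u K ≤ v K) → Null v → Null u
  Null-≤ u≤v v→0 ε 0<ε = Eventually-zip (λ K → ≤-trans) u≤v (v→0 ε 0<ε)

  Null-+ : ∀ {u v} → Null u → Null v → Null (λ K → u K + v K)
  Null-+ u→0 v→0 ε 0<ε = Eventually-zip
    (λ K u≤ v≤ → ≤-respʳ (x½+x½≈x ε) (+-mono-≤ u≤ v≤))
    (u→0 _ (0<x½ 0<ε)) (v→0 _ (0<x½ 0<ε))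

  -- The denominator is `1# + k` rather than `k`, so that `k ≈ 0#` needs no case of its own.
  absorb : ∀ {k ε} → 0# ≤ k → 0# < ε → ∃ λ δ → 0# < δ × (∀ {x} → x ≤ δ → k * x ≤ ε)
  absorb {k} {ε} 0≤k 0<ε = ε * m ⁻¹ , 0<δ , λ {x} x≤δ → begin
    k * x              ≤⟨ *-monoˡ-≤ 0≤k x≤δ ⟩
    k * (ε * m ⁻¹)     ≤⟨ *-monoʳ-≤ (<⇒≤ 0<δ) (≤-by 0≤1 (solve 1 (λ k → (:1 :+ k) :- k := :1) refl k)) ⟩
    m * (ε * m ⁻¹)     ≈⟨ solve 3 (λ m e i → m :* (e :* i) := e :* (m :* i)) refl m ε (m ⁻¹) ⟩
    ε * (m * m ⁻¹)     ≈⟨ *-congˡ (x*x⁻¹≈1 0<m) ⟩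
    ε * 1#             ≈⟨ *-identityʳ ε ⟩
    ε                  ∎
    where
    m = 1# + k
    0<m = 0<-+ 0<1 0≤k
    0<δ = 0<-* 0<ε (0<x⁻¹ 0<m)

  Null-* : ∀ {u} c → 0# ≤ c → Null u → Null (λ K → c * u K)
  Null-* c 0≤c u→0 ε 0<ε =
    let δ , 0<δ , small = absorb 0≤c 0<ε in Eventually-map (λ K → small) (u→0 δ 0<δ)

  Null-const⇒≤ : ∀ {x u} → Null u → (∀ K → x ≤ u K) → x ≤ 0#
  Null-const⇒≤ u→0 x≤u = ≤-from-ε λ ε 0<ε →
    ≤-respʳ (sym (+-identityˡ ε)) (Eventually-const (Eventually-map (λ K → ≤-trans (x≤u K)) (u→0 ε 0<ε)))

  ι⁻¹-null : Null (λ K → ι K ⁻¹)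
  ι⁻¹-null ε 0<ε = let n , ε⁻¹≤ιn = archimedean (ε ⁻¹) in suc n , λ K n<K →
    let 0<ιK = 0<ι (ℕ.≤-trans (ℕ.s≤s ℕ.z≤n) n<K) in
    *-cancelˡ-≤ (0<-* 0<ιK (0<x⁻¹ 0<ε)) (begin
      ι K * ε ⁻¹ * ι K ⁻¹
        ≈⟨ solve 3 (λ k e i → k :* e :* i := e :* (k :* i)) refl (ι K) (ε ⁻¹) (ι K ⁻¹) ⟩
      ε ⁻¹ * (ι K * ι K ⁻¹)     ≈⟨ *-congˡ (x*x⁻¹≈1 0<ιK) ⟩
      ε ⁻¹ * 1#                 ≈⟨ *-identityʳ _ ⟩
      ε ⁻¹                      ≤⟨ ε⁻¹≤ιn ⟩
      ι n                       ≤⟨ ι-mono (ℕ.≤-trans (ℕ.n≤1+n n) n<K) ⟩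
      ι K                       ≈⟨ *-identityʳ _ ⟨
      ι K * 1#                  ≈⟨ *-congˡ (x*x⁻¹≈1 0<ε) ⟨
      ι K * (ε * ε ⁻¹)          ≈⟨ solve 3 (λ k e i → k :* (e :* i) := k :* i :* e) refl (ι K) ε (ε ⁻¹) ⟩
      ι K * ε ⁻¹ * ε            ∎)

  0≤^ : ∀ {a} n → 0# ≤ a → 0# ≤ a ^ n
  0≤^ zero    0≤a = 0≤1
  0≤^ (suc n) 0≤a = *-nonNeg 0≤a (0≤^ n 0≤a)

  -- Bernoulli's inequality without division: for a < 1 it bounds a^n by 1/(1 + n(1 - a)), which
  -- makes the powers vanish. From n to n + 1 the left-hand side drops by a^n (n + 1)(1 - a)^2.
  bernoulli : ∀ {a} n → 0# ≤ a → a ^ n * (1# + ι n * (1# - a)) ≤ 1#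
  bernoulli {a} zero    0≤a = ≤-reflexive
    (solve 1 (λ a → :1 :* (:1 :+ :0 :* (:1 :- a)) := :1) refl a)
  bernoulli {a} (suc n) 0≤a = ≤-trans
    (≤-by (*-nonNeg (*-nonNeg (0≤^ n 0≤a) (0≤ι (suc n))) (0≤x² (1# - a)))
      (solve 3 (λ a p k → p :* (:1 :+ k :* (:1 :- a)) :- a :* p :* (:1 :+ (:1 :+ k) :* (:1 :- a))
                 := p :* (:1 :+ k) :* ((:1 :- a) :* (:1 :- a))) refl a (a ^ n) (ι n)))
    (bernoulli n 0≤a)

  ^-null : ∀ {a} → 0# ≤ a → a < 1# → Null (a ^_)
  ^-null {a} 0≤a a<1 ε 0<ε =
    Eventually-zip small (ι⁻¹-null (h * ε) (0<-* 0<h 0<ε)) (1 , λ K 1≤K → 0<ι 1≤K)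
    where
    h = 1# - a
    0<h = x<y⇒0<y-x a<1
    small : ∀ K → ι K ⁻¹ ≤ h * ε → 0# < ι K → a ^ K ≤ ε
    small K ιK⁻¹≤ 0<ιK = *-cancelˡ-≤ (0<-* 0<ιK 0<h) (begin
      ι K * h * a ^ K
        ≤⟨ ≤-by (0≤^ K 0≤a) (solve 2 (λ p q → p :* (:1 :+ q) :- q :* p := p) refl (a ^ K) (ι K * h)) ⟩
      a ^ K * (1# + ι K * h)          ≤⟨ bernoulli K 0≤a ⟩
      1#                              ≈⟨ x*x⁻¹≈1 0<ιK ⟨
      ι K * ι K ⁻¹                    ≤⟨ *-monoˡ-≤ (<⇒≤ 0<ιK) ιK⁻¹≤ ⟩
      ι K * (h * ε)                   ≈⟨ *-assoc _ _ _ ⟨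
      ι K * h * ε                     ∎)

  -- The one-sided inequality suffices, since `m` and `n` may be exchanged.
  Cauchy : (ℕ → ℝ) → Set
  Cauchy f = ∀ ε → 0# < ε → ∃ λ N → ∀ m n → N ℕ.≤ m → N ℕ.≤ n → f m ≤ f n + ε

  -- The limit is the lower limit, the supremum of the numbers lying eventually below `f`: for large
  -- n, `f n - ε` is such a number and `f n + ε` bounds all of them.
  cauchy-converges : ∀ f → Cauchy f → ∃ λ l → Null (λ n → ∣ f n - l ∣)
  cauchy-converges f cauchy = l , λ ε 0<ε →
    let N , close = cauchy ε 0<ε in N , λ n N≤n →
    ∣x∣≤ (≤-by (x≤y⇒0≤y-x (proj₁ l-isSup (f n - ε) (N , λ m N≤m →
                 ≤-by (x≤y⇒0≤y-x (close n m N≤n N≤m))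
                   (solve 3 (λ x y e → y :- (x :- e) := (y :+ e) :- x) refl (f n) (f m) ε))))
            (solve 3 (λ x l e → e :- (x :- l) := l :- (x :- e)) refl (f n) l ε))
         (≤-by (x≤y⇒0≤y-x (proj₂ l-isSup (f n + ε) λ y (M , y≤) →
                 ≤-trans (y≤ (M ℕ.⊔ N) (ℕ.m≤m⊔n M N)) (close (M ℕ.⊔ N) n (ℕ.m≤n⊔m M N) N≤n)))
            (solve 3 (λ x l e → e :- (:- (x :- l)) := (x :+ e) :- l) refl (f n) l ε))
    where
    P : ℝ → Set
    P x = Eventually λ n → x ≤ f n

    N₁ = proj₁ (cauchy 1# 0<1)
    close₁ = proj₂ (cauchy 1# 0<1)

    nonempty : ∃ P
    nonempty = f N₁ - 1# , N₁ , λ n N₁≤n →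
      ≤-by (x≤y⇒0≤y-x (close₁ N₁ n ℕ.≤-refl N₁≤n))
        (solve 2 (λ x y → y :- (x :- :1) := (y :+ :1) :- x) refl (f N₁) (f n))

    bounded : ∃ (IsUpperBound P)
    bounded = f N₁ + 1# , λ y (M , y≤) →
      ≤-trans (y≤ (M ℕ.⊔ N₁) (ℕ.m≤m⊔n M N₁)) (close₁ (M ℕ.⊔ N₁) N₁ (ℕ.m≤n⊔m M N₁) ℕ.≤-refl)

    l = proj₁ (complete P nonempty bounded)
    l-isSup = proj₂ (complete P nonempty bounded)

  maximum : ∀ {n} → (Fin n → ℝ) → ℝ
  maximum {zero}  f = 0#
  maximum {suc n} f = f zero ⊔ maximum (f ∘ suc)

  ≤-maximum : ∀ {n} (f : Fin n → ℝ) i → f i ≤ maximum f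
  ≤-maximum f zero    = x≤x⊔y _ _
  ≤-maximum f (suc i) = ≤-trans (≤-maximum (f ∘ suc) i) (x≤y⊔x _ _)

  maximum-≤ : ∀ {n} (f : Fin n → ℝ) {c} → 0# ≤ c → (∀ i → f i ≤ c) → maximum f ≤ c
  maximum-≤ {zero}  f 0≤c f≤c = 0≤c
  maximum-≤ {suc n} f 0≤c f≤c = ⊔-lub (f≤c zero) (maximum-≤ (f ∘ suc) 0≤c (f≤c ∘ suc))

  0≤maximum : ∀ {n} (f : Fin n → ℝ) → 0# ≤ maximum f
  0≤maximum {zero}  f = ≤-refl
  0≤maximum {suc n} f = ≤-trans (0≤maximum (f ∘ suc)) (x≤y⊔x _ _)

  open SemiringSum (CommutativeRing.semiring commutativeRing) public
    using (*-distribˡ-sum; *-distribʳ-sum; sum-cong-≋; ∑-distrib-+)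

  0≤sum : ∀ {n} {f : Fin n → ℝ} → (∀ i → 0# ≤ f i) → 0# ≤ sum f
  0≤sum {zero}  0≤f = ≤-refl
  0≤sum {suc n} 0≤f = 0≤-+ (0≤f zero) (0≤sum (0≤f ∘ suc))

  -- Once `e K ≤ (1# - a) * δ`, the number `δ` is a fixed point of the majorising map u ↦ au + (1 -
  -- a)δ, so the excess over `δ` shrinks by the factor `a` at each step. Half of `ε` goes to `δ`,
  -- the other half to that excess.
  contraction-null : ∀ {a} (u e : ℕ → ℝ) → 0# ≤ a → a < 1# → Null e →
                     Eventually (λ K → u (suc K) ≤ a * u K + e K) → Null u
  contraction-null {a} u e 0≤a a<1 e→0 step ε 0<ε = M ℕ.+ N , λ K M+N≤K →
    let n = K ℕ.∸ N
        n+N≡K = ℕ.m∸n+n≡m (ℕ.≤-trans (ℕ.m≤n+m N M) M+N≤K)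
        M≤n = ℕ.≤-trans (ℕ.≤-reflexive (≡.sym (ℕ.m+n∸n≡m M N))) (ℕ.∸-monoˡ-≤ N M+N≤K)
    in ≡.subst (λ k → u k ≤ ε) n+N≡K (begin
         u (n ℕ.+ N)            ≤⟨ bound n ⟩
         v * a ^ n + δ          ≤⟨ +-mono-≤ (small n M≤n) ≤-refl ⟩
         δ + δ                  ≈⟨ x½+x½≈x ε ⟩
         ε                      ∎)
    where
    δ = ε * ½
    0<δ = 0<x½ 0<ε

    steps : Eventually λ K → u (suc K) ≤ a * u K + e K × e K ≤ (1# - a) * δ
    steps = Eventually-zip (λ K p q → p , q) step
              (e→0 ((1# - a) * δ) (0<-* (x<y⇒0<y-x a<1) 0<δ))

    N = proj₁ steps
    -- `u` carries no sign, while `Null-*` asks for a non-negative factor.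
    v = u N ⊔ 0#

    bound : ∀ n → u (n ℕ.+ N) ≤ v * a ^ n + δ
    bound zero    = begin
      u N              ≤⟨ x≤x⊔y (u N) 0# ⟩
      v                ≤⟨ ≤-by (<⇒≤ 0<δ) (solve 2 (λ v e → (v :* :1 :+ e) :- v := e) refl v δ) ⟩
      v * 1# + δ       ∎
    bound (suc n) = let p , q = proj₂ steps (n ℕ.+ N) (ℕ.m≤n+m N n) in begin
      u (suc (n ℕ.+ N))                       ≤⟨ p ⟩
      a * u (n ℕ.+ N) + e (n ℕ.+ N)           ≤⟨ +-mono-≤ (*-monoˡ-≤ 0≤a (bound n)) q ⟩
      a * (v * a ^ n + δ) + (1# - a) * δ
        ≈⟨ solve 4 (λ a v p e → a :* (v :* p :+ e) :+ (:1 :- a) :* e := v :* (a :* p) :+ e) refl a v (a ^ n) δ ⟩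
      v * (a * a ^ n) + δ                     ∎

    vanishing : Eventually λ n → v * a ^ n ≤ δ
    vanishing = Null-* v (x≤y⊔x (u N) 0#) (^-null 0≤a a<1) δ 0<δ

    M = proj₁ vanishing
    small = proj₂ vanishing

-- Square roots, the field of complex numbers and its modulus.

module ComplexNumbers (em : ExcludedMiddle 0ℓ) (𝐑 : CompleteOrderedField) where
  open Analysis em 𝐑
  open RealAnalysis em 𝐑

  ²-cancel-≤ : ∀ {x y} → 0# ≤ y → x * x ≤ y * y → x ≤ y
  ²-cancel-≤ {x} {y} 0≤y x²≤y² with ≤⊎> x y
  ... | inj₁ x≤y = x≤y
  ... | inj₂ y<x = contradiction x²≤y² (<⇒≱ (<-by
    (0<-* (x<y⇒0<y-x y<x) (<-≤-trans (≤-<-trans 0≤y y<x) (≤-by 0≤y (solve 2 (λ x y → (x :+ y) :- x := y) refl x y))))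
    (solve 2 (λ x y → x :* x :- y :* y := (x :- y) :* (x :+ y)) refl x y)))

  ²-injective : ∀ {x y} → 0# ≤ x → 0# ≤ y → x * x ≈ y * y → x ≈ y
  ²-injective 0≤x 0≤y x²≈y² =
    antisym (²-cancel-≤ 0≤y (≤-reflexive x²≈y²)) (²-cancel-≤ 0≤x (≤-reflexive (sym x²≈y²)))

  root-bounded : ∀ n a → 1 ℕ.≤ n → ∃ (IsUpperBound λ y → 0# ≤ y × y ^ n ≤ a)
  root-bounded (suc n) a _ = 1# + ∣ a ∣ , upper
    where
    1≤^ : ∀ {y} n → 1# ≤ y → 1# ≤ y ^ n
    1≤^ zero    1≤y = ≤-refl
    1≤^ (suc n) 1≤y = ≤-respˡ (*-identityˡ 1#) (*-mono-≤ (≤-trans 0≤1 1≤y) 0≤1 1≤y (1≤^ n 1≤y))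

    upper : IsUpperBound (λ y → 0# ≤ y × y ^ suc n ≤ a) (1# + ∣ a ∣)
    upper y (0≤y , yⁿ≤a) with total y 1#
    ... | inj₁ y≤1 = ≤-trans y≤1 (≤-by (0≤∣x∣ a) (solve 1 (λ m → (:1 :+ m) :- :1 := m) refl ∣ a ∣))
    ... | inj₂ 1≤y = begin
      y              ≈⟨ *-identityʳ y ⟨
      y * 1#         ≤⟨ *-monoˡ-≤ 0≤y (1≤^ n 1≤y) ⟩
      y * y ^ n      ≤⟨ yⁿ≤a ⟩
      a              ≤⟨ x≤∣x∣ a ⟩
      ∣ a ∣          ≤⟨ ≤-by 0≤1 (solve 1 (λ m → (:1 :+ m) :- m := :1) refl ∣ a ∣) ⟩
      1# + ∣ a ∣     ∎

  ≤-root : ∀ {n y a} → 1 ℕ.≤ n → 0# ≤ y → y ^ n ≤ a → y ≤ root n a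
  ≤-root {n} {y} {a} 1≤n 0≤y yⁿ≤a = x≤Sup (root-bounded n a 1≤n) (0≤y , yⁿ≤a)

  0≤root : ∀ n a → 0# ≤ root n a
  0≤root n a = 0≤Sup λ y → proj₁

  y^2≈y*y : ∀ y → y ^ 2 ≈ y * y
  y^2≈y*y y = *-congˡ (*-identityʳ y)

  -- Either strict inequality contradicts the supremum: if `s * s` falls short of `a`, a slightly
  -- larger number is still admissible; if it exceeds `a`, a slightly smaller one is already an
  -- upper bound.
  root² : ∀ {a} → 0# ≤ a → root 2 a * root 2 a ≈ a
  root² {a} 0≤a = antisym (≯⇒≤ too-large) (≯⇒≤ too-small)
    where
    s = root 2 a
    0≤s = 0≤root 2 a
    1≤2 = ℕ.s≤s (ℕ.z≤n {1})

    too-small : ¬ (s * s < a)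
    too-small s²<a = <⇒≱ (<-by 0<δ (solve 2 (λ s d → (s :+ d) :- s := d) refl s δ))
      (≤-root {2} 1≤2 (0≤-+ 0≤s (<⇒≤ 0<δ)) (≤-respˡ (sym (y^2≈y*y (s + δ))) (begin
        (s + δ) * (s + δ)            ≤⟨ ≤-by (*-nonNeg (<⇒≤ 0<δ) (x≤y⇒0≤y-x δ≤gap))
                                          (solve 3 (λ s d g → (s :* s :+ d :* (:1 :+ (s :+ s :+ g))) :- (s :+ d) :* (s :+ d) := d :* ((:1 :+ g) :- d)) refl s δ gap) ⟩
        s * s + δ * m                ≈⟨ +-congˡ δm≈gap ⟩
        s * s + gap                  ≈⟨ solve 2 (λ x a → x :+ (a :- x) := a) refl (s * s) a ⟩
        a                            ∎)))
      where
      gap = a - s * s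
      0<gap = x<y⇒0<y-x s²<a
      m = 1# + (s + s + gap)
      0<m = 0<-+ 0<1 (0≤-+ (0≤-+ 0≤s 0≤s) (<⇒≤ 0<gap))
      -- As δ ≤ 1 + `gap`, the factor 2s + δ is at most `m`, whence (s + δ)^2 ≤ s^2 + δm = a.
      δ = gap * m ⁻¹
      0<δ = 0<-* 0<gap (0<x⁻¹ 0<m)
      δm≈gap : δ * m ≈ gap
      δm≈gap = trans (solve 3 (λ g i m → g :* i :* m := g :* (m :* i)) refl gap (m ⁻¹) m)
                 (trans (*-congˡ (x*x⁻¹≈1 0<m)) (*-identityʳ gap))
      δ≤gap : δ ≤ 1# + gap
      δ≤gap = ≤-by (0≤-+ 0≤1 (*-nonNeg (<⇒≤ 0<δ) (0≤-+ (0≤-+ 0≤s 0≤s) (<⇒≤ 0<gap))))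
        (begin-equality
          1# + gap - δ                            ≈⟨ +-congʳ (+-congˡ δm≈gap) ⟨
          1# + δ * m - δ
            ≈⟨ solve 3 (λ d s g → :1 :+ d :* (:1 :+ (s :+ s :+ g)) :- d := :1 :+ d :* (s :+ s :+ g)) refl δ s gap ⟩
          1# + δ * (s + s + gap)                  ∎)

    too-large : ¬ (a < s * s)
    too-large a<s² with ≤⊎> s 0#
    ... | inj₁ s≤0 = <⇒≱ (≤-<-trans 0≤a a<s²)
      (≤-respʳ (zeroˡ s) (*-monoʳ-≤ 0≤s s≤0))
    ... | inj₂ 0<s = <⇒≱ (<-by 0<δ (solve 2 (λ s d → s :- (s :- d) := d) refl s δ))
      (Sup≤ 0≤u λ y (_ , y²≤a) → ²-cancel-≤ 0≤u (begin
        y * y                   ≈⟨ y^2≈y*y y ⟨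
        y ^ 2                   ≤⟨ y²≤a ⟩
        a                       ≈⟨ solve 2 (λ x a → x :- (x :- a) := a) refl (s * s) a ⟨
        s * s - gap             ≈⟨ +-congˡ (-‿cong δ2s≈gap) ⟨
        s * s - δ * (s + s)
          ≤⟨ ≤-by (0≤x² δ) (solve 2 (λ s d → (s :- d) :* (s :- d) :- (s :* s :- d :* (s :+ s)) := d :* d) refl s δ) ⟩
        (s - δ) * (s - δ)       ∎))
      where
      gap = s * s - a
      0<gap = x<y⇒0<y-x a<s²
      0<2s = 0<-+ 0<s 0≤s
      -- With 2sδ equal to `gap`, (s - δ)^2 = a + δ^2 is still at least `a`.
      δ = gap * (s + s) ⁻¹
      0<δ = 0<-* 0<gap (0<x⁻¹ 0<2s)
      δ2s≈gap : δ * (s + s) ≈ gap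
      δ2s≈gap = trans (solve 3 (λ g i m → g :* i :* m := g :* (m :* i)) refl gap ((s + s) ⁻¹) (s + s))
                 (trans (*-congˡ (x*x⁻¹≈1 0<2s)) (*-identityʳ gap))
      0≤u : 0# ≤ s - δ
      0≤u = *-cancelˡ-≤ 0<2s (≤-by (0≤-+ (0≤x² s) 0≤a) (begin-equality
        (s + s) * (s - δ) - (s + s) * 0#
          ≈⟨ solve 2 (λ s d → (s :+ s) :* (s :- d) :- (s :+ s) :* :0 := (s :* s :+ s :* s) :- d :* (s :+ s)) refl s δ ⟩
        (s * s + s * s) - δ * (s + s)      ≈⟨ +-congˡ (-‿cong δ2s≈gap) ⟩
        (s * s + s * s) - (s * s - a)
          ≈⟨ solve 2 (λ x a → (x :+ x) :- (x :- a) := x :+ a) refl (s * s) a ⟩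
        s * s + a                          ∎))

  ℂ-commutativeRing : CommutativeRing 0ℓ 0ℓ
  ℂ-commutativeRing = record
    { Carrier = ℂ ; _≈_ = _≈ᶜ_ ; _+_ = _+ᶜ_ ; _*_ = _*ᶜ_ ; -_ = -ᶜ_ ; 0# = 0ᶜ ; 1# = 1ᶜ
    ; isCommutativeRing = record
      { isRing = record
        { +-isAbelianGroup = record
          { isGroup = record
            { isMonoid = record
              { isSemigroup = record
                { isMagma = record
                  { isEquivalence = record
                    { refl  = refl , refl
                    ; sym   = λ (p , q) → sym p , sym q
                    ; trans = λ (p , q) (p′ , q′) → trans p p′ , trans q q′ }
                  ; ∙-cong = λ (p , q) (p′ , q′) → +-cong p p′ , +-cong q q′ }
                ; assoc = λ z w v → +-assoc _ _ _ , +-assoc _ _ _ }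
              ; identity = (λ z → +-identityˡ _ , +-identityˡ _)
                         , (λ z → +-identityʳ _ , +-identityʳ _) }
            ; inverse = (λ z → -‿inverseˡ _ , -‿inverseˡ _) , (λ z → -‿inverseʳ _ , -‿inverseʳ _)
            ; ⁻¹-cong = λ (p , q) → -‿cong p , -‿cong q }
          ; comm = λ z w → +-comm _ _ , +-comm _ _ }
        ; *-cong = λ (p , q) (p′ , q′) → +-cong (*-cong p p′) (-‿cong (*-cong q q′))
                                        , +-cong (*-cong p q′) (*-cong q p′)
        ; *-assoc = λ (a +i b) (c +i d) (e +i f) →
            solve 6 (λ a b c d e f → (a :* c :- b :* d) :* e :- (a :* d :+ b :* c) :* f
                                   := a :* (c :* e :- d :* f) :- b :* (c :* f :+ d :* e)) refl a b c d e f ,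
            solve 6 (λ a b c d e f → (a :* c :- b :* d) :* f :+ (a :* d :+ b :* c) :* e
                                   := a :* (c :* f :+ d :* e) :+ b :* (c :* e :- d :* f)) refl a b c d e f
        ; *-identity = (λ (a +i b) → solve 2 (λ a b → :1 :* a :- :0 :* b := a) refl a b ,
                                     solve 2 (λ a b → :1 :* b :+ :0 :* a := b) refl a b)
                     , (λ (a +i b) → solve 2 (λ a b → a :* :1 :- b :* :0 := a) refl a b ,
                                     solve 2 (λ a b → a :* :0 :+ b :* :1 := b) refl a b)
        ; distrib = (λ (a +i b) (c +i d) (e +i f) →
            solve 6 (λ a b c d e f → a :* (c :+ e) :- b :* (d :+ f)
                                   := (a :* c :- b :* d) :+ (a :* e :- b :* f)) refl a b c d e f ,
            solve 6 (λ a b c d e f → a :* (d :+ f) :+ b :* (c :+ e)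
                                   := (a :* d :+ b :* c) :+ (a :* f :+ b :* e)) refl a b c d e f)
                  , (λ (a +i b) (c +i d) (e +i f) →
            solve 6 (λ a b c d e f → (c :+ e) :* a :- (d :+ f) :* b
                                   := (c :* a :- d :* b) :+ (e :* a :- f :* b)) refl a b c d e f ,
            solve 6 (λ a b c d e f → (c :+ e) :* b :+ (d :+ f) :* a
                                   := (c :* b :+ d :* a) :+ (e :* b :+ f :* a)) refl a b c d e f) }
      ; *-comm = λ (a +i b) (c +i d) →
          solve 4 (λ a b c d → a :* c :- b :* d := c :* a :- d :* b) refl a b c d ,
          solve 4 (λ a b c d → a :* d :+ b :* c := c :* b :+ d :* a) refl a b c d } }
    where open CommutativeRing commutativeRing using (+-assoc; -‿inverseˡ)

  module ℂᵣ = CommutativeRing ℂ-commutativeRing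
  module ℂₛ = IntegerSolver ℂ-commutativeRing
  module ℂΣ = SemiringSum ℂᵣ.semiring

  normSq-cong : ∀ {z w} → z ≈ᶜ w → normSq z ≈ normSq w
  normSq-cong (p , q) = +-cong (*-cong p p) (*-cong q q)

  0≤normSq : ∀ z → 0# ≤ normSq z
  0≤normSq z = 0≤-+ (0≤x² (re z)) (0≤x² (im z))

  0≤∣∣ᶜ : ∀ z → 0# ≤ ∣ z ∣ᶜ
  0≤∣∣ᶜ z = 0≤root 2 (normSq z)

  ∣∣ᶜ² : ∀ z → ∣ z ∣ᶜ * ∣ z ∣ᶜ ≈ normSq z
  ∣∣ᶜ² z = root² (0≤normSq z)

  -- The modulus is defined through a supremum. Here it is replaced by the equation for its square,
  -- which leaves identities between moduli to the ring solver.
  ∣∣ᶜ-unique : ∀ {z x} → 0# ≤ x → normSq z ≈ x * x → ∣ z ∣ᶜ ≈ x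
  ∣∣ᶜ-unique {z} 0≤x eq = ²-injective (0≤∣∣ᶜ z) 0≤x (trans (∣∣ᶜ² z) eq)

  ∣∣ᶜ-cong : ∀ {z w} → z ≈ᶜ w → ∣ z ∣ᶜ ≈ ∣ w ∣ᶜ
  ∣∣ᶜ-cong {z} {w} z≈w = ∣∣ᶜ-unique {z} (0≤∣∣ᶜ w) (trans (normSq-cong {z} {w} z≈w) (sym (∣∣ᶜ² w)))

  ∣zw∣≈∣z∣∣w∣ : ∀ z w → ∣ z *ᶜ w ∣ᶜ ≈ ∣ z ∣ᶜ * ∣ w ∣ᶜ
  ∣zw∣≈∣z∣∣w∣ z@(a +i b) w@(c +i d) = ∣∣ᶜ-unique {z *ᶜ w} (*-nonNeg (0≤∣∣ᶜ z) (0≤∣∣ᶜ w)) (begin-equality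
    normSq (z *ᶜ w)
      ≈⟨ solve 4 (λ a b c d → (a :* c :- b :* d) :* (a :* c :- b :* d) :+ (a :* d :+ b :* c) :* (a :* d :+ b :* c)
          := (a :* a :+ b :* b) :* (c :* c :+ d :* d)) refl a b c d ⟩
    normSq z * normSq w                            ≈⟨ *-cong (∣∣ᶜ² z) (∣∣ᶜ² w) ⟨
    ∣ z ∣ᶜ * ∣ z ∣ᶜ * (∣ w ∣ᶜ * ∣ w ∣ᶜ)
      ≈⟨ solve 2 (λ x y → x :* x :* (y :* y) := x :* y :* (x :* y)) refl ∣ z ∣ᶜ ∣ w ∣ᶜ ⟩
    ∣ z ∣ᶜ * ∣ w ∣ᶜ * (∣ z ∣ᶜ * ∣ w ∣ᶜ)            ∎)

  ∣x∣*∣x∣≈x*x : ∀ x → ∣ x ∣ * ∣ x ∣ ≈ x * x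
  ∣x∣*∣x∣≈x*x x with ⊔-sel x (- x)
  ... | inj₁ ∣x∣≈x  = *-cong ∣x∣≈x ∣x∣≈x
  ... | inj₂ ∣x∣≈-x = trans (*-cong ∣x∣≈-x ∣x∣≈-x) (solve 1 (λ x → (:- x) :* (:- x) := x :* x) refl x)

  ∣re∣≤∣∣ᶜ : ∀ z → ∣ re z ∣ ≤ ∣ z ∣ᶜ
  ∣re∣≤∣∣ᶜ z = ²-cancel-≤ (0≤∣∣ᶜ z) (begin
    ∣ re z ∣ * ∣ re z ∣    ≈⟨ ∣x∣*∣x∣≈x*x (re z) ⟩
    re z * re z            ≤⟨ ≤-by (0≤x² (im z)) (solve 2 (λ x y → (x :+ y) :- x := y) refl _ _) ⟩
    normSq z               ≈⟨ ∣∣ᶜ² z ⟨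
    ∣ z ∣ᶜ * ∣ z ∣ᶜ        ∎)

  ∣im∣≤∣∣ᶜ : ∀ z → ∣ im z ∣ ≤ ∣ z ∣ᶜ
  ∣im∣≤∣∣ᶜ z = ²-cancel-≤ (0≤∣∣ᶜ z) (begin
    ∣ im z ∣ * ∣ im z ∣    ≈⟨ ∣x∣*∣x∣≈x*x (im z) ⟩
    im z * im z            ≤⟨ ≤-by (0≤x² (re z)) (solve 2 (λ x y → (x :+ y) :- y := x) refl _ _) ⟩
    normSq z               ≈⟨ ∣∣ᶜ² z ⟨
    ∣ z ∣ᶜ * ∣ z ∣ᶜ        ∎)

  ∣∣ᶜ≤∣re∣+∣im∣ : ∀ z → ∣ z ∣ᶜ ≤ ∣ re z ∣ + ∣ im z ∣
  ∣∣ᶜ≤∣re∣+∣im∣ z = ²-cancel-≤ (0≤-+ 0≤x 0≤y) (begin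
    ∣ z ∣ᶜ * ∣ z ∣ᶜ       ≈⟨ ∣∣ᶜ² z ⟩
    normSq z              ≈⟨ +-cong (∣x∣*∣x∣≈x*x (re z)) (∣x∣*∣x∣≈x*x (im z)) ⟨
    x * x + y * y
      ≤⟨ ≤-by (0≤-+ 0≤xy 0≤xy) (solve 2 (λ x y → (x :+ y) :* (x :+ y) :- (x :* x :+ y :* y) := x :* y :+ x :* y) refl x y) ⟩
    (x + y) * (x + y)     ∎)
    where
    x = ∣ re z ∣
    y = ∣ im z ∣
    0≤x = 0≤∣x∣ (re z)
    0≤y = 0≤∣x∣ (im z)
    0≤xy = *-nonNeg 0≤x 0≤y

  ∣fromℝ∣≈∣∣ : ∀ x → ∣ fromℝ x ∣ᶜ ≈ ∣ x ∣
  ∣fromℝ∣≈∣∣ x = ∣∣ᶜ-unique {fromℝ x} (0≤∣x∣ x)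
    (trans (solve 1 (λ x → x :* x :+ :0 :* :0 := x :* x) refl x) (sym (∣x∣*∣x∣≈x*x x)))

  ∣1∣ᶜ≈1 : ∣ 1ᶜ ∣ᶜ ≈ 1#
  ∣1∣ᶜ≈1 = ∣∣ᶜ-unique {1ᶜ} 0≤1 (solve 0 (:1 :* :1 :+ :0 :* :0 := :1 :* :1) refl)

  ∣0∣ᶜ≈0 : ∣ 0ᶜ ∣ᶜ ≈ 0#
  ∣0∣ᶜ≈0 = ∣∣ᶜ-unique {0ᶜ} ≤-refl (solve 0 (:0 :* :0 :+ :0 :* :0 := :0 :* :0) refl)

  ∣-z∣≈∣z∣ : ∀ z → ∣ -ᶜ z ∣ᶜ ≈ ∣ z ∣ᶜ
  ∣-z∣≈∣z∣ z = ∣∣ᶜ-unique { -ᶜ z} (0≤∣∣ᶜ z)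
    (trans (solve 2 (λ a b → (:- a) :* (:- a) :+ (:- b) :* (:- b) := a :* a :+ b :* b) refl (re z) (im z))
           (sym (∣∣ᶜ² z)))

  ∣z∣≤0⇒z≈0 : ∀ z → ∣ z ∣ᶜ ≤ 0# → z ≈ᶜ 0ᶜ
  ∣z∣≤0⇒z≈0 z ∣z∣≤0 = zero-of (≤-trans (∣re∣≤∣∣ᶜ z) ∣z∣≤0) , zero-of (≤-trans (∣im∣≤∣∣ᶜ z) ∣z∣≤0)
    where
    zero-of : ∀ {x} → ∣ x ∣ ≤ 0# → x ≈ 0#
    zero-of {x} ∣x∣≤0 = antisym (≤-trans (x≤∣x∣ x) ∣x∣≤0)
      (≤-by (x≤y⇒0≤y-x (≤-trans (-x≤∣x∣ x) ∣x∣≤0)) (solve 1 (λ x → x :- :0 := :0 :- (:- x)) refl x))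

  z≉0⇒0<∣z∣ : ∀ {z} → z ≉ᶜ 0ᶜ → 0# < ∣ z ∣ᶜ
  z≉0⇒0<∣z∣ {z} z≉0 = 0≤∣∣ᶜ z , λ 0≈∣z∣ → z≉0 (∣z∣≤0⇒z≈0 z (≤-reflexive (sym 0≈∣z∣)))

  0<∣z∣⇒z≉0 : ∀ {z} → 0# < ∣ z ∣ᶜ → z ≉ᶜ 0ᶜ
  0<∣z∣⇒z≉0 {z} 0<∣z∣ z≈0 = proj₂ 0<∣z∣ (sym (trans (∣∣ᶜ-cong {z} {0ᶜ} z≈0) ∣0∣ᶜ≈0))

  ⁻¹ᶜ-inverseʳ : ∀ {z} → z ≉ᶜ 0ᶜ → z *ᶜ z ⁻¹ᶜ ≈ᶜ 1ᶜ
  ⁻¹ᶜ-inverseʳ {z@(a +i b)} z≉0 =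
    trans (solve 3 (λ a b i → a :* (a :* i) :- b :* ((:- b) :* i) := (a :* a :+ b :* b) :* i) refl a b i)
      (⁻¹-inverseʳ (0<⇒≉0 (<-respʳ (∣∣ᶜ² z) (0<-* 0<∣z∣ 0<∣z∣)))) ,
    solve 3 (λ a b i → a :* ((:- b) :* i) :+ b :* (a :* i) := :0) refl a b i
    where
    i = normSq z ⁻¹
    0<∣z∣ = z≉0⇒0<∣z∣ {z} z≉0

  ∣z∣∣z⁻¹∣≈1 : ∀ {z} → z ≉ᶜ 0ᶜ → ∣ z ∣ᶜ * ∣ z ⁻¹ᶜ ∣ᶜ ≈ 1#
  ∣z∣∣z⁻¹∣≈1 {z} z≉0 = begin-equality
    ∣ z ∣ᶜ * ∣ z ⁻¹ᶜ ∣ᶜ    ≈⟨ ∣zw∣≈∣z∣∣w∣ z (z ⁻¹ᶜ) ⟨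
    ∣ z *ᶜ z ⁻¹ᶜ ∣ᶜ        ≈⟨ ∣∣ᶜ-cong {z *ᶜ z ⁻¹ᶜ} {1ᶜ} (⁻¹ᶜ-inverseʳ {z} z≉0) ⟩
    ∣ 1ᶜ ∣ᶜ                ≈⟨ ∣1∣ᶜ≈1 ⟩
    1#                     ∎

-- Seminorms on ℂ^d and the equivalence of norms.

module NormedSpaces (em : ExcludedMiddle 0ℓ) (𝐑 : CompleteOrderedField) where
  open Analysis em 𝐑
  open RealAnalysis em 𝐑
  open ComplexNumbers em 𝐑
  open Vector using (_∷_; tail)
  open ℂₛ using () renaming
    (solve to solveᶜ; _:=_ to _⊜_; _:+_ to _⊕_; _:*_ to _⊗_; _:-_ to _⊖_; :-_ to ⊝_; :0 to :0ᶜ; :1 to :1ᶜ)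

  ·-cong : ∀ {d} (M : Matrix d) {v w} → v ≈ᵛ w → M · v ≈ᵛ M · w
  ·-cong M v≈w i = ℂΣ.sum-cong-≋ λ k → ℂᵣ.*-congˡ {M i k} (v≈w k)

  ·-+ᵛ : ∀ {d} (M : Matrix d) v w → M · (v +ᵛ w) ≈ᵛ (M · v) +ᵛ (M · w)
  ·-+ᵛ M v w i = ℂᵣ.trans (ℂΣ.sum-cong-≋ λ k → ℂᵣ.distribˡ (M i k) (v k) (w k))
                          (ℂΣ.∑-distrib-+ (λ k → M i k *ᶜ v k) (λ k → M i k *ᶜ w k))

  ·-• : ∀ {d} (M : Matrix d) c v → M · (c • v) ≈ᵛ c • (M · v)
  ·-• M c v i = ℂᵣ.trans
    (ℂΣ.sum-cong-≋ λ k → solveᶜ 3 (λ m c v → m ⊗ (c ⊗ v) ⊜ c ⊗ (m ⊗ v)) ℂᵣ.refl (M i k) c (v k))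
    (ℂᵣ.sym (ℂΣ.*-distribˡ-sum c λ k → M i k *ᶜ v k))

  ≈ᵛ-trans : ∀ {d} {u v w : ℂ^ d} → u ≈ᵛ v → v ≈ᵛ w → u ≈ᵛ w
  ≈ᵛ-trans u≈v v≈w i = ℂᵣ.trans (u≈v i) (v≈w i)

  ≈ᵛ-sym : ∀ {d} {u v : ℂ^ d} → u ≈ᵛ v → v ≈ᵛ u
  ≈ᵛ-sym u≈v i = ℂᵣ.sym (u≈v i)

  ≈ᵛ-refl : ∀ {d} {v : ℂ^ d} → v ≈ᵛ v
  ≈ᵛ-refl i = ℂᵣ.refl

  +ᵛ-cong : ∀ {d} {u v w x : ℂ^ d} → u ≈ᵛ v → w ≈ᵛ x → u +ᵛ w ≈ᵛ v +ᵛ x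
  +ᵛ-cong u≈v w≈x i = ℂᵣ.+-cong (u≈v i) (w≈x i)

  -ᵛ-cong : ∀ {d} {u v w x : ℂ^ d} → u ≈ᵛ v → w ≈ᵛ x → u -ᵛ w ≈ᵛ v -ᵛ x
  -ᵛ-cong u≈v w≈x i = ℂᵣ.+-cong (u≈v i) (ℂᵣ.-‿cong (w≈x i))

  •-cong : ∀ {d} c {u v : ℂ^ d} → u ≈ᵛ v → c • u ≈ᵛ c • v
  •-cong c u≈v i = ℂᵣ.*-congˡ {c} (u≈v i)

  -1• : ∀ {d} (v : ℂ^ d) → (-ᶜ 1ᶜ) • v ≈ᵛ 0ᵛ -ᵛ v
  -1• v i = solveᶜ 1 (λ v → (⊝ :1ᶜ) ⊗ v ⊜ :0ᶜ ⊖ v) ℂᵣ.refl (v i)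

  ·-neg : ∀ {d} (M : Matrix d) v → M · (λ k → -ᶜ v k) ≈ᵛ λ i → -ᶜ (M · v) i
  ·-neg M v i = ℂᵣ.trans
    (·-cong M {w = (-ᶜ 1ᶜ) • v} (λ k → solveᶜ 1 (λ v → ⊝ v ⊜ (⊝ :1ᶜ) ⊗ v) ℂᵣ.refl (v k)) i)
    (ℂᵣ.trans (·-• M (-ᶜ 1ᶜ) v i) (solveᶜ 1 (λ v → (⊝ :1ᶜ) ⊗ v ⊜ ⊝ v) ℂᵣ.refl ((M · v) i)))

  ·--ᵛ : ∀ {d} (M : Matrix d) v w → M · (v -ᵛ w) ≈ᵛ (M · v) -ᵛ (M · w)
  ·--ᵛ M v w i = ℂᵣ.trans (·-+ᵛ M v (λ k → -ᶜ w k) i) (ℂᵣ.+-congˡ {(M · v) i} (·-neg M w i))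

  *-· : ∀ {d} (M N : Matrix d) v → (λ i j → sumᶜ λ k → M i k *ᶜ N k j) · v ≈ᵛ M · (N · v)
  *-· M N v i = ℂᵣ.trans
    (ℂΣ.sum-cong-≋ λ k → ℂΣ.*-distribʳ-sum (v k) λ j → M i j *ᶜ N j k)
    (ℂᵣ.trans (ℂΣ.∑-comm λ k j → M i j *ᶜ N j k *ᶜ v k)
      (ℂΣ.sum-cong-≋ λ j → ℂᵣ.trans
        (ℂΣ.sum-cong-≋ λ k → ℂᵣ.*-assoc (M i j) (N j k) (v k))
        (ℂᵣ.sym (ℂΣ.*-distribˡ-sum (M i j) λ k → N j k *ᶜ v k))))

  sum-zero : ∀ {n} {f : Fin n → ℂ} → (∀ i → f i ≈ᶜ 0ᶜ) → sumᶜ f ≈ᶜ 0ᶜ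
  sum-zero {n} f≈0 = ℂᵣ.trans (ℂΣ.sum-cong-≋ f≈0) (ℂΣ.sum-replicate-zero n)

  ·-0ᵛ : ∀ {d} (M : Matrix d) → M · 0ᵛ ≈ᵛ 0ᵛ
  ·-0ᵛ M i = sum-zero λ k → ℂᵣ.zeroʳ (M i k)

  1ᴹ : ∀ {d} → Matrix d
  1ᴹ {d} = RawRing.1# (Matrix-rawRing d)

  1ᴹ-· : ∀ {d} (v : ℂ^ d) → 1ᴹ · v ≈ᵛ v
  1ᴹ-· v zero    = ℂᵣ.trans
    (ℂᵣ.+-cong (ℂᵣ.*-identityˡ (v zero)) (sum-zero λ k → ℂᵣ.zeroˡ (v (suc k))))
    (ℂᵣ.+-identityʳ (v zero))
  1ᴹ-· v (suc i) = ℂᵣ.trans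
    (ℂᵣ.+-cong (ℂᵣ.zeroˡ (v zero)) (1ᴹ-· (tail v) i)) (ℂᵣ.+-identityˡ (v (suc i)))

  sumᴹ-· : ∀ {n d} (A : Fin n → Matrix d) v → sumᴹ A · v ≈ᵛ sumᵛ λ r → A r · v
  sumᴹ-· {zero}  A v i = sum-zero λ k → ℂᵣ.zeroˡ (v k)
  sumᴹ-· {suc n} A v i = ℂᵣ.trans
    (ℂΣ.sum-cong-≋ λ k → ℂᵣ.distribʳ (v k) (A zero i k) (sumᴹ (A ∘ suc) i k))
    (ℂᵣ.trans (ℂΣ.∑-distrib-+ (λ k → A zero i k *ᶜ v k) (λ k → sumᴹ (A ∘ suc) i k *ᶜ v k))
      (ℂᵣ.+-congˡ {(A zero · v) i} (sumᴹ-· (A ∘ suc) v i)))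

  -- Definiteness is kept apart and homogeneity is an inequality only, so that pullbacks along
  -- singular matrices, restrictions, maxima and weighted sums all stay within the notion.
  -- Non-negativity follows by writing 0 as v + (0 - v).
  record Seminorm (d : ℕ) : Set where
    field
      size           : ℂ^ d → ℝ
      size-cong      : ∀ {v w} → v ≈ᵛ w → size v ≈ size w
      subhomogeneous : ∀ c v → size (c • v) ≤ ∣ c ∣ᶜ * size v
      subadditive    : ∀ v w → size (v +ᵛ w) ≤ size v + size w

    size-0 : size 0ᵛ ≈ 0#
    size-0 = antisym
      (begin
        size 0ᵛ               ≈⟨ size-cong (λ i → ℂᵣ.sym (ℂᵣ.zeroˡ 0ᶜ)) ⟩
        size (0ᶜ • 0ᵛ)        ≤⟨ subhomogeneous 0ᶜ 0ᵛ ⟩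
        ∣ 0ᶜ ∣ᶜ * size 0ᵛ     ≈⟨ trans (*-congʳ ∣0∣ᶜ≈0) (zeroˡ _) ⟩
        0#                    ∎)
      (≤-by (x≤y⇒0≤y-x (≤-respˡ (size-cong (λ i → ℂᵣ.+-identityˡ 0ᶜ)) (subadditive 0ᵛ 0ᵛ)))
        (solve 1 (λ x → x :- :0 := (x :+ x) :- x) refl (size 0ᵛ)))

    size-neg : ∀ v → size (0ᵛ -ᵛ v) ≤ size v
    size-neg v = begin
      size (0ᵛ -ᵛ v)            ≈⟨ size-cong (-1• v) ⟨
      size ((-ᶜ 1ᶜ) • v)        ≤⟨ subhomogeneous (-ᶜ 1ᶜ) v ⟩
      ∣ -ᶜ 1ᶜ ∣ᶜ * size v       ≈⟨ *-congʳ (trans (∣-z∣≈∣z∣ 1ᶜ) ∣1∣ᶜ≈1) ⟩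
      1# * size v               ≈⟨ *-identityˡ _ ⟩
      size v                    ∎

    0≤size : ∀ v → 0# ≤ size v
    0≤size v = *-cancelˡ-≤ 0<2 (begin
      (1# + 1#) * 0#             ≈⟨ zeroʳ _ ⟩
      0#                         ≈⟨ size-0 ⟨
      size 0ᵛ                    ≈⟨ size-cong (λ i → solveᶜ 1 (λ v → :0ᶜ ⊜ v ⊕ (:0ᶜ ⊖ v)) ℂᵣ.refl (v i)) ⟩
      size (v +ᵛ (0ᵛ -ᵛ v))      ≤⟨ subadditive v (0ᵛ -ᵛ v) ⟩
      size v + size (0ᵛ -ᵛ v)    ≤⟨ +-mono-≤ ≤-refl (size-neg v) ⟩
      size v + size v            ≈⟨ solve 1 (λ x → x :+ x := (:1 :+ :1) :* x) refl (size v) ⟩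
      (1# + 1#) * size v         ∎)

    size-sub-sym : ∀ v w → size (v -ᵛ w) ≤ size (w -ᵛ v)
    size-sub-sym v w = ≤-respˡ
      (size-cong λ i → solveᶜ 2 (λ v w → :0ᶜ ⊖ (w ⊖ v) ⊜ v ⊖ w) ℂᵣ.refl (v i) (w i))
      (size-neg (w -ᵛ v))

    size-sub-trans : ∀ u v w → size (u -ᵛ w) ≤ size (u -ᵛ v) + size (v -ᵛ w)
    size-sub-trans u v w = ≤-respˡ
      (size-cong λ i → solveᶜ 3 (λ u v w → (u ⊖ v) ⊕ (v ⊖ w) ⊜ u ⊖ w) ℂᵣ.refl (u i) (v i) (w i))
      (subadditive (u -ᵛ v) (v -ᵛ w))

    size-sub-≤ : ∀ v w → size (v -ᵛ w) ≤ size v + size w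
    size-sub-≤ v w = ≤-trans
      (≤-respˡ (size-cong λ i → solveᶜ 2 (λ v w → v ⊕ (:0ᶜ ⊖ w) ⊜ v ⊖ w) ℂᵣ.refl (v i) (w i))
        (subadditive v (0ᵛ -ᵛ w)))
      (+-mono-≤ ≤-refl (size-neg w))

    size-≤-sub : ∀ v w → size v ≤ size (v -ᵛ w) + size w
    size-≤-sub v w = ≤-respˡ
      (size-cong λ i → solveᶜ 2 (λ v w → (v ⊖ w) ⊕ w ⊜ v) ℂᵣ.refl (v i) (w i))
      (subadditive (v -ᵛ w) w)

    size-sub-self : ∀ {v w} → v ≈ᵛ w → size (v -ᵛ w) ≈ 0#
    size-sub-self {v} {w} v≈w = trans
      (size-cong λ i → ℂᵣ.trans (ℂᵣ.+-congʳ (v≈w i)) (ℂᵣ.-‿inverseʳ (w i))) size-0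

    Definite : Set
    Definite = ∀ v → size v ≤ 0# → v ≈ᵛ 0ᵛ

    CauchySequence : (ℕ → ℂ^ d) → Set
    CauchySequence u = ∀ ε → 0# < ε → ∃ λ N → ∀ m n → N ℕ.≤ m → N ℕ.≤ n → size (u m -ᵛ u n) ≤ ε

    _ConvergesTo_ : (ℕ → ℂ^ d) → ℂ^ d → Set
    u ConvergesTo l = Null λ n → size (u n -ᵛ l)

    definite-sub : Definite → ∀ {v w} → size (v -ᵛ w) ≤ 0# → v ≈ᵛ w
    definite-sub definite {v} {w} small i = ℂᵣ.trans
      (solveᶜ 2 (λ v w → v ⊜ (v ⊖ w) ⊕ w) ℂᵣ.refl (v i) (w i))
      (ℂᵣ.trans (ℂᵣ.+-congʳ (definite (v -ᵛ w) small i)) (ℂᵣ.+-identityˡ (w i)))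

  open Seminorm public

  fromNorm : ∀ {d} → Norm d → Seminorm d
  fromNorm ν = record
    { size           = ‖_‖
    ; size-cong      = cong
    ; subhomogeneous = λ c v → ≤-reflexive (homogeneous c v)
    ; subadditive    = triangle }
    where open Norm ν

  fromNorm-definite : ∀ {d} (ν : Norm d) → Definite (fromNorm ν)
  fromNorm-definite ν v ‖v‖≤0 = Norm.definite ν v (antisym ‖v‖≤0 (0≤size (fromNorm ν) v))

  -- Turns an operator bound into a comparison of seminorms: a constant dominating `pullback M p` by
  -- `p` bounds the matrix `M` in `p`.
  pullback : ∀ {d} → Matrix d → Seminorm d → Seminorm d
  pullback M p = record
    { size           = λ v → size p (M · v)
    ; size-cong      = λ v≈w → size-cong p (·-cong M v≈w)
    ; subhomogeneous = λ c v → ≤-respˡ (sym (size-cong p (·-• M c v))) (subhomogeneous p c (M · v))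
    ; subadditive    = λ v w → ≤-respˡ (sym (size-cong p (·-+ᵛ M v w))) (subadditive p (M · v) (M · w)) }

  0∷-• : ∀ {d} c (v : ℂ^ d) → (0ᶜ ∷ (c • v)) ≈ᵛ c • (0ᶜ ∷ v)
  0∷-• c v zero    = ℂᵣ.sym (ℂᵣ.zeroʳ c)
  0∷-• c v (suc i) = ℂᵣ.refl

  0∷-+ : ∀ {d} (v w : ℂ^ d) → (0ᶜ ∷ (v +ᵛ w)) ≈ᵛ (0ᶜ ∷ v) +ᵛ (0ᶜ ∷ w)
  0∷-+ v w zero    = ℂᵣ.sym (ℂᵣ.+-identityˡ 0ᶜ)
  0∷-+ v w (suc i) = ℂᵣ.refl

  ∷-cong : ∀ {d c c′} {v w : ℂ^ d} → c ≈ᶜ c′ → v ≈ᵛ w → (c ∷ v) ≈ᵛ (c′ ∷ w)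
  ∷-cong c≈c′ v≈w zero    = c≈c′
  ∷-cong c≈c′ v≈w (suc i) = v≈w i

  restrict : ∀ {d} → Seminorm (suc d) → Seminorm d
  restrict p = record
    { size           = λ v → size p (0ᶜ ∷ v)
    ; size-cong      = λ v≈w → size-cong p (∷-cong ℂᵣ.refl v≈w)
    ; subhomogeneous = λ c v → ≤-respˡ (sym (size-cong p (0∷-• c v))) (subhomogeneous p c (0ᶜ ∷ v))
    ; subadditive    = λ v w → ≤-respˡ (sym (size-cong p (0∷-+ v w))) (subadditive p (0ᶜ ∷ v) (0ᶜ ∷ w)) }

  ℓ¹ : ∀ {d} → ℂ^ d → ℝ
  ℓ¹ v = sum λ i → ∣ v i ∣ᶜ

  0≤ℓ¹ : ∀ {d} (v : ℂ^ d) → 0# ≤ ℓ¹ v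
  0≤ℓ¹ v = 0≤sum λ i → 0≤∣∣ᶜ (v i)

  ∣vᵢ∣≤ℓ¹ : ∀ {d} (v : ℂ^ d) i → ∣ v i ∣ᶜ ≤ ℓ¹ v
  ∣vᵢ∣≤ℓ¹ v zero    = ≤-respˡ (+-identityʳ _) (+-mono-≤ ≤-refl (0≤ℓ¹ (tail v)))
  ∣vᵢ∣≤ℓ¹ v (suc i) = ≤-respˡ (+-identityˡ _) (+-mono-≤ (0≤∣∣ᶜ (v zero)) (∣vᵢ∣≤ℓ¹ (tail v) i))

  -- The constant built here is the sum of the sizes of the basis vectors.
  ≤ℓ¹ : ∀ {d} (p : Seminorm d) → ∃ λ k → 0# ≤ k × (∀ v → size p v ≤ k * ℓ¹ v)
  ≤ℓ¹ {zero}  p = 0# , ≤-refl , λ v → ≤-reflexive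
    (trans (trans (size-cong p λ ()) (size-0 p)) (sym (zeroˡ _)))
  ≤ℓ¹ {suc d} p = let k , 0≤k , bound = ≤ℓ¹ (restrict p) in
    size p e + k , 0≤-+ (0≤size p e) 0≤k , λ v → begin
      size p v                                             ≈⟨ size-cong p (split v) ⟩
      size p ((v zero • e) +ᵛ (0ᶜ ∷ tail v))               ≤⟨ subadditive p (v zero • e) (0ᶜ ∷ tail v) ⟩
      size p (v zero • e) + size p (0ᶜ ∷ tail v)
        ≤⟨ +-mono-≤ (subhomogeneous p (v zero) e) (bound (tail v)) ⟩
      ∣ v zero ∣ᶜ * size p e + k * ℓ¹ (tail v)
        ≤⟨ ≤-by (0≤-+ (*-nonNeg (0≤size p e) (0≤ℓ¹ (tail v))) (*-nonNeg 0≤k (0≤∣∣ᶜ (v zero))))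
            (solve 4 (λ c s k t → (s :+ k) :* (c :+ t) :- (c :* s :+ k :* t) := s :* t :+ k :* c) refl ∣ v zero ∣ᶜ (size p e) k (ℓ¹ (tail v))) ⟩
      (size p e + k) * ℓ¹ v                                ∎
    where
    e : ℂ^ (suc d)
    e = 1ᶜ ∷ 0ᵛ
    split : ∀ v → v ≈ᵛ (v zero • e) +ᵛ (0ᶜ ∷ tail v)
    split v zero    = solveᶜ 1 (λ v → v ⊜ v ⊗ :1ᶜ ⊕ :0ᶜ) ℂᵣ.refl (v zero)
    split v (suc i) = solveᶜ 2 (λ v w → w ⊜ v ⊗ :0ᶜ ⊕ w) ℂᵣ.refl (v zero) (v (suc i))

  Null-sum : ∀ {d} {u : Fin d → ℕ → ℝ} → (∀ i → Null (u i)) → Null λ n → sum λ i → u i n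
  Null-sum {zero}  u→0 ε 0<ε = 0 , λ _ _ → <⇒≤ 0<ε
  Null-sum {suc d} u→0 = Null-+ (u→0 zero) (Null-sum (u→0 ∘ suc))

  abstract
    ℓ¹-complete : ∀ {d} (u : ℕ → ℂ^ d) →
                  (∀ ε → 0# < ε → ∃ λ N → ∀ m n → N ℕ.≤ m → N ℕ.≤ n → ℓ¹ (u m -ᵛ u n) ≤ ε) →
                  ∃ λ l → Null λ n → ℓ¹ (u n -ᵛ l)
    ℓ¹-complete {d} u cauchy = l , Null-sum λ i →
      Null-≤ (0 , λ n _ → ∣∣ᶜ≤∣re∣+∣im∣ (u n i +ᶜ -ᶜ l i))
        (Null-+ (proj₂ (limit re (λ z w → refl) ∣re∣≤∣∣ᶜ i)) (proj₂ (limit im (λ z w → refl) ∣im∣≤∣∣ᶜ i)))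
      where
      limit : (π : ℂ → ℝ) → (∀ z w → π (z +ᶜ -ᶜ w) ≈ π z - π w) → (∀ z → ∣ π z ∣ ≤ ∣ z ∣ᶜ) →
              ∀ i → ∃ λ x → Null λ n → ∣ π (u n i) - x ∣
      limit π π-sub π≤ i = cauchy-converges (λ n → π (u n i)) λ ε 0<ε →
        let N , close = cauchy ε 0<ε in N , λ m n N≤m N≤n →
        ≤-by (x≤y⇒0≤y-x (begin
            π (u m i) - π (u n i)            ≈⟨ π-sub (u m i) (u n i) ⟨
            π (u m i +ᶜ -ᶜ u n i)            ≤⟨ x≤∣x∣ _ ⟩
            ∣ π (u m i +ᶜ -ᶜ u n i) ∣        ≤⟨ π≤ _ ⟩
            ∣ u m i +ᶜ -ᶜ u n i ∣ᶜ           ≤⟨ ∣vᵢ∣≤ℓ¹ (u m -ᵛ u n) i ⟩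
            ℓ¹ (u m -ᵛ u n)                  ≤⟨ close m n N≤m N≤n ⟩
            ε                                ∎))
          (solve 3 (λ x y e → y :+ e :- x := e :- (x :- y)) refl (π (u m i)) (π (u n i)) ε)

      l : ℂ^ d
      l i = proj₁ (limit re (λ z w → refl) ∣re∣≤∣∣ᶜ i) +i proj₁ (limit im (λ z w → refl) ∣im∣≤∣∣ᶜ i)

  -- By induction on the dimension: the hyperplane of the vectors 0 ∷ u is complete,
  -- so the affine hyperplane of the vectors 1 ∷ u keeps a positive distance from
  -- the origin.
  ℓ¹≤ : ∀ {d} (p : Seminorm d) → Definite p → ∃ λ k → 0# ≤ k × (∀ v → ℓ¹ v ≤ k * size p v)
  ℓ¹≤ {zero}  p definite = 0# , ≤-refl , λ v → ≤-reflexive (sym (zeroˡ _))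
  ℓ¹≤ {suc d} p definite = δ ⁻¹ + k * (1# + δ ⁻¹ * size p e) ,
    0≤-+ 0≤δ⁻¹ (*-nonNeg 0≤k (0≤-+ 0≤1 (*-nonNeg 0≤δ⁻¹ (0≤size p e)))) , λ v → begin
      ∣ v zero ∣ᶜ + ℓ¹ (tail v)
        ≤⟨ +-mono-≤ (head-bound v) (≤-trans (bound (tail v)) (*-monoˡ-≤ 0≤k (tail-bound v))) ⟩
      δ ⁻¹ * size p v + k * (size p v + δ ⁻¹ * size p v * size p e)
        ≈⟨ solve 4 (λ i s k e → i :* s :+ k :* (s :+ i :* s :* e) := (i :+ k :* (:1 :+ i :* e)) :* s) refl (δ ⁻¹) (size p v) k (size p e) ⟩
      (δ ⁻¹ + k * (1# + δ ⁻¹ * size p e)) * size p v                  ∎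
    where
    p′ = restrict p

    definite′ : Definite p′
    definite′ v p′v≤0 i = definite (0ᶜ ∷ v) p′v≤0 (suc i)

    induction = ℓ¹≤ p′ definite′
    k = proj₁ induction
    0≤k = proj₁ (proj₂ induction)
    bound = proj₂ (proj₂ induction)

    e : ℂ^ (suc d)
    e = 1ᶜ ∷ 0ᵛ

    -- Differences of the vectors 1 ∷ u n lie in the hyperplane, where the induction hypothesis
    -- makes `u` a Cauchy sequence. Its limit `l` gives 1 ∷ l size 0, which definiteness refutes in
    -- the first coordinate.
    not-arbitrarily-close : ¬ (∀ n → ∃ λ u → size p (1ᶜ ∷ u) ≤ ι (suc n) ⁻¹)
    not-arbitrarily-close close = proj₂ 0<1 (sym (proj₁ (definite (1ᶜ ∷ l) 1∷l≤0 zero)))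
      where
      u : ℕ → ℂ^ d
      u n = proj₁ (close n)

      p[1∷u]-null : Null λ n → size p (1ᶜ ∷ u n)
      p[1∷u]-null = Null-≤ (0 , λ n _ → proj₂ (close n)) λ ε 0<ε → Eventually-suc (ι⁻¹-null ε 0<ε)

      difference : ∀ v w → (0ᶜ ∷ (v -ᵛ w)) ≈ᵛ ((1ᶜ ∷ v) -ᵛ (1ᶜ ∷ w))
      difference v w zero    = ℂᵣ.sym (ℂᵣ.-‿inverseʳ 1ᶜ)
      difference v w (suc i) = ℂᵣ.refl

      cauchy : ∀ ε → 0# < ε → ∃ λ N → ∀ m n → N ℕ.≤ m → N ℕ.≤ n → ℓ¹ (u m -ᵛ u n) ≤ ε
      cauchy ε 0<ε = let N , small = Null-* k 0≤k p[1∷u]-null (ε * ½) (0<x½ 0<ε) in N , λ m n N≤m N≤n → begin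
        ℓ¹ (u m -ᵛ u n)                                         ≤⟨ bound (u m -ᵛ u n) ⟩
        k * size p (0ᶜ ∷ (u m -ᵛ u n))
          ≈⟨ *-congˡ (size-cong p (difference (u m) (u n))) ⟩
        k * size p ((1ᶜ ∷ u m) -ᵛ (1ᶜ ∷ u n))
          ≤⟨ *-monoˡ-≤ 0≤k (size-sub-≤ p (1ᶜ ∷ u m) (1ᶜ ∷ u n)) ⟩
        k * (size p (1ᶜ ∷ u m) + size p (1ᶜ ∷ u n))             ≈⟨ distribˡ _ _ _ ⟩
        k * size p (1ᶜ ∷ u m) + k * size p (1ᶜ ∷ u n)           ≤⟨ +-mono-≤ (small m N≤m) (small n N≤n) ⟩
        ε * ½ + ε * ½                                           ≈⟨ x½+x½≈x ε ⟩
        ε                                                       ∎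

      l = proj₁ (ℓ¹-complete u cauchy)
      k′ = ≤ℓ¹ p′

      1∷l≤0 : size p (1ᶜ ∷ l) ≤ 0#
      1∷l≤0 = Null-const⇒≤
        (Null-+ (Null-* (proj₁ k′) (proj₁ (proj₂ k′)) (proj₂ (ℓ¹-complete u cauchy))) p[1∷u]-null)
        λ n → begin
          size p (1ᶜ ∷ l)                                                ≤⟨ size-≤-sub p (1ᶜ ∷ l) (1ᶜ ∷ u n) ⟩
          size p ((1ᶜ ∷ l) -ᵛ (1ᶜ ∷ u n)) + size p (1ᶜ ∷ u n)
            ≤⟨ +-mono-≤ (size-sub-sym p (1ᶜ ∷ l) (1ᶜ ∷ u n)) ≤-refl ⟩
          size p ((1ᶜ ∷ u n) -ᵛ (1ᶜ ∷ l)) + size p (1ᶜ ∷ u n)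
            ≈⟨ +-congʳ (size-cong p (difference (u n) l)) ⟨
          size p′ (u n -ᵛ l) + size p (1ᶜ ∷ u n)
            ≤⟨ +-mono-≤ (proj₂ (proj₂ k′) (u n -ᵛ l)) ≤-refl ⟩
          proj₁ k′ * ℓ¹ (u n -ᵛ l) + size p (1ᶜ ∷ u n)                   ∎

    -- The reciprocals 1/(n + 1) are the candidates for the distance; if all of them fail, some
    -- vector 1 ∷ u lies below each.
    gap : ∃ λ δ → 0# < δ × (∀ u → δ ≤ size p (1ᶜ ∷ u))
    gap with em {∃ λ n → ∀ u → ι (suc n) ⁻¹ ≤ size p (1ᶜ ∷ u)}
    ... | yes (n , far) = ι (suc n) ⁻¹ , 0<x⁻¹ (0<ι (ℕ.s≤s (ℕ.z≤n {n}))) , far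
    ... | no never = contradiction close not-arbitrarily-close
      where
      close : ∀ n → ∃ λ u → size p (1ᶜ ∷ u) ≤ ι (suc n) ⁻¹
      close n with em {∃ λ u → size p (1ᶜ ∷ u) ≤ ι (suc n) ⁻¹}
      ... | yes found = found
      ... | no none = contradiction (n , far) never
        where
        far : ∀ u → ι (suc n) ⁻¹ ≤ size p (1ᶜ ∷ u)
        far u with total (ι (suc n) ⁻¹) (size p (1ᶜ ∷ u))
        ... | inj₁ le = le
        ... | inj₂ ge = contradiction (u , ge) none

    δ = proj₁ gap
    0<δ = proj₁ (proj₂ gap)
    0≤δ⁻¹ = <⇒≤ (0<x⁻¹ 0<δ)

    -- Division by a non-zero first coordinate moves `v` into the affine hyperplane of the vectors 1
    -- ∷ u, where `δ` is a lower bound; homogeneity multiplies the coordinate back.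
    δ∣v₀∣≤ : ∀ v → δ * ∣ v zero ∣ᶜ ≤ size p v
    δ∣v₀∣≤ v with em {v zero ≈ᶜ 0ᶜ}
    ... | yes v₀≈0 = ≤-trans
      (≤-reflexive (trans (*-congˡ (trans (∣∣ᶜ-cong {v zero} {0ᶜ} v₀≈0) ∣0∣ᶜ≈0)) (zeroʳ δ))) (0≤size p v)
    ... | no v₀≉0 = begin
      δ * ∣ c ∣ᶜ
        ≤⟨ *-monoʳ-≤ (0≤∣∣ᶜ c) (proj₂ (proj₂ gap) (c ⁻¹ᶜ • tail v)) ⟩
      size p (1ᶜ ∷ (c ⁻¹ᶜ • tail v)) * ∣ c ∣ᶜ         ≈⟨ *-congʳ (size-cong p rescale) ⟩
      size p (c ⁻¹ᶜ • v) * ∣ c ∣ᶜ                     ≤⟨ *-monoʳ-≤ (0≤∣∣ᶜ c) (subhomogeneous p (c ⁻¹ᶜ) v) ⟩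
      ∣ c ⁻¹ᶜ ∣ᶜ * size p v * ∣ c ∣ᶜ
        ≈⟨ solve 3 (λ i s c → i :* s :* c := c :* i :* s) refl ∣ c ⁻¹ᶜ ∣ᶜ (size p v) ∣ c ∣ᶜ ⟩
      ∣ c ∣ᶜ * ∣ c ⁻¹ᶜ ∣ᶜ * size p v                  ≈⟨ *-congʳ (∣z∣∣z⁻¹∣≈1 {c} v₀≉0) ⟩
      1# * size p v                                   ≈⟨ *-identityˡ _ ⟩
      size p v                                        ∎
      where
      c = v zero
      rescale : (1ᶜ ∷ (c ⁻¹ᶜ • tail v)) ≈ᵛ c ⁻¹ᶜ • v
      rescale zero    = ℂᵣ.sym (ℂᵣ.trans (ℂᵣ.*-comm (c ⁻¹ᶜ) c) (⁻¹ᶜ-inverseʳ {c} v₀≉0))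
      rescale (suc i) = ℂᵣ.refl

    head-bound : ∀ v → ∣ v zero ∣ᶜ ≤ δ ⁻¹ * size p v
    head-bound v = *-cancelˡ-≤ 0<δ (≤-trans (δ∣v₀∣≤ v) (≤-reflexive (sym
      (trans (sym (*-assoc δ (δ ⁻¹) (size p v))) (trans (*-congʳ (x*x⁻¹≈1 0<δ)) (*-identityˡ _))))))

    tail-bound : ∀ v → size p (0ᶜ ∷ tail v) ≤ size p v + δ ⁻¹ * size p v * size p e
    tail-bound v = begin
      size p (0ᶜ ∷ tail v)                           ≈⟨ size-cong p split ⟩
      size p (v -ᵛ (v zero • e))                     ≤⟨ size-sub-≤ p v (v zero • e) ⟩
      size p v + size p (v zero • e)                 ≤⟨ +-mono-≤ ≤-refl (subhomogeneous p (v zero) e) ⟩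
      size p v + ∣ v zero ∣ᶜ * size p e
        ≤⟨ +-mono-≤ ≤-refl (*-monoʳ-≤ (0≤size p e) (head-bound v)) ⟩
      size p v + δ ⁻¹ * size p v * size p e          ∎
      where
      split : (0ᶜ ∷ tail v) ≈ᵛ v -ᵛ (v zero • e)
      split zero    = solveᶜ 1 (λ v → :0ᶜ ⊜ v ⊖ v ⊗ :1ᶜ) ℂᵣ.refl (v zero)
      split (suc i) = solveᶜ 2 (λ v w → w ⊜ w ⊖ v ⊗ :0ᶜ) ℂᵣ.refl (v zero) (v (suc i))

  -- Equivalence of norms, with ℓ¹ as the intermediary. With a pullback for `p` it bounds every
  -- matrix in every norm, and it carries estimates between the given norm and the adapted one.
  dominated : ∀ {d} (p q : Seminorm d) → Definite q → ∃ λ k → 0# ≤ k × (∀ v → size p v ≤ k * size q v)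
  dominated p q definite =
    let k , 0≤k , p≤ = ≤ℓ¹ p
        k′ , 0≤k′ , ≤q = ℓ¹≤ q definite
    in k * k′ , *-nonNeg 0≤k 0≤k′ , λ v → begin
      size p v                ≤⟨ p≤ v ⟩
      k * ℓ¹ v                ≤⟨ *-monoˡ-≤ 0≤k (≤q v) ⟩
      k * (k′ * size q v)     ≈⟨ *-assoc k k′ _ ⟨
      k * k′ * size q v       ∎

  complete-seminorm : ∀ {d} (p : Seminorm d) → Definite p →
                      ∀ u → CauchySequence p u → ∃ (_ConvergesTo_ p u)
  complete-seminorm p definite u cauchy =
    proj₁ limit , Null-≤ (0 , λ n _ → p≤ (u n -ᵛ proj₁ limit)) (Null-* k′ 0≤k′ (proj₂ limit))
    where
    k = proj₁ (ℓ¹≤ p definite)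
    0≤k = proj₁ (proj₂ (ℓ¹≤ p definite))
    ≤p = proj₂ (proj₂ (ℓ¹≤ p definite))
    k′ = proj₁ (≤ℓ¹ p)
    0≤k′ = proj₁ (proj₂ (≤ℓ¹ p))
    p≤ = proj₂ (proj₂ (≤ℓ¹ p))

    ℓ¹-cauchy : ∀ ε → 0# < ε → ∃ λ N → ∀ i j → N ℕ.≤ i → N ℕ.≤ j → ℓ¹ (u i -ᵛ u j) ≤ ε
    ℓ¹-cauchy ε 0<ε =
      let δ , 0<δ , small = absorb 0≤k 0<ε
          N , close = cauchy δ 0<δ
      in N , λ i j N≤i N≤j → ≤-trans (≤p (u i -ᵛ u j)) (small (close i j N≤i N≤j))

    limit : ∃ λ l → Null λ n → ℓ¹ (u n -ᵛ l)
    limit = ℓ¹-complete u ℓ¹-cauchy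

-- A norm in which every letter contracts by q.

module AdaptedNorms (em : ExcludedMiddle 0ℓ) (𝐑 : CompleteOrderedField) where
  open Analysis em 𝐑
  open RealAnalysis em 𝐑
  open ComplexNumbers em 𝐑
  open NormedSpaces em 𝐑
  open Vec using ([]; _∷_; _∷ʳ_)

  maximum-seminorm : ∀ {n d} → (Fin n → Seminorm d) → Seminorm d
  maximum-seminorm {n} p = record
    { size           = λ v → maximum (sizes v)
    ; size-cong      = λ v≈w → antisym (mono λ r → ≤-reflexive (size-cong (p r) v≈w))
                                       (mono λ r → ≤-reflexive (sym (size-cong (p r) v≈w)))
    ; subhomogeneous = λ c v →
        maximum-≤ (sizes (c • v)) (*-nonNeg (0≤∣∣ᶜ c) (0≤maximum (sizes v))) λ r →
        ≤-trans (subhomogeneous (p r) c v) (*-monoˡ-≤ (0≤∣∣ᶜ c) (≤-maximum (sizes v) r))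
    ; subadditive    = λ v w →
        maximum-≤ (sizes (v +ᵛ w)) (0≤-+ (0≤maximum (sizes v)) (0≤maximum (sizes w))) λ r →
        ≤-trans (subadditive (p r) v w) (+-mono-≤ (≤-maximum (sizes v) r) (≤-maximum (sizes w) r)) }
    where
    sizes : ℂ^ _ → Fin n → ℝ
    sizes v r = size (p r) v
    mono : ∀ {f g : Fin n → ℝ} → (∀ r → f r ≤ g r) → maximum f ≤ maximum g
    mono {f} {g} f≤g = maximum-≤ f (0≤maximum g) λ r → ≤-trans (f≤g r) (≤-maximum g r)

  zero-seminorm : ∀ {d} → Seminorm d
  zero-seminorm = record
    { size           = λ _ → 0#
    ; size-cong      = λ _ → refl
    ; subhomogeneous = λ c _ → ≤-reflexive (sym (zeroʳ ∣ c ∣ᶜ))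
    ; subadditive    = λ _ _ → ≤-reflexive (sym (+-identityˡ 0#)) }

  scale-plus : ∀ {d q} → 0# ≤ q → Seminorm d → Seminorm d → Seminorm d
  scale-plus {q = q} 0≤q a b = record
    { size           = λ v → q * size a v + size b v
    ; size-cong      = λ v≈w → +-cong (*-congˡ (size-cong a v≈w)) (size-cong b v≈w)
    ; subhomogeneous = λ c v → ≤-trans
        (+-mono-≤ (*-monoˡ-≤ 0≤q (subhomogeneous a c v)) (subhomogeneous b c v))
        (≤-reflexive (solve 4 (λ q c x y → q :* (c :* x) :+ c :* y := c :* (q :* x :+ y)) refl q ∣ c ∣ᶜ (size a v) (size b v)))
    ; subadditive    = λ v w → ≤-trans
        (+-mono-≤ (*-monoˡ-≤ 0≤q (subadditive a v w)) (subadditive b v w))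
        (≤-reflexive (solve 5 (λ q x x′ y y′ → q :* (x :+ x′) :+ (y :+ y′) := (q :* x :+ y) :+ (q :* x′ :+ y′)) refl
          q (size a v) (size a w) (size b v) (size b w))) }

  words-bounded : ∀ {B} T (f : Word B T → ℝ) → ∃ λ M → ∀ w → f w ≤ M
  words-bounded zero    f = f [] , λ { [] → ≤-refl }
  words-bounded (suc T) f = maximum bounds , λ { (r ∷ w) →
    ≤-trans (proj₂ (words-bounded T λ w → f (r ∷ w)) w) (≤-maximum bounds r) }
    where
    bounds = λ r → proj₁ (words-bounded T λ w → f (r ∷ w))

  -- If `q ^ T` were less than `a`, then `q` would be among the numbers whose supremum is
  -- `root T a`.
  root<⇒≤^ : ∀ {T a q} → 1 ℕ.≤ T → 0# ≤ q → root T a < q → a ≤ q ^ T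
  root<⇒≤^ {T} 1≤T 0≤q root<q = ≯⇒≤ λ qᵀ<a → <⇒≱ root<q (≤-root {T} 1≤T 0≤q (<⇒≤ qᵀ<a))

  module _ {d : ℕ} (ν : Norm d) where
    open Norm ν
    private p = fromNorm ν

    -- Without an upper bound `Sup` would return its default value 0, and the induced norm would
    -- control nothing.
    inducedNorm-bounded : ∀ M → ∃ (IsUpperBound λ t → ∃ λ v → ‖ v ‖ ≤ 1# × t ≈ ‖ M · v ‖)
    inducedNorm-bounded M = proj₁ k , λ t (v , ‖v‖≤1 , t≈) → begin
      t                   ≈⟨ t≈ ⟩
      ‖ M · v ‖           ≤⟨ proj₂ (proj₂ k) v ⟩
      proj₁ k * ‖ v ‖     ≤⟨ *-monoˡ-≤ (proj₁ (proj₂ k)) ‖v‖≤1 ⟩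
      proj₁ k * 1#        ≈⟨ *-identityʳ _ ⟩
      proj₁ k             ∎
      where k = dominated (pullback M p) p (fromNorm-definite ν)

    inducedNorm-bound : ∀ M v → ‖ M · v ‖ ≤ inducedNorm M * ‖ v ‖
    inducedNorm-bound M v with ≤⊎> ‖ v ‖ 0#
    ... | inj₁ ‖v‖≤0 = ≤-reflexive (begin-equality
      ‖ M · v ‖                 ≈⟨ cong (·-cong M (fromNorm-definite ν v ‖v‖≤0)) ⟩
      ‖ M · 0ᵛ ‖                ≈⟨ cong (·-0ᵛ M) ⟩
      ‖ 0ᵛ {d} ‖                ≈⟨ size-0 p ⟩
      0#                        ≈⟨ zeroʳ _ ⟨
      inducedNorm M * 0#        ≈⟨ *-congˡ (antisym ‖v‖≤0 (0≤size p v)) ⟨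
      inducedNorm M * ‖ v ‖     ∎)
    ... | inj₂ 0<‖v‖ = begin
      ‖ M · v ‖                                    ≈⟨ cong v≈ ⟩
      ‖ fromℝ ‖ v ‖ • (M · (c • v)) ‖              ≈⟨ homogeneous _ _ ⟩
      ∣ fromℝ ‖ v ‖ ∣ᶜ * ‖ M · (c • v) ‖
        ≤⟨ *-monoˡ-≤ (0≤∣∣ᶜ _) (x≤Sup (inducedNorm-bounded M) (c • v , ‖cv‖≤1 , refl)) ⟩
      ∣ fromℝ ‖ v ‖ ∣ᶜ * inducedNorm M             ≈⟨ *-congʳ (trans (∣fromℝ∣≈∣∣ _) (0≤x⇒∣x∣≈x (<⇒≤ 0<‖v‖))) ⟩
      ‖ v ‖ * inducedNorm M                        ≈⟨ *-comm _ _ ⟩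
      inducedNorm M * ‖ v ‖                        ∎
      where
      c = fromℝ (‖ v ‖ ⁻¹)

      ‖v‖c≈1 : fromℝ ‖ v ‖ *ᶜ c ≈ᶜ 1ᶜ
      ‖v‖c≈1 = trans (solve 1 (λ x → x :- :0 :* :0 := x) refl _) (x*x⁻¹≈1 0<‖v‖)
             , solve 2 (λ x y → x :* :0 :+ :0 :* y := :0) refl _ _

      v≈ : M · v ≈ᵛ fromℝ ‖ v ‖ • (M · (c • v))
      v≈ i = ℂᵣ.sym (ℂᵣ.trans (ℂᵣ.*-congˡ {fromℝ ‖ v ‖} (·-• M c v i))
        (ℂᵣ.trans (ℂᵣ.sym (ℂᵣ.*-assoc (fromℝ ‖ v ‖) c ((M · v) i)))
          (ℂᵣ.trans (ℂᵣ.*-congʳ ‖v‖c≈1) (ℂᵣ.*-identityˡ ((M · v) i)))))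

      ‖cv‖≤1 : ‖ c • v ‖ ≤ 1#
      ‖cv‖≤1 = begin
        ‖ c • v ‖                ≈⟨ homogeneous c v ⟩
        ∣ c ∣ᶜ * ‖ v ‖           ≈⟨ *-congʳ (trans (∣fromℝ∣≈∣∣ _) (0≤x⇒∣x∣≈x (<⇒≤ (0<x⁻¹ 0<‖v‖)))) ⟩
        ‖ v ‖ ⁻¹ * ‖ v ‖         ≈⟨ trans (*-comm _ _) (x*x⁻¹≈1 0<‖v‖) ⟩
        1#                       ∎

    -- One length at which the radius has come below `q` is enough. The successor makes that length
    -- positive, since a root of order 0 is meaningless.
    jsr-word-bound : ∀ {B} (A : Fin B → Matrix d) λ* q → IsJointSpectralRadius ν A λ* →
                     λ* < q → 0# ≤ q →
                     ∃ λ T → ∀ (w : Word B (suc T)) v → ‖ matrixOf A w · v ‖ ≤ q ^ suc T * ‖ v ‖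
    jsr-word-bound {B} A λ* q jsr λ*<q 0≤q = T , λ w v →
      ≤-trans (inducedNorm-bound (matrixOf A w) v) (*-monoʳ-≤ (0≤size p v)
        (≤-trans (x≤Sup bounded (w , refl)) (root<⇒≤^ {suc T} (ℕ.s≤s (ℕ.z≤n {T})) 0≤q λₜ<q)))
      where
      close = jsr (q - λ*) (x<y⇒0<y-x λ*<q)
      T = proj₁ close
      λₜ<q : λ[ suc T ] ν A < q
      λₜ<q = <-by (x<y⇒0<y-x (≤-<-trans (x≤∣x∣ _) (proj₂ close (suc T) (ℕ.n≤1+n T))))
        (solve 3 (λ q l m → q :- m := (q :- l) :- (m :- l)) refl q λ* (λ[ suc T ] ν A))
      bounded : ∃ (IsUpperBound λ t → ∃ λ (w : Word B (suc T)) → t ≈ inducedNorm (matrixOf A w))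
      bounded = proj₁ bound , λ t (w , t≈) → ≤-respˡ (sym t≈) (proj₂ bound w)
        where bound = words-bounded (suc T) λ w → inducedNorm (matrixOf A w)

  module _ {B d : ℕ} (A : Fin B → Matrix d) where

    matrixOf-∷ : ∀ {K} r (w : Word B K) v → matrixOf A (r ∷ w) · v ≈ᵛ A r · matrixOf A w · v
    matrixOf-∷ r w v = *-· (A r) (matrixOf A w) v

    -- The last letter of a word acts first on the vector, which is the order in which `growth`
    -- applies letters.
    matrixOf-∷ʳ : ∀ {K} (w : Word B K) r v → matrixOf A (w ∷ʳ r) · v ≈ᵛ matrixOf A w · (A r · v)
    matrixOf-∷ʳ [] r v = ≈ᵛ-trans (matrixOf-∷ r [] v)
      (≈ᵛ-trans (·-cong (A r) (1ᴹ-· v)) (≈ᵛ-sym (1ᴹ-· (A r · v))))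
    matrixOf-∷ʳ (s ∷ w) r v = ≈ᵛ-trans (matrixOf-∷ s (w ∷ʳ r) v)
      (≈ᵛ-trans (·-cong (A s) (matrixOf-∷ʳ w r v)) (≈ᵛ-sym (matrixOf-∷ s w (A r · v))))

    -- The maximum of p(A_w v) over |w| = t. Since the recursion applies a letter to `v` before all
    -- others, `growth p s` at A_r v is at most `growth p (suc s)` at `v` by construction.
    growth : Seminorm d → ℕ → Seminorm d
    growth p zero    = p
    growth p (suc t) = maximum-seminorm λ r → pullback (A r) (growth p t)

    growth-≤ : ∀ p t v {c} → 0# ≤ c → (∀ (w : Word B t) → size p (matrixOf A w · v) ≤ c) →
               size (growth p t) v ≤ c
    growth-≤ p zero    v 0≤c bound = ≤-respˡ (size-cong p (1ᴹ-· v)) (bound [])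
    growth-≤ p (suc t) v 0≤c bound = maximum-≤ _ 0≤c λ r → growth-≤ p t (A r · v) 0≤c λ w →
      ≤-respˡ (size-cong p (matrixOf-∷ʳ w r v)) (bound (w ∷ʳ r))

    -- adapted p t = Σ_{s < t} q^(t-1-s) · growth p s
    adapted : ∀ {q} → 0# ≤ q → Seminorm d → ℕ → Seminorm d
    adapted 0≤q p zero    = zero-seminorm
    adapted 0≤q p (suc t) = scale-plus 0≤q (adapted 0≤q p t) (growth p t)

    -- A letter shifts the weighted sum by one place: each `growth p s` at A_r v becomes at most
    -- `growth p (suc s)` at `v`. Compared with q times the sum at `v`, the shifted sum lacks the
    -- lowest term q^t p(v) and gains `growth p t` at the top.
    adapted-step : ∀ {q} (0≤q : 0# ≤ q) p t r v →
                   size (adapted 0≤q p t) (A r · v) + q ^ t * size p v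
                     ≤ q * size (adapted 0≤q p t) v + size (growth p t) v
    adapted-step {q} 0≤q p zero    r v = ≤-reflexive
      (solve 2 (λ q x → :0 :+ :1 :* x := q :* :0 :+ x) refl q (size p v))
    adapted-step {q} 0≤q p (suc t) r v = begin
      q * a (A r · v) + g (A r · v) + q * q ^ t * size p v
        ≈⟨ solve 5 (λ q x y z w → q :* x :+ y :+ q :* z :* w := q :* (x :+ z :* w) :+ y) refl q (a (A r · v)) (g (A r · v)) (q ^ t) (size p v) ⟩
      q * (a (A r · v) + q ^ t * size p v) + g (A r · v)
        ≤⟨ +-mono-≤ (*-monoˡ-≤ 0≤q (adapted-step 0≤q p t r v)) (≤-maximum (λ s → g (A s · v)) r) ⟩
      q * (q * a v + g v) + size (growth p (suc t)) v           ∎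
      where
      a = size (adapted 0≤q p t)
      g = size (growth p t)

    adapted-definite : ∀ {q} (0<q : 0# < q) p → Definite p → ∀ t →
                       Definite (adapted (<⇒≤ 0<q) p (suc t))
    adapted-definite {q} 0<q p definite zero v small = definite v
      (≤-respˡ (solve 2 (λ q x → q :* :0 :+ x := x) refl q (size p v)) small)
    adapted-definite {q} 0<q p definite (suc t) v small = adapted-definite 0<q p definite t v
      (*-cancelˡ-≤ 0<q (begin
        q * a
          ≤⟨ ≤-by (0≤size (growth p (suc t)) v) (solve 2 (λ x y → x :+ y :- x := y) refl (q * a) g) ⟩
        q * a + g               ≤⟨ small ⟩
        0#                      ≈⟨ zeroʳ q ⟨
        q * 0#                  ∎))
      where
      a = size (adapted (<⇒≤ 0<q) p (suc t)) v
      g = size (growth p (suc t)) v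

    -- The two boundary terms of `adapted-step` cancel, because the bound on words of length `T`
    -- keeps `growth p T` below `q ^ T` times `p`.
    adapted-contracts : ∀ {q} (0≤q : 0# ≤ q) p T →
                        (∀ (w : Word B T) v → size p (matrixOf A w · v) ≤ q ^ T * size p v) →
                        ∀ r v → size (adapted 0≤q p T) (A r · v) ≤ q * size (adapted 0≤q p T) v
    adapted-contracts {q} 0≤q p T bound r v =
      ≤-by (0≤-+ (x≤y⇒0≤y-x (adapted-step 0≤q p T r v)) (x≤y⇒0≤y-x
             (growth-≤ p T v (*-nonNeg (0≤^ T 0≤q) (0≤size p v)) λ w → bound w v)))
        (solve 4 (λ x y a g → a :- x := ((a :+ g) :- (x :+ y)) :+ (y :- g)) refl
          (size (adapted 0≤q p T) (A r · v)) (q ^ T * size p v) (q * size (adapted 0≤q p T) v) (size (growth p T) v))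

  abstract
    contracting-norm : ∀ {B d} (ν : Norm d) (A : Fin B → Matrix d) λ* ρ →
                       IsJointSpectralRadius ν A λ* → λ* < ρ → 0# < ρ →
                       ∃ λ q → (0# < q × q < ρ) ×
                         ∃ λ p → Definite p × (∀ r v → size p (A r · v) ≤ q * size p v)
    contracting-norm ν A λ* ρ jsr λ*<ρ 0<ρ =
      -- The maximum with 0 makes `q` positive; then the lowest summand q^T p makes the adapted norm
      -- definite.
      let q , λ*⊔0<q , q<ρ = midpoint (⊔-< λ*<ρ 0<ρ)
          0<q = ≤-<-trans (x≤y⊔x λ* 0#) λ*⊔0<q
          T , bound = jsr-word-bound ν A λ* q jsr (≤-<-trans (x≤x⊔y λ* 0#) λ*⊔0<q) (<⇒≤ 0<q)
          p = fromNorm ν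
      in q , (0<q , q<ρ) , adapted A (<⇒≤ 0<q) p (suc T) ,
         adapted-definite A 0<q p (fromNorm-definite ν) T ,
         adapted-contracts A (<⇒≤ 0<q) p (suc T) bound

-- The dilation equation and its continuous solution.

module Dilation (em : ExcludedMiddle 0ℓ) (𝐑 : CompleteOrderedField) where
  open Analysis em 𝐑
  open RealAnalysis em 𝐑
  open ComplexNumbers em 𝐑
  open NormedSpaces em 𝐑
  open AdaptedNorms em 𝐑
  open ℂₛ using () renaming
    (solve to solveᶜ; _:=_ to _⊜_; _:+_ to _⊕_; _:*_ to _⊗_; _:-_ to _⊖_; :0 to :0ᶜ)

  -- A natural number as length, unlike `Fin′`, admits `toℕ r`, its successor and the full length
  -- `n` alike.
  prefix : ∀ {n d} → (Fin n → ℂ^ d) → ℕ → ℂ^ d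
  prefix {zero}  f k       = 0ᵛ
  prefix {suc n} f zero    = 0ᵛ
  prefix {suc n} f (suc k) = f zero +ᵛ prefix (f ∘ suc) k

  prefix-zero : ∀ {n d} (f : Fin n → ℂ^ d) → prefix f 0 ≈ᵛ 0ᵛ
  prefix-zero {zero}  f = ≈ᵛ-refl
  prefix-zero {suc n} f = ≈ᵛ-refl

  prefix-inject : ∀ {n d} (f : Fin n → ℂ^ d) r →
                  sumᵛ (λ (s : Fin′ r) → f (inject s)) ≈ᵛ prefix f (toℕ r)
  prefix-inject f zero    = ≈ᵛ-refl
  prefix-inject f (suc r) = +ᵛ-cong (≈ᵛ-refl {v = f zero}) (prefix-inject (f ∘ suc) r)

  prefix-suc : ∀ {n d} (f : Fin n → ℂ^ d) r → prefix f (suc (toℕ r)) ≈ᵛ prefix f (toℕ r) +ᵛ f r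
  prefix-suc f zero    i = ℂᵣ.trans (ℂᵣ.+-congˡ {f zero i} (prefix-zero (f ∘ suc) i)) (ℂᵣ.+-comm (f zero i) 0ᶜ)
  prefix-suc f (suc r) i = ℂᵣ.trans (ℂᵣ.+-congˡ {f zero i} (prefix-suc (f ∘ suc) r i))
    (ℂᵣ.sym (ℂᵣ.+-assoc (f zero i) (prefix (f ∘ suc) (toℕ r) i) (f (suc r) i)))

  prefix-all : ∀ {n d} (f : Fin n → ℂ^ d) → prefix f n ≈ᵛ sumᵛ f
  prefix-all {zero}  f = ≈ᵛ-refl
  prefix-all {suc n} f = +ᵛ-cong (≈ᵛ-refl {v = f zero}) (prefix-all (f ∘ suc))

  -- The last interval is closed on the right, so that t = n + 1, which stands for x = 1, has a
  -- digit too; the disjunction records that the other intervals are half-open.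
  locate-digit : ∀ n t → 0# ≤ t → t ≤ ι (suc n) →
                 ∃ λ (r : Fin (suc n)) → ι (toℕ r) ≤ t × t ≤ ι (suc (toℕ r)) ×
                   (t < ι (suc (toℕ r)) ⊎ toℕ r ≡ n)
  locate-digit zero    t 0≤t t≤1 = zero , 0≤t , t≤1 , inj₂ ≡.refl
  locate-digit (suc n) t 0≤t t≤ with ≤⊎> 1# t
  ... | inj₂ t<1 = zero , 0≤t , <⇒≤ t<ι1 , inj₁ t<ι1
    where t<ι1 = <-respʳ (sym (+-identityʳ 1#)) t<1
  ... | inj₁ 1≤t = let r , lower , upper , inner = locate-digit n (t - 1#) (x≤y⇒0≤y-x 1≤t)
                                                      (≤-by (x≤y⇒0≤y-x t≤) (shift t (ι (suc n))))
    in suc r ,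
       ≤-by (x≤y⇒0≤y-x lower) (solve 2 (λ t i → t :- (:1 :+ i) := (t :- :1) :- i) refl t _) ,
       ≤-by (x≤y⇒0≤y-x upper) (sym (shift t _)) ,
       shift-inner inner
    where
    shift : ∀ t i → i - (t - 1#) ≈ (1# + i) - t
    shift = solve 2 (λ t i → i :- (t :- :1) := (:1 :+ i) :- t) refl
    shift-inner : ∀ {r} → t - 1# < ι (suc (toℕ r)) ⊎ toℕ r ≡ n →
                   t < ι (suc (toℕ {suc (suc n)} (suc r))) ⊎ suc (toℕ r) ≡ suc n
    shift-inner (inj₁ t-1<) = inj₁ (<-by (x<y⇒0<y-x t-1<) (sym (shift t _)))
    shift-inner (inj₂ r≡n)  = inj₂ (≡.cong suc r≡n)

  below : ∀ {x y} → 0# < x → 0# < y → ∃ λ m → 0# < m × m ≤ x × m ≤ y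
  below {x} {y} 0<x 0<y with total x y
  ... | inj₁ x≤y = x , 0<x , ≤-refl , x≤y
  ... | inj₂ y≤x = y , 0<y , y≤x , ≤-refl

  -- The expanding branches x ↦ Bx - r.

  module Digits (b : ℕ) where
    β : ℝ
    β = ι (suc b)

    0<β : 0# < β
    0<β = 0<ι {suc b} (ℕ.s≤s ℕ.z≤n)

    0≤β : 0# ≤ β
    0≤β = <⇒≤ 0<β

    0≤β⁻¹ : 0# ≤ β ⁻¹
    0≤β⁻¹ = <⇒≤ (0<x⁻¹ 0<β)

    β*xβ⁻¹≈x : ∀ x → β * (x * β ⁻¹) ≈ x
    β*xβ⁻¹≈x x = trans (solve 3 (λ b x i → b :* (x :* i) := x :* (b :* i)) refl β x (β ⁻¹))
                   (trans (*-congˡ (x*x⁻¹≈1 0<β)) (*-identityʳ x))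

    ι≤b : ∀ (r : Fin (suc b)) → ι (toℕ r) ≤ ι b
    ι≤b r = ι-mono (ℕ.s≤s⁻¹ (Fin.toℕ<n r))

    0̂ 1̂ : [0,1]
    0̂ = 0# , ≤-refl , 0≤1
    1̂ = 1# , 0≤1 , ≤-refl

    -- y is the image of x under the expanding branch mapping [r/B, (r+1)/B] onto [0,1].
    Branch : Fin (suc b) → [0,1] → [0,1] → Set
    Branch r x y = proj₁ y ≈ β * proj₁ x - ι (toℕ r)

    branch : ∀ r (x : [0,1]) → ι (toℕ r) ≤ β * proj₁ x → β * proj₁ x ≤ ι (suc (toℕ r)) →
             ∃ λ y → Branch r x y
    branch r x lower upper = (β * proj₁ x - ι (toℕ r) , x≤y⇒0≤y-x lower ,
      ≤-by (x≤y⇒0≤y-x upper) (solve 2 (λ t i → :1 :- (t :- i) := :1 :+ i :- t) refl _ _)) , refl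

    abstract
      -- The final disjunction is what later places every word with a larger first letter strictly
      -- to the right of `x`.
      locate : (x : [0,1]) → ∃ λ r → ∃ λ y → Branch r x y × (proj₁ y < 1# ⊎ toℕ r ≡ b)
      locate x@(t , 0≤t , t≤1) = located (locate-digit b (β * t) (*-nonNeg 0≤β 0≤t)
                                    (≤-respʳ (*-identityʳ β) (*-monoˡ-≤ 0≤β t≤1)))
        where
        located : (∃ λ (r : Fin (suc b)) → ι (toℕ r) ≤ β * t × β * t ≤ ι (suc (toℕ r)) ×
                    (β * t < ι (suc (toℕ r)) ⊎ toℕ r ≡ b)) →
                  ∃ λ r → ∃ λ y → Branch r x y × (proj₁ y < 1# ⊎ toℕ r ≡ b)
        located (r , lower , upper , inj₁ inner) = r , proj₁ (branch r x lower upper) , refl ,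
          inj₁ (<-by (x<y⇒0<y-x inner) (solve 2 (λ t i → :1 :- (t :- i) := :1 :+ i :- t) refl _ _))
        located (r , lower , upper , inj₂ last)   = r , proj₁ (branch r x lower upper) , refl , inj₂ last

    digit : [0,1] → Fin (suc b)
    digit x = proj₁ (locate x)

    scaled : [0,1] → [0,1]
    scaled x = proj₁ (proj₂ (locate x))

    located : ∀ x → Branch (digit x) x (scaled x)
    located x = proj₁ (proj₂ (proj₂ (locate x)))

    -- The images satisfy y - y′ = r′ - r ≥ 1 and both lie in [0,1]. This leaves neighbouring digits
    -- only, with `x` at their common endpoint.
    branches-adjacent : ∀ {r r′ x y y′} → Branch r x y → Branch r′ x y′ → toℕ r ℕ.< toℕ r′ →
                        toℕ r′ ≡ suc (toℕ r) × proj₁ y ≈ 1# × proj₁ y′ ≈ 0#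
    branches-adjacent {r} {r′} {x} {y , 0≤y , y≤1} {y′ , 0≤y′ , y′≤1} at-r at-r′ r<r′ =
      ℕ.≤-antisym (ℕ.≮⇒≥ λ 1+r<r′ → <⇒≱ (1<2 1+r<r′) y≤1) r<r′ ,
      antisym y≤1 (≤-trans (≤-by 0≤y′ (solve 1 (λ y → :1 :+ y :- :1 := y) refl y′)) 1+y′≤y) ,
      antisym (≤-by (x≤y⇒0≤y-x (≤-trans 1+y′≤y y≤1)) (solve 1 (λ y → :0 :- y := :1 :- (:1 :+ y)) refl y′)) 0≤y′
      where
      t = β * proj₁ x
      y-y′ : y - y′ ≈ ι (toℕ r′) - ι (toℕ r)
      y-y′ = trans (+-cong at-r (-‿cong at-r′)) (solve 3 (λ t i j → (t :- i) :- (t :- j) := j :- i) refl t (ι (toℕ r)) (ι (toℕ r′)))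
      1+y′≤y : 1# + y′ ≤ y
      1+y′≤y = ≤-by (x≤y⇒0≤y-x (ι-mono r<r′)) (begin-equality
        y - (1# + y′)
          ≈⟨ solve 2 (λ y z → y :- (:1 :+ z) := (y :- z) :- :1) refl y y′ ⟩
        (y - y′) - 1#                             ≈⟨ +-congʳ y-y′ ⟩
        ι (toℕ r′) - ι (toℕ r) - 1#
          ≈⟨ solve 2 (λ i j → j :- i :- :1 := j :- (:1 :+ i)) refl (ι (toℕ r)) (ι (toℕ r′)) ⟩
        ι (toℕ r′) - ι (suc (toℕ r))              ∎)
      1<2 : suc (suc (toℕ r)) ℕ.≤ toℕ r′ → 1# < y
      1<2 far = <-by (0<-+ 0<1 (0≤-+ 0≤y′ (x≤y⇒0≤y-x (ι-mono far)))) (begin-equality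
        y - 1#
          ≈⟨ solve 2 (λ y z → y :- :1 := (y :- z) :+ z :- :1) refl y y′ ⟩
        (y - y′) + y′ - 1#                                       ≈⟨ +-congʳ (+-congʳ y-y′) ⟩
        ι (toℕ r′) - ι (toℕ r) + y′ - 1#
          ≈⟨ solve 3 (λ i j z → j :- i :+ z :- :1 := :1 :+ (z :+ (j :- (:1 :+ (:1 :+ i))))) refl (ι (toℕ r)) (ι (toℕ r′)) y′ ⟩
        1# + (y′ + (ι (toℕ r′) - ι (suc (suc (toℕ r)))))         ∎)

  Respects : ∀ {d} → ([0,1] → ℂ^ d) → Set
  Respects Φ = ∀ x y → proj₁ x ≈ proj₁ y → Φ x ≈ᵛ Φ y

  -- The invariant of the iteration: the end values 0 and `V` make neighbouring pieces meet, and
  -- `respects` rules out dependence on the proofs carried by elements of [0,1].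
  record Admissible {d} (V : ℂ^ d) (Φ : [0,1] → ℂ^ d) : Set where
    field
      respects : Respects Φ
      at-zero  : ∀ x → proj₁ x ≈ 0# → Φ x ≈ᵛ 0ᵛ
      at-one   : ∀ x → proj₁ x ≈ 1# → Φ x ≈ᵛ V
  open Admissible

  -- Stated for x ≤ y only, which avoids absolute values.
  UniformlyContinuous : ∀ {d} → Seminorm d → ([0,1] → ℂ^ d) → Set
  UniformlyContinuous p Φ = ∀ ε → 0# < ε → ∃ λ δ → 0# < δ ×
    (∀ x y → proj₁ x ≤ proj₁ y → proj₁ y - proj₁ x ≤ δ → size p (Φ y -ᵛ Φ x) ≤ ε)

  -- The dilation operator and its fixed point.

  module Operator
    (b d : ℕ) (A : Fin (suc b) → Matrix d) (V : ℂ^ d) (μ : ℂ) (μ≉0 : μ ≉ᶜ 0ᶜ)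
    (eigenvector : sumᵛ (λ r → A r · V) ≈ᵛ μ • V)
    (p : Seminorm d) (definite : Definite p)
    (q : ℝ) (0≤q : 0# ≤ q) (contracts : ∀ r v → size p (A r · v) ≤ q * size p v)
    (q/μ<1 : ∣ μ ⁻¹ᶜ ∣ᶜ * q < 1#)
    where
    open Digits b

    a : ℝ
    a = ∣ μ ⁻¹ᶜ ∣ᶜ * q

    0≤a : 0# ≤ a
    0≤a = *-nonNeg (0≤∣∣ᶜ (μ ⁻¹ᶜ)) 0≤q

    AV : Fin (suc b) → ℂ^ d
    AV r = A r · V

    -- The right-hand side of the equation with Φ(Bx - r) replaced by a free vector, so that fitting
    -- the pieces together concerns only the two arguments `0ᵛ` and `V`.
    glue : Fin (suc b) → ℂ^ d → ℂ^ d
    glue r v = μ ⁻¹ᶜ • (prefix AV (toℕ r) +ᵛ A r · v)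

    glue-cong : ∀ r {v w} → v ≈ᵛ w → glue r v ≈ᵛ glue r w
    glue-cong r v≈w i = ℂᵣ.*-congˡ {μ ⁻¹ᶜ} (ℂᵣ.+-congˡ {prefix AV (toℕ r) i} (·-cong (A r) v≈w i))

    glue-contracts : ∀ r v w → size p (glue r v -ᵛ glue r w) ≤ a * size p (v -ᵛ w)
    glue-contracts r v w = begin
      size p (glue r v -ᵛ glue r w)                     ≈⟨ size-cong p difference ⟩
      size p (μ ⁻¹ᶜ • (A r · (v -ᵛ w)))                 ≤⟨ subhomogeneous p (μ ⁻¹ᶜ) (A r · (v -ᵛ w)) ⟩
      ∣ μ ⁻¹ᶜ ∣ᶜ * size p (A r · (v -ᵛ w))              ≤⟨ *-monoˡ-≤ (0≤∣∣ᶜ (μ ⁻¹ᶜ)) (contracts r (v -ᵛ w)) ⟩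
      ∣ μ ⁻¹ᶜ ∣ᶜ * (q * size p (v -ᵛ w))                ≈⟨ *-assoc _ _ _ ⟨
      a * size p (v -ᵛ w)                               ∎
      where
      difference : glue r v -ᵛ glue r w ≈ᵛ μ ⁻¹ᶜ • (A r · (v -ᵛ w))
      difference i = ℂᵣ.trans
        (solveᶜ 4 (λ m c x y → m ⊗ (c ⊕ x) ⊖ m ⊗ (c ⊕ y) ⊜ m ⊗ (x ⊖ y)) ℂᵣ.refl
          (μ ⁻¹ᶜ) (prefix AV (toℕ r) i) ((A r · v) i) ((A r · w) i))
        (ℂᵣ.*-congˡ {μ ⁻¹ᶜ} (ℂᵣ.sym (·--ᵛ (A r) v w i)))

    -- `A r · V` is the very summand by which the next prefix sum is longer.
    glue-junction : ∀ {r r′} → toℕ r′ ≡ suc (toℕ r) → glue r V ≈ᵛ glue r′ 0ᵛ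
    glue-junction {r} {r′} r′≡ i = ℂᵣ.*-congˡ {μ ⁻¹ᶜ} (ℂᵣ.trans
      (ℂᵣ.sym (prefix-suc AV r i))
      (ℂᵣ.trans (ℂᵣ.reflexive (≡.cong (λ k → prefix AV k i) (≡.sym r′≡)))
        (ℂᵣ.trans (ℂᵣ.sym (ℂᵣ.+-identityʳ (prefix AV (toℕ r′) i)))
          (ℂᵣ.+-congˡ {prefix AV (toℕ r′) i} (ℂᵣ.sym (·-0ᵛ (A r′) i))))))

    glue-first : glue zero 0ᵛ ≈ᵛ 0ᵛ
    glue-first i = ℂᵣ.trans
      (ℂᵣ.*-congˡ {μ ⁻¹ᶜ} (ℂᵣ.trans (ℂᵣ.+-congˡ {0ᶜ} (·-0ᵛ (A zero) i)) (ℂᵣ.+-identityˡ 0ᶜ)))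
      (ℂᵣ.zeroʳ (μ ⁻¹ᶜ))

    -- Here the eigenvector equation enters: the full prefix sum is QV = μV.
    glue-last : glue (fromℕ b) V ≈ᵛ V
    glue-last i = ℂᵣ.trans (ℂᵣ.*-congˡ {μ ⁻¹ᶜ} (ℂᵣ.trans
        (ℂᵣ.sym (prefix-suc AV (fromℕ b) i))
        (ℂᵣ.trans (ℂᵣ.reflexive (≡.cong (λ k → prefix AV (suc k) i) (Fin.toℕ-fromℕ b)))
          (ℂᵣ.trans (prefix-all AV i) (eigenvector i)))))
      (ℂᵣ.trans (ℂᵣ.sym (ℂᵣ.*-assoc (μ ⁻¹ᶜ) μ (V i)))
        (ℂᵣ.trans (ℂᵣ.*-congʳ (ℂᵣ.trans (ℂᵣ.*-comm (μ ⁻¹ᶜ) μ) (⁻¹ᶜ-inverseʳ {μ} μ≉0))) (ℂᵣ.*-identityˡ (V i))))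

    -- The digit taken at an endpoint is a convention of `locate`; `𝒯-branch` makes it immaterial
    -- for admissible functions.
    𝒯 : ([0,1] → ℂ^ d) → [0,1] → ℂ^ d
    𝒯 Φ x = glue (digit x) (Φ (scaled x))

    𝒯-contracts : ∀ {Φ Ψ c} → (∀ x → size p (Φ x -ᵛ Ψ x) ≤ c) →
                  ∀ x → size p (𝒯 Φ x -ᵛ 𝒯 Ψ x) ≤ a * c
    𝒯-contracts close x = ≤-trans (glue-contracts (digit x) _ _) (*-monoˡ-≤ 0≤a (close (scaled x)))

    -- Different digits occur only at a junction, where one image is 1 and the other 0; both sides
    -- then reduce to the junction value.
    glue-coherent : ∀ {Φ} → Admissible V Φ → ∀ {x r r′ y y′} → Branch r x y → Branch r′ x y′ →
                    glue r (Φ y) ≈ᵛ glue r′ (Φ y′)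
    glue-coherent {Φ} adm {x} {r} {r′} {y} {y′} at-r at-r′ with ℕ.<-cmp (toℕ r) (toℕ r′)
    ... | tri< r<r′ _ _ = let r′≡ , y≈1 , y′≈0 = branches-adjacent {r} {r′} {x} {y} {y′} at-r at-r′ r<r′ in
      ≈ᵛ-trans (glue-cong r (at-one adm y y≈1))
        (≈ᵛ-trans (glue-junction r′≡) (glue-cong r′ (≈ᵛ-sym (at-zero adm y′ y′≈0))))
    ... | tri> _ _ r′<r = let r≡ , y′≈1 , y≈0 = branches-adjacent {r′} {r} {x} {y′} {y} at-r′ at-r r′<r in
      ≈ᵛ-trans (glue-cong r (at-zero adm y y≈0))
        (≈ᵛ-trans (≈ᵛ-sym (glue-junction r≡)) (glue-cong r′ (≈ᵛ-sym (at-one adm y′ y′≈1))))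
    ... | tri≈ _ r≡r′ _ with Fin.toℕ-injective r≡r′
    ...   | ≡.refl = glue-cong r (respects adm y y′ (trans at-r (sym at-r′)))

    𝒯-branch : ∀ {Φ} → Admissible V Φ → ∀ {r x y} → Branch r x y → 𝒯 Φ x ≈ᵛ glue r (Φ y)
    𝒯-branch adm {r} {x} {y} at-r = glue-coherent adm {x} {y = scaled x} {y} (located x) at-r

    𝒯-admissible : ∀ {Φ} → Admissible V Φ → Admissible V (𝒯 Φ)
    𝒯-admissible {Φ} adm = record
      { respects = λ x y x≈y → ≈ᵛ-sym (𝒯-branch adm {digit x} {y} {scaled x}
          (trans (located x) (+-congʳ (*-congˡ x≈y))))
      ; at-zero  = λ x x≈0 → ≈ᵛ-trans
          (𝒯-branch adm {zero} {x} {0̂} (sym (trans (+-congʳ (trans (*-congˡ x≈0) (zeroʳ β))) (-‿inverseʳ 0#))))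
          (≈ᵛ-trans (glue-cong zero (at-zero adm 0̂ refl)) glue-first)
      ; at-one   = λ x x≈1 → ≈ᵛ-trans
          (𝒯-branch adm {fromℕ b} {x} {1̂} (sym (begin-equality
            β * proj₁ x - ι (toℕ (fromℕ b))
              ≈⟨ +-cong (*-congˡ x≈1) (-‿cong (reflexive (≡.cong ι (Fin.toℕ-fromℕ b)))) ⟩
            (1# + ι b) * 1# - ι b              ≈⟨ solve 1 (λ i → (:1 :+ i) :* :1 :- i := :1) refl (ι b) ⟩
            1#                                 ∎)))
          (≈ᵛ-trans (glue-cong (fromℕ b) (at-one adm 1̂ refl)) glue-last) }

    a*x≤x : ∀ {x} → 0# ≤ x → a * x ≤ x
    a*x≤x 0≤x = ≤-respʳ (*-identityˡ _) (*-monoʳ-≤ 0≤x (<⇒≤ q/μ<1))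

    𝒯-uniformlyContinuous : ∀ {Φ} → Admissible V Φ → UniformlyContinuous p Φ → UniformlyContinuous p (𝒯 Φ)
    𝒯-uniformlyContinuous {Φ} adm uc ε 0<ε =
      m * β ⁻¹ , 0<-* 0<m (0<x⁻¹ 0<β) , λ x y x≤y y-x≤ → close x y x≤y (begin
        β * (proj₁ y - proj₁ x)    ≤⟨ *-monoˡ-≤ 0≤β y-x≤ ⟩
        β * (m * β ⁻¹)             ≈⟨ β*xβ⁻¹≈x m ⟩
        m                          ∎)
      where
      δ = proj₁ (uc (ε * ½) (0<x½ 0<ε))
      0<δ = proj₁ (proj₂ (uc (ε * ½) (0<x½ 0<ε)))
      Φ-close = proj₂ (proj₂ (uc (ε * ½) (0<x½ 0<ε)))

      -- The bound by 1 lets `y` reach the next subinterval at most, so that its image there stays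
      -- in [0,1].
      m = proj₁ (below 0<δ 0<1)
      0<m = proj₁ (proj₂ (below 0<δ 0<1))
      m≤δ = proj₁ (proj₂ (proj₂ (below 0<δ 0<1)))
      m≤1 = proj₂ (proj₂ (proj₂ (below 0<δ 0<1)))

      glue-close : ∀ r u v → proj₁ u ≤ proj₁ v → proj₁ v - proj₁ u ≤ m →
                   size p (glue r (Φ v) -ᵛ glue r (Φ u)) ≤ ε * ½
      glue-close r u v u≤v v-u≤m = begin
        size p (glue r (Φ v) -ᵛ glue r (Φ u))    ≤⟨ glue-contracts r (Φ v) (Φ u) ⟩
        a * size p (Φ v -ᵛ Φ u)                  ≤⟨ a*x≤x (0≤size p _) ⟩
        size p (Φ v -ᵛ Φ u)                      ≤⟨ Φ-close u v u≤v (≤-trans v-u≤m m≤δ) ⟩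
        ε * ½                                    ∎

      close : ∀ x y → proj₁ x ≤ proj₁ y → β * (proj₁ y - proj₁ x) ≤ m → size p (𝒯 Φ y -ᵛ 𝒯 Φ x) ≤ ε
      close x y x≤y small = case-split (≤⊎> (β * proj₁ y) (ι (suc (toℕ r))))
        where
        r = digit x
        u = scaled x
        s = proj₁ x
        t = proj₁ y
        i = ι (toℕ r)
        βs≤βt = *-monoˡ-≤ 0≤β x≤y
        i≤βs : i ≤ β * s
        i≤βs = ≤-by (proj₁ (proj₂ u)) (sym (located x))

        case-split : β * t ≤ 1# + i ⊎ 1# + i < β * t → size p (𝒯 Φ y -ᵛ 𝒯 Φ x) ≤ ε
        case-split (inj₁ βt≤1+i) = begin
          size p (𝒯 Φ y -ᵛ 𝒯 Φ x)
            ≈⟨ size-cong p (-ᵛ-cong (𝒯-branch adm {r} {y} {v} (proj₂ (branch r y (≤-trans i≤βs βs≤βt) βt≤1+i))) ≈ᵛ-refl) ⟩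
          size p (glue r (Φ v) -ᵛ glue r (Φ u))      ≤⟨ glue-close r u v
              (≤-by (x≤y⇒0≤y-x βs≤βt) (trans (+-congˡ (-‿cong (located x))) (solve 3 (λ x y i → (y :- i) :- (x :- i) := y :- x) refl (β * s) (β * t) i)))
              (≤-trans (≤-reflexive (trans (+-congˡ (-‿cong (located x))) (solve 4 (λ b s t i → (b :* t :- i) :- (b :* s :- i) := b :* (t :- s)) refl β s t i))) small) ⟩
          ε * ½                                      ≤⟨ <⇒≤ (x½<x 0<ε) ⟩
          ε                                          ∎
          where v = proj₁ (branch r y (≤-trans i≤βs βs≤βt) βt≤1+i)
        -- The points lie on both sides of a junction. Its value, `glue r V` and `glue r′ 0ᵛ` at
        -- once, is inserted between them, and each side costs ε/2.
        case-split (inj₂ 1+i<βt) = begin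
          size p (𝒯 Φ y -ᵛ 𝒯 Φ x)
            ≤⟨ size-sub-trans p (𝒯 Φ y) (glue r V) (𝒯 Φ x) ⟩
          size p (𝒯 Φ y -ᵛ glue r V) + size p (glue r V -ᵛ 𝒯 Φ x)
            ≈⟨ +-cong (size-cong p (-ᵛ-cong (𝒯-branch adm {r′} {y} {w} Branch-r′)
                (≈ᵛ-trans (glue-junction r′≡) (glue-cong r′ (≈ᵛ-sym (at-zero adm 0̂ refl))))))
                (size-cong p (-ᵛ-cong (glue-cong r (≈ᵛ-sym (at-one adm 1̂ refl))) ≈ᵛ-refl)) ⟩
          size p (glue r′ (Φ w) -ᵛ glue r′ (Φ 0̂)) + size p (glue r (Φ 1̂) -ᵛ glue r (Φ u))
            ≤⟨ +-mono-≤ (glue-close r′ 0̂ w (proj₁ (proj₂ w)) w≤m) (glue-close r u 1̂ (proj₂ (proj₂ u)) 1-u≤m) ⟩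
          ε * ½ + ε * ½                                                                  ≈⟨ x½+x½≈x ε ⟩
          ε                                                                              ∎
          where
          r<b : toℕ r ℕ.< b
          r<b = ℕ.≤∧≢⇒< (ℕ.s≤s⁻¹ (Fin.toℕ<n r)) λ r≡b → <⇒≱ 1+i<βt (begin
            β * t             ≤⟨ *-monoˡ-≤ 0≤β (proj₂ (proj₂ y)) ⟩
            β * 1#            ≈⟨ *-identityʳ β ⟩
            1# + ι b          ≡⟨ ≡.cong (λ k → 1# + ι k) r≡b ⟨
            1# + i            ∎)
          r′ = fromℕ< (ℕ.s≤s r<b)
          r′≡ : toℕ r′ ≡ suc (toℕ r)
          r′≡ = Fin.toℕ-fromℕ< (ℕ.s≤s r<b)
          gap≤m : β * t - (1# + i) ≤ m
          gap≤m = ≤-trans (≤-by (x≤y⇒0≤y-x (proj₂ (proj₂ u)))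
            (trans (solve 4 (λ b s t i → b :* (t :- s) :- (b :* t :- (:1 :+ i)) := :1 :- (b :* s :- i)) refl β s t i)
              (+-congˡ (-‿cong (sym (located x)))))) small
          w : [0,1]
          w = β * t - (1# + i) , x≤y⇒0≤y-x (<⇒≤ 1+i<βt) , ≤-trans gap≤m m≤1
          Branch-r′ : Branch r′ y w
          Branch-r′ = +-congˡ (-‿cong (reflexive (≡.cong ι (≡.sym r′≡))))
          w≤m : proj₁ w - 0# ≤ m
          w≤m = ≤-respˡ (solve 1 (λ x → x := x :- :0) refl _) gap≤m
          1-u≤m : 1# - proj₁ u ≤ m
          1-u≤m = ≤-trans (≤-by (x≤y⇒0≤y-x (<⇒≤ 1+i<βt))
            (trans (+-congˡ (-‿cong (+-congˡ (-‿cong (located x)))))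
              (solve 4 (λ b s t i → b :* (t :- s) :- (:1 :- (b :* s :- i)) := b :* t :- (:1 :+ i)) refl β s t i))) small

    Φ₀ : [0,1] → ℂ^ d
    Φ₀ x = fromℝ (proj₁ x) • V

    Φ₀-admissible : Admissible V Φ₀
    Φ₀-admissible = record
      { respects = λ x y x≈y i → ℂᵣ.*-congʳ {V i} (x≈y , refl)
      ; at-zero  = λ x x≈0 i → ℂᵣ.trans (ℂᵣ.*-congʳ {V i} (x≈0 , refl)) (ℂᵣ.zeroˡ (V i))
      ; at-one   = λ x x≈1 i → ℂᵣ.trans (ℂᵣ.*-congʳ {V i} (x≈1 , refl)) (ℂᵣ.*-identityˡ (V i)) }

    size-ray : ∀ {t} → 0# ≤ t → size p (fromℝ t • V) ≤ t * size p V
    size-ray {t} 0≤t = ≤-trans (subhomogeneous p (fromℝ t) V)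
      (≤-reflexive (*-congʳ (trans (∣fromℝ∣≈∣∣ t) (0≤x⇒∣x∣≈x 0≤t))))

    Φ₀-uniformlyContinuous : UniformlyContinuous p Φ₀
    Φ₀-uniformlyContinuous ε 0<ε =
      let δ , 0<δ , small = absorb (0≤size p V) 0<ε in δ , 0<δ , λ x y x≤y y-x≤δ → begin
        size p (Φ₀ y -ᵛ Φ₀ x)                         ≈⟨ size-cong p (difference x y) ⟩
        size p (fromℝ (proj₁ y - proj₁ x) • V)        ≤⟨ size-ray (x≤y⇒0≤y-x x≤y) ⟩
        (proj₁ y - proj₁ x) * size p V                ≈⟨ *-comm _ _ ⟩
        size p V * (proj₁ y - proj₁ x)                ≤⟨ small y-x≤δ ⟩
        ε                                             ∎
      where
      difference : ∀ x y → Φ₀ y -ᵛ Φ₀ x ≈ᵛ fromℝ (proj₁ y - proj₁ x) • V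
      difference x y i = ℂᵣ.trans
        (solveᶜ 3 (λ s t v → t ⊗ v ⊖ s ⊗ v ⊜ (t ⊖ s) ⊗ v) ℂᵣ.refl (fromℝ (proj₁ x)) (fromℝ (proj₁ y)) (V i))
        (ℂᵣ.*-congʳ {V i} (refl , solve 0 (:0 :+ :- :0 := :0) refl))

    Φ : ℕ → [0,1] → ℂ^ d
    Φ zero    = Φ₀
    Φ (suc n) = 𝒯 (Φ n)

    Φ-admissible : ∀ n → Admissible V (Φ n)
    Φ-admissible zero    = Φ₀-admissible
    Φ-admissible (suc n) = 𝒯-admissible {Φ n} (Φ-admissible n)

    Φ-uniformlyContinuous : ∀ n → UniformlyContinuous p (Φ n)
    Φ-uniformlyContinuous zero    = Φ₀-uniformlyContinuous
    Φ-uniformlyContinuous (suc n) = 𝒯-uniformlyContinuous {Φ n} (Φ-admissible n) (Φ-uniformlyContinuous n)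

    Φ₀-bound : ∀ x → size p (Φ₀ x) ≤ size p V
    Φ₀-bound (t , 0≤t , t≤1) = ≤-trans (size-ray 0≤t)
      (≤-respʳ (*-identityˡ _) (*-monoʳ-≤ (0≤size p V) t≤1))

    glue-bounded : ∃ λ M → 0# ≤ M × (∀ r v → size p (glue r v) ≤ M + a * size p v)
    glue-bounded = maximum sizes , 0≤maximum sizes , λ r v → begin
      size p (glue r v)                                              ≤⟨ size-≤-sub p (glue r v) (glue r 0ᵛ) ⟩
      size p (glue r v -ᵛ glue r 0ᵛ) + size p (glue r 0ᵛ)
        ≤⟨ +-mono-≤ (glue-contracts r v 0ᵛ) (≤-maximum sizes r) ⟩
      a * size p (v -ᵛ 0ᵛ) + maximum sizes
        ≈⟨ +-congʳ (*-congˡ (size-cong p λ i → solveᶜ 1 (λ v → v ⊖ :0ᶜ ⊜ v) ℂᵣ.refl (v i))) ⟩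
      a * size p v + maximum sizes                                   ≈⟨ +-comm _ _ ⟩
      maximum sizes + a * size p v                                   ∎
      where
      sizes : Fin (suc b) → ℝ
      sizes r = size p (glue r 0ᵛ)

    -- The first iterate moves Φ₀ by at most D, hence all iterates stay within
    -- radius D / (1 - a) of Φ₀.
    D radius : ℝ
    D = proj₁ glue-bounded + a * size p V + size p V
    radius = D * (1# - a) ⁻¹

    0<1-a : 0# < 1# - a
    0<1-a = x<y⇒0<y-x q/μ<1

    0≤radius : 0# ≤ radius
    0≤radius = *-nonNeg
      (0≤-+ (0≤-+ (proj₁ (proj₂ glue-bounded)) (*-nonNeg 0≤a (0≤size p V))) (0≤size p V))
      (<⇒≤ (0<x⁻¹ 0<1-a))

    radius-fixed : a * radius + D ≈ radius
    radius-fixed = begin-equality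
      a * radius + D
        ≈⟨ +-congˡ (trans (*-congˡ (x*x⁻¹≈1 0<1-a)) (*-identityʳ D)) ⟨
      a * radius + D * ((1# - a) * (1# - a) ⁻¹)
        ≈⟨ solve 3 (λ a d i → a :* (d :* i) :+ d :* ((:1 :- a) :* i) := d :* i) refl a D ((1# - a) ⁻¹) ⟩
      radius                                          ∎

    Φ-near-Φ₀ : ∀ m x → size p (Φ m x -ᵛ Φ₀ x) ≤ radius
    Φ-near-Φ₀ zero    x = ≤-respˡ (sym (size-sub-self p (≈ᵛ-refl {v = Φ₀ x}))) 0≤radius
    Φ-near-Φ₀ (suc m) x = begin
      size p (𝒯 (Φ m) x -ᵛ Φ₀ x)
        ≤⟨ size-sub-trans p (𝒯 (Φ m) x) (𝒯 Φ₀ x) (Φ₀ x) ⟩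
      size p (𝒯 (Φ m) x -ᵛ 𝒯 Φ₀ x) + size p (𝒯 Φ₀ x -ᵛ Φ₀ x)
        ≤⟨ +-mono-≤ (𝒯-contracts {_} {_} (Φ-near-Φ₀ m) x) (≤-trans (size-sub-≤ p (𝒯 Φ₀ x) (Φ₀ x))
            (+-mono-≤ (≤-trans (proj₂ (proj₂ glue-bounded) (digit x) (Φ₀ (scaled x))) (+-mono-≤ ≤-refl (*-monoˡ-≤ 0≤a (Φ₀-bound (scaled x))))) (Φ₀-bound x))) ⟩
      a * radius + D                                              ≈⟨ radius-fixed ⟩
      radius                                                      ∎

    -- Both iterates are `n` applications of `𝒯` to functions at distance at most `radius`.
    Φ-near-Φ : ∀ n m x → size p (Φ (n ℕ.+ m) x -ᵛ Φ n x) ≤ a ^ n * radius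
    Φ-near-Φ zero    m x = ≤-respʳ (sym (*-identityˡ radius)) (Φ-near-Φ₀ m x)
    Φ-near-Φ (suc n) m x = ≤-respʳ (sym (*-assoc a (a ^ n) radius)) (𝒯-contracts {_} {_} (Φ-near-Φ n m) x)

    aⁿradius-null : Null λ n → a ^ n * radius
    aⁿradius-null ε 0<ε = Eventually-map (λ n → ≤-respˡ (*-comm radius (a ^ n)))
      (Null-* radius 0≤radius (^-null 0≤a q/μ<1) ε 0<ε)

    Φ-cauchy : ∀ x → CauchySequence p λ n → Φ n x
    Φ-cauchy x ε 0<ε = let N , small = aⁿradius-null (ε * ½) (0<x½ 0<ε) in N , λ m n N≤m N≤n → begin
      size p (Φ m x -ᵛ Φ n x)                                 ≤⟨ size-sub-trans p (Φ m x) (Φ N x) (Φ n x) ⟩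
      size p (Φ m x -ᵛ Φ N x) + size p (Φ N x -ᵛ Φ n x)
        ≤⟨ +-mono-≤ (near N≤m) (≤-trans (size-sub-sym p (Φ N x) (Φ n x)) (near N≤n)) ⟩
      a ^ N * radius + a ^ N * radius
        ≤⟨ +-mono-≤ (small N ℕ.≤-refl) (small N ℕ.≤-refl) ⟩
      ε * ½ + ε * ½                                           ≈⟨ x½+x½≈x ε ⟩
      ε                                                       ∎
      where
      near : ∀ {N m} → N ℕ.≤ m → size p (Φ m x -ᵛ Φ N x) ≤ a ^ N * radius
      near {N} {m} N≤m = ≡.subst (λ k → size p (Φ k x -ᵛ Φ N x) ≤ a ^ N * radius)
        (ℕ.m+[n∸m]≡n N≤m) (Φ-near-Φ N (m ℕ.∸ N) x)

    abstract
      F : [0,1] → ℂ^ d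
      F x = proj₁ (complete-seminorm p definite (λ n → Φ n x) (Φ-cauchy x))

      Φ→F : ∀ x → Null λ n → size p (Φ n x -ᵛ F x)
      Φ→F x = proj₂ (complete-seminorm p definite (λ n → Φ n x) (Φ-cauchy x))

    Φ-near-F : ∀ n x → size p (Φ n x -ᵛ F x) ≤ a ^ n * radius
    Φ-near-F n x = ≤-from-ε λ ε 0<ε → let N , close = Φ→F x ε 0<ε in begin
      size p (Φ n x -ᵛ F x)
        ≤⟨ size-sub-trans p (Φ n x) (Φ (n ℕ.+ N) x) (F x) ⟩
      size p (Φ n x -ᵛ Φ (n ℕ.+ N) x) + size p (Φ (n ℕ.+ N) x -ᵛ F x)
        ≤⟨ +-mono-≤ (≤-trans (size-sub-sym p (Φ n x) (Φ (n ℕ.+ N) x)) (Φ-near-Φ n N x)) (close (n ℕ.+ N) (ℕ.m≤n+m N n)) ⟩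
      a ^ n * radius + ε                                                ∎

    -- A vector approached by the iterates at the rate a^n must be the limit. The fixed-point
    -- equation, compatibility with `_≈_` and both end values are instances; at the index `suc n`
    -- the iterate has the form `𝒯 (Φ n)`.
    F-inherits : ∀ {x w} → (∀ n → size p (Φ (suc n) x -ᵛ w) ≤ a ^ n * radius) → F x ≈ᵛ w
    F-inherits {x} {w} close = definite-sub p definite (Null-const⇒≤ (Null-+ aⁿradius-null aⁿradius-null) λ n → begin
      size p (F x -ᵛ w)
        ≤⟨ size-sub-trans p (F x) (Φ (suc n) x) w ⟩
      size p (F x -ᵛ Φ (suc n) x) + size p (Φ (suc n) x -ᵛ w)
        ≤⟨ +-mono-≤ (≤-trans (size-sub-sym p (F x) (Φ (suc n) x)) (≤-trans (Φ-near-F (suc n) x) (shrink n))) (close n) ⟩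
      a ^ n * radius + a ^ n * radius                                 ∎)
      where
      shrink : ∀ n → a ^ suc n * radius ≤ a ^ n * radius
      shrink n = ≤-respˡ (sym (*-assoc a (a ^ n) radius)) (a*x≤x (*-nonNeg (0≤^ n 0≤a) 0≤radius))

    0≤aⁿradius : ∀ n → 0# ≤ a ^ n * radius
    0≤aⁿradius n = *-nonNeg (0≤^ n 0≤a) 0≤radius

    F-fixed : ∀ x → F x ≈ᵛ 𝒯 F x
    F-fixed x = F-inherits λ n → ≤-trans (𝒯-contracts {_} {_} (Φ-near-F n) x) (a*x≤x (0≤aⁿradius n))

    F-equal : ∀ {x w} → (∀ n → Φ (suc n) x ≈ᵛ w) → F x ≈ᵛ w
    F-equal same = F-inherits λ n → ≤-respˡ (sym (size-sub-self p (same n))) (0≤aⁿradius n)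

    F-admissible : Admissible V F
    F-admissible = record
      { respects = λ x y x≈y → F-inherits λ n → begin
          size p (Φ (suc n) x -ᵛ F y)
            ≈⟨ size-cong p (-ᵛ-cong {u = Φ (suc n) x} {Φ (suc n) y} {F y} {F y} (respects (Φ-admissible (suc n)) x y x≈y) ≈ᵛ-refl) ⟩
          size p (Φ (suc n) y -ᵛ F y)       ≤⟨ Φ-near-F (suc n) y ⟩
          a * a ^ n * radius                ≈⟨ *-assoc a (a ^ n) radius ⟩
          a * (a ^ n * radius)              ≤⟨ a*x≤x (0≤aⁿradius n) ⟩
          a ^ n * radius                    ∎
      ; at-zero  = λ x x≈0 → F-equal λ n → at-zero (Φ-admissible (suc n)) x x≈0
      ; at-one   = λ x x≈1 → F-equal λ n → at-one (Φ-admissible (suc n)) x x≈1 }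

    F-branch : ∀ {r x y} → Branch r x y → F x ≈ᵛ glue r (F y)
    F-branch {r} {x} {y} at-r = ≈ᵛ-trans (F-fixed x) (𝒯-branch F-admissible {r} {x} {y} at-r)

    F-uniformlyContinuous : UniformlyContinuous p F
    F-uniformlyContinuous ε 0<ε =
      let η = ε * ½ * ½
          N , small = aⁿradius-null η (0<x½ (0<x½ 0<ε))
          δ , 0<δ , close = Φ-uniformlyContinuous N (ε * ½) (0<x½ 0<ε)
          near : ∀ x → size p (Φ N x -ᵛ F x) ≤ η
          near x = ≤-trans (Φ-near-F N x) (small N ℕ.≤-refl)
      in δ , 0<δ , λ x y x≤y y-x≤δ → begin
        size p (F y -ᵛ F x)
          ≤⟨ size-sub-trans p (F y) (Φ N y) (F x) ⟩
        size p (F y -ᵛ Φ N y) + size p (Φ N y -ᵛ F x)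
          ≤⟨ +-mono-≤ ≤-refl (size-sub-trans p (Φ N y) (Φ N x) (F x)) ⟩
        size p (F y -ᵛ Φ N y) + (size p (Φ N y -ᵛ Φ N x) + size p (Φ N x -ᵛ F x))
          ≤⟨ +-mono-≤ (≤-trans (size-sub-sym p (F y) (Φ N y)) (near y)) (+-mono-≤ (close x y x≤y y-x≤δ) (near x)) ⟩
        η + (ε * ½ + η)
          ≈⟨ solve 2 (λ e h → h :+ (e :+ h) := (h :+ h) :+ e) refl (ε * ½) η ⟩
        (η + η) + ε * ½
          ≈⟨ +-congʳ (x½+x½≈x (ε * ½)) ⟩
        ε * ½ + ε * ½
          ≈⟨ x½+x½≈x ε ⟩
        ε                                                                                           ∎

    F-bounded : ∃ λ M → 0# ≤ M × (∀ x → size p (F x) ≤ M)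
    F-bounded = radius + size p V , 0≤-+ 0≤radius (0≤size p V) , λ x → begin
      size p (F x)                                   ≤⟨ size-≤-sub p (F x) (Φ₀ x) ⟩
      size p (F x -ᵛ Φ₀ x) + size p (Φ₀ x)
        ≤⟨ +-mono-≤ (≤-trans (size-sub-sym p (F x) (Φ₀ x)) (Φ-near-F 0 x)) (Φ₀-bound x) ⟩
      1# * radius + size p V                         ≈⟨ +-congʳ (*-identityˡ radius) ⟩
      radius + size p V                              ∎

    F-solves : SolvesDilation A μ V F
    F-solves = record
      { at-0     = at-zero F-admissible
      ; at-1     = at-one F-admissible
      ; dilation = λ r x y _ _ at-r → ≈ᵛ-trans (F-branch {r} {x} {y} at-r) λ i → ℂᵣ.trans
          (ℂᵣ.distribˡ (μ ⁻¹ᶜ) (prefix AV (toℕ r) i) ((A r · F y) i))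
          (ℂᵣ.+-congʳ (ℂᵣ.*-congˡ {μ ⁻¹ᶜ} (ℂᵣ.sym (prefix-inject AV r i)))) }

    F-continuous : (ν : Norm d) → Continuous ν F
    F-continuous ν x ε 0<ε = δ , 0<δ , λ y ∣y-x∣<δ → ≤-<-trans (close y (<⇒≤ ∣y-x∣<δ)) (x½<x 0<ε)
      where
      open Norm ν using (‖_‖)
      bound = dominated (fromNorm ν) p definite
      room = absorb (proj₁ (proj₂ bound)) (0<x½ 0<ε)
      uc = F-uniformlyContinuous (proj₁ room) (proj₁ (proj₂ room))
      δ = proj₁ uc
      0<δ = proj₁ (proj₂ uc)

      scale-back : ∀ {v} → size p v ≤ proj₁ room → ‖ v ‖ ≤ ε * ½
      scale-back {v} small = ≤-trans (proj₂ (proj₂ bound) v) (proj₂ (proj₂ room) small)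

      close : ∀ y → ∣ proj₁ y - proj₁ x ∣ ≤ δ → ‖ F y -ᵛ F x ‖ ≤ ε * ½
      close y near = by-cases (total (proj₁ x) (proj₁ y))
        where
        by-cases : proj₁ x ≤ proj₁ y ⊎ proj₁ y ≤ proj₁ x → ‖ F y -ᵛ F x ‖ ≤ ε * ½
        by-cases (inj₁ x≤y) = scale-back {F y -ᵛ F x} (proj₂ (proj₂ uc) x y x≤y (≤-trans (x≤∣x∣ _) near))
        by-cases (inj₂ y≤x) = scale-back {F y -ᵛ F x} (≤-trans (size-sub-sym p (F y) (F x)) (proj₂ (proj₂ uc) y x y≤x
          (≤-trans (≤-respˡ (solve 2 (λ x y → :- (y :- x) := x :- y) refl (proj₁ x) (proj₁ y)) (-x≤∣x∣ _)) near)))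

  -- Uniqueness of the continuous solution.

  module Uniqueness
    (b d : ℕ) (1≤b : 1 ℕ.≤ b) (A : Fin (suc b) → Matrix d) (V : ℂ^ d) (μ : ℂ) (ν : Norm d)
    (Φ Ψ : [0,1] → ℂ^ d) (Φ-continuous : Continuous ν Φ) (Ψ-continuous : Continuous ν Ψ)
    (Φ-solves : SolvesDilation A μ V Φ) (Ψ-solves : SolvesDilation A μ V Ψ)
    where
    open Digits b
    open Norm ν using (‖_‖; cong)
    private
      module Φ = SolvesDilation Φ-solves
      module Ψ = SolvesDilation Ψ-solves
      p = fromNorm ν

    β⁻¹<1 : β ⁻¹ < 1#
    β⁻¹<1 = ≯1⇒ (≤⊎> 1# (β ⁻¹))
      where
      ≯1⇒ : 1# ≤ β ⁻¹ ⊎ β ⁻¹ < 1# → β ⁻¹ < 1#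
      ≯1⇒ (inj₂ lt) = lt
      ≯1⇒ (inj₁ ge) = contradiction
        (begin
          β              ≈⟨ *-identityʳ β ⟨
          β * 1#         ≤⟨ *-monoˡ-≤ 0≤β ge ⟩
          β * β ⁻¹       ≈⟨ x*x⁻¹≈1 0<β ⟩
          1#             ∎)
        (<⇒≱ (<-by (0<ι 1≤b) (solve 1 (λ i → :1 :+ i :- :1 := i) refl (ι b))))

    -- The points z are the B-adic ones, where the equation determines its solutions.
    agree-nearby : ∀ n (x : [0,1]) → proj₁ x < 1# →
                   ∃ λ (z : [0,1]) → proj₁ z ≤ proj₁ x × proj₁ x - proj₁ z ≤ (β ⁻¹) ^ n × Φ z ≈ᵛ Ψ z
    agree-nearby zero    (t , 0≤t , t≤1) t<1 = 0̂ , 0≤t ,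
      ≤-respˡ (solve 1 (λ t → t := t :- :0) refl t) t≤1 ,
      ≈ᵛ-trans (Φ.at-0 0̂ refl) (≈ᵛ-sym (Ψ.at-0 0̂ refl))
    agree-nearby (suc n) x x<1 = step (agree-nearby n y y<1)
      where
      r = digit x
      y = scaled x
      i = ι (toℕ r)
      t = β * proj₁ x

      -- The equation speaks of half-open intervals, so the image must stay below 1. For the last
      -- digit this follows from 1 - y = B(1 - x).
      last-digit : proj₁ y < 1# ⊎ toℕ r ≡ b → proj₁ y < 1#
      last-digit (inj₁ y<1) = y<1
      last-digit (inj₂ r≡b) = <-by (0<-* 0<β (x<y⇒0<y-x x<1)) (begin-equality
        1# - proj₁ y                        ≈⟨ +-congˡ (-‿cong (located x)) ⟩
        1# - (t - i)                        ≡⟨ ≡.cong (λ k → 1# - (t - ι k)) r≡b ⟩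
        1# - (t - ι b)
          ≈⟨ solve 2 (λ i s → :1 :- ((:1 :+ i) :* s :- i) := (:1 :+ i) :* (:1 :- s)) refl (ι b) (proj₁ x) ⟩
        β * (1# - proj₁ x)                  ∎)

      y<1 : proj₁ y < 1#
      y<1 = last-digit (proj₂ (proj₂ (proj₂ (locate x))))

      step : (∃ λ (z : [0,1]) → proj₁ z ≤ proj₁ y × proj₁ y - proj₁ z ≤ (β ⁻¹) ^ n × Φ z ≈ᵛ Ψ z) →
             ∃ λ (z : [0,1]) → proj₁ z ≤ proj₁ x × proj₁ x - proj₁ z ≤ (β ⁻¹) ^ suc n × Φ z ≈ᵛ Ψ z
      step (z′@(s , 0≤s , s≤1) , z′≤y , y-z′≤ , same) = z , z≤x , x-z≤ , ≈ᵛ-trans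
        (Φ.dilation r z z′ lower upper z′≈) (≈ᵛ-trans
          (+ᵛ-cong (≈ᵛ-refl {v = μ ⁻¹ᶜ • sumᵛ (λ (s : Fin′ r) → A (inject s) · V)})
            (•-cong (μ ⁻¹ᶜ) (·-cong (A r) same)))
          (≈ᵛ-sym (Ψ.dilation r z z′ lower upper z′≈)))
        where
        -- The preimage of `s` under the branch of `x`; passing to it divides the distance by B.
        w = (i + s) * β ⁻¹
        βw≈ : β * w ≈ i + s
        βw≈ = β*xβ⁻¹≈x (i + s)
        β[x-w] : β * (proj₁ x - w) ≈ proj₁ y - s
        β[x-w] = begin-equality
          β * (proj₁ x - w)
            ≈⟨ solve 3 (λ b x w → b :* (x :- w) := b :* x :- b :* w) refl β (proj₁ x) w ⟩
          t - β * w                ≈⟨ +-congˡ (-‿cong βw≈) ⟩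
          t - (i + s)              ≈⟨ solve 3 (λ t i s → t :- (i :+ s) := (t :- i) :- s) refl t i s ⟩
          t - i - s                ≈⟨ +-congʳ (located x) ⟨
          proj₁ y - s              ∎
        z≤x : w ≤ proj₁ x
        z≤x = *-cancelˡ-≤ 0<β (≤-by (x≤y⇒0≤y-x z′≤y)
          (trans (solve 3 (λ b x w → b :* x :- b :* w := b :* (x :- w)) refl β (proj₁ x) w) β[x-w]))
        z : [0,1]
        z = w , *-nonNeg (0≤-+ (0≤ι (toℕ r)) 0≤s) 0≤β⁻¹ , ≤-trans z≤x (proj₂ (proj₂ x))
        x-z≤ : proj₁ x - w ≤ β ⁻¹ * (β ⁻¹) ^ n
        x-z≤ = *-cancelˡ-≤ 0<β (begin
          β * (proj₁ x - w)                ≈⟨ β[x-w] ⟩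
          proj₁ y - s                      ≤⟨ y-z′≤ ⟩
          (β ⁻¹) ^ n                       ≈⟨ β*xβ⁻¹≈x _ ⟨
          β * ((β ⁻¹) ^ n * β ⁻¹)          ≈⟨ *-congˡ (*-comm _ _) ⟩
          β * (β ⁻¹ * (β ⁻¹) ^ n)          ∎)
        lower : i * β ⁻¹ ≤ w
        lower = *-monoʳ-≤ 0≤β⁻¹ (≤-by 0≤s (solve 2 (λ i s → i :+ s :- i := s) refl i s))
        upper : w < (1# + i) * β ⁻¹
        upper = <-by (0<-* (x<y⇒0<y-x (≤-<-trans z′≤y y<1)) (0<x⁻¹ 0<β))
          (solve 3 (λ i s c → (:1 :+ i) :* c :- (i :+ s) :* c := (:1 :- s) :* c) refl i s (β ⁻¹))
        z′≈ : s ≈ β * w - i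
        z′≈ = sym (trans (+-congʳ βw≈) (solve 2 (λ i s → i :+ s :- i := s) refl i s))

    unique : ∀ x → Φ x ≈ᵛ Ψ x
    unique x = by-cases (≤⊎> 1# (proj₁ x))
      where
      nearby : ∀ δ → 0# < δ → proj₁ x < 1# →
               ∃ λ (z : [0,1]) → ∣ proj₁ z - proj₁ x ∣ ≤ δ × Φ z ≈ᵛ Ψ z
      nearby δ 0<δ x<1 =
        let n , small = ^-null 0≤β⁻¹ β⁻¹<1 δ 0<δ
            z , z≤x , x-z≤ , same = agree-nearby n x x<1
        in z , ∣x∣≤
             (≤-by (0≤-+ (x≤y⇒0≤y-x z≤x) (<⇒≤ 0<δ)) (solve 3 (λ d x z → d :- (z :- x) := (x :- z) :+ d) refl δ (proj₁ x) (proj₁ z)))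
             (≤-respˡ (solve 2 (λ x z → x :- z := :- (z :- x)) refl (proj₁ x) (proj₁ z)) (≤-trans x-z≤ (small n ℕ.≤-refl))) ,
           same

      by-cases : 1# ≤ proj₁ x ⊎ proj₁ x < 1# → Φ x ≈ᵛ Ψ x
      -- At 1 the value is prescribed; the approximation by B-adic points from the left serves the
      -- points below 1.
      by-cases (inj₁ 1≤x) = ≈ᵛ-trans (Φ.at-1 x x≈1) (≈ᵛ-sym (Ψ.at-1 x x≈1))
        where x≈1 = antisym (proj₂ (proj₂ x)) 1≤x
      by-cases (inj₂ x<1) = definite-sub p (fromNorm-definite ν) (≤-from-ε λ ε 0<ε →
        let δ₁ , 0<δ₁ , close₁ = Φ-continuous x (ε * ½) (0<x½ 0<ε)
            δ₂ , 0<δ₂ , close₂ = Ψ-continuous x (ε * ½) (0<x½ 0<ε)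
            δ , 0<δ , δ≤δ₁ , δ≤δ₂ = below 0<δ₁ 0<δ₂
            z , z-x≤ , same = nearby (δ * ½) (0<x½ 0<δ) x<1
            z-x<δ = ≤-<-trans z-x≤ (x½<x 0<δ)
        in begin
          ‖ Φ x -ᵛ Ψ x ‖                          ≤⟨ size-sub-trans p (Φ x) (Φ z) (Ψ x) ⟩
          ‖ Φ x -ᵛ Φ z ‖ + ‖ Φ z -ᵛ Ψ x ‖
            ≤⟨ +-mono-≤ (size-sub-sym p (Φ x) (Φ z)) (≤-reflexive (cong (-ᵛ-cong {u = Φ z} {Ψ z} {Ψ x} {Ψ x} same ≈ᵛ-refl))) ⟩
          ‖ Φ z -ᵛ Φ x ‖ + ‖ Ψ z -ᵛ Ψ x ‖
            ≤⟨ +-mono-≤ (<⇒≤ (close₁ z (<-≤-trans z-x<δ δ≤δ₁))) (<⇒≤ (close₂ z (<-≤-trans z-x<δ δ≤δ₂))) ⟩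
          ε * ½ + ε * ½                           ≈⟨ x½+x½≈x ε ⟩
          ε                                       ≈⟨ +-identityˡ ε ⟨
          0# + ε                                  ∎)

-- The running sums and their recursion on the first letter.

module RunningSums (em : ExcludedMiddle 0ℓ) (𝐑 : CompleteOrderedField) where
  open Analysis em 𝐑
  open RealAnalysis em 𝐑
  open ComplexNumbers em 𝐑
  open NormedSpaces em 𝐑
  open AdaptedNorms em 𝐑
  open Dilation em 𝐑
  open Vec using ([]; _∷_; lookup)

  if-true : ∀ {P : Set} {d} {v w : ℂ^ d} → P → (if does (em {P}) then v else w) ≈ᵛ v
  if-true {P} p with em {P}
  ... | yes _ = ≈ᵛ-refl
  ... | no ¬p = contradiction p ¬p

  if-false : ∀ {P : Set} {d} {v w : ℂ^ d} → ¬ P → (if does (em {P}) then v else w) ≈ᵛ w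
  if-false {P} ¬p with em {P}
  ... | yes p = contradiction p ¬p
  ... | no _  = ≈ᵛ-refl

  sumᵛ-cong : ∀ {n d} {f g : Fin n → ℂ^ d} → (∀ r → f r ≈ᵛ g r) → sumᵛ f ≈ᵛ sumᵛ g
  sumᵛ-cong {zero}  f≈g = ≈ᵛ-refl
  sumᵛ-cong {suc n} f≈g = +ᵛ-cong (f≈g zero) (sumᵛ-cong (f≈g ∘ suc))

  ·-sumᵛ : ∀ {n d} (M : Matrix d) (f : Fin n → ℂ^ d) → M · sumᵛ f ≈ᵛ sumᵛ λ r → M · f r
  ·-sumᵛ {zero}  M f = ·-0ᵛ M
  ·-sumᵛ {suc n} M f = ≈ᵛ-trans (·-+ᵛ M (f zero) (sumᵛ (f ∘ suc)))
    (+ᵛ-cong (≈ᵛ-refl {v = M · f zero}) (·-sumᵛ M (f ∘ suc)))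

  sumᵛ-zero : ∀ {n d} {f : Fin n → ℂ^ d} → (∀ r → f r ≈ᵛ 0ᵛ) → sumᵛ f ≈ᵛ 0ᵛ
  sumᵛ-zero {zero}  f≈0 = ≈ᵛ-refl
  sumᵛ-zero {suc n} f≈0 = ≈ᵛ-trans (+ᵛ-cong (f≈0 zero) (sumᵛ-zero (f≈0 ∘ suc))) λ i → ℂᵣ.+-identityˡ 0ᶜ

  -- The shape of a sum over first letters: below the digit of `x` all words count, at the digit the
  -- condition passes to the remaining letters, above it no word counts.
  sumᵛ-split : ∀ {n d} (h f : Fin n → ℂ^ d) {g} r →
               (∀ s → toℕ s ℕ.< toℕ r → h s ≈ᵛ f s) → h r ≈ᵛ g → (∀ s → toℕ r ℕ.< toℕ s → h s ≈ᵛ 0ᵛ) →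
               sumᵛ h ≈ᵛ prefix f (toℕ r) +ᵛ g
  sumᵛ-split h f {g} zero    below-r at-r above-r i = ℂᵣ.trans
    (ℂᵣ.+-cong (at-r i) (sumᵛ-zero (λ s → above-r (suc s) (ℕ.s≤s ℕ.z≤n)) i)) (ℂᵣ.+-comm (g i) 0ᶜ)
  sumᵛ-split h f {g} (suc r) below-r at-r above-r i = ℂᵣ.trans
    (ℂᵣ.+-cong (below-r zero (ℕ.s≤s ℕ.z≤n) i)
      (sumᵛ-split (h ∘ suc) (f ∘ suc) {g} r (λ s s<r → below-r (suc s) (ℕ.s≤s s<r)) at-r (λ s r<s → above-r (suc s) (ℕ.s≤s r<s)) i))
    (ℂᵣ.sym (ℂᵣ.+-assoc (f zero i) (prefix (f ∘ suc) (toℕ r) i) (g i)))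

  sumWords-cong : ∀ {B d} K {f g : Word B K → ℂ^ d} → (∀ w → f w ≈ᵛ g w) → sumWords K f ≈ᵛ sumWords K g
  sumWords-cong zero    f≈g = f≈g []
  sumWords-cong (suc K) f≈g = sumᵛ-cong λ r → sumWords-cong K λ w → f≈g (r ∷ w)

  sumWords-zero : ∀ {B d} K {f : Word B K → ℂ^ d} → (∀ w → f w ≈ᵛ 0ᵛ) → sumWords K f ≈ᵛ 0ᵛ
  sumWords-zero zero    f≈0 = f≈0 []
  sumWords-zero (suc K) f≈0 = sumᵛ-zero λ r → sumWords-zero K λ w → f≈0 (r ∷ w)

  ·-sumWords : ∀ {B d} K (M : Matrix d) (f : Word B K → ℂ^ d) →
               M · sumWords K f ≈ᵛ sumWords K λ w → M · f w
  ·-sumWords zero    M f = ≈ᵛ-refl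
  ·-sumWords (suc K) M f = ≈ᵛ-trans (·-sumᵛ M (λ r → sumWords K λ w → f (r ∷ w)))
    (sumᵛ-cong λ r → ·-sumWords K M λ w → f (r ∷ w))

  -- As matrices the prefix sums act linearly on the varying vector Q^K C, so finitely many operator
  -- bounds serve for all K.
  prefixᴹ : ∀ {n d} → (Fin n → Matrix d) → ℕ → Matrix d
  prefixᴹ {zero}  A k       = λ _ _ → 0ᶜ
  prefixᴹ {suc n} A zero    = λ _ _ → 0ᶜ
  prefixᴹ {suc n} A (suc k) = λ i j → A zero i j +ᶜ prefixᴹ (A ∘ suc) k i j

  prefixᴹ-· : ∀ {n d} (A : Fin n → Matrix d) k v → prefix (λ s → A s · v) k ≈ᵛ prefixᴹ A k · v
  prefixᴹ-· {zero}  A k       v i = ℂᵣ.sym (sum-zero λ j → ℂᵣ.zeroˡ (v j))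
  prefixᴹ-· {suc n} A zero    v i = ℂᵣ.sym (sum-zero λ j → ℂᵣ.zeroˡ (v j))
  prefixᴹ-· {suc n} A (suc k) v i = ℂᵣ.trans (ℂᵣ.+-congˡ {(A zero · v) i} (prefixᴹ-· (A ∘ suc) k v i))
    (ℂᵣ.sym (ℂᵣ.trans (ℂΣ.sum-cong-≋ λ j → ℂᵣ.distribʳ (v j) (A zero i j) (prefixᴹ (A ∘ suc) k i j))
      (ℂΣ.∑-distrib-+ (λ j → A zero i j *ᶜ v j) (λ j → prefixᴹ (A ∘ suc) k i j *ᶜ v j))))

  module Recursion (b d : ℕ) (rep : LinearRepresentation (suc b) d) where
    open LinearRepresentation rep
    open Digits b

    radix-∷ : ∀ {K} r (w : Word (suc b) K) → radix (r ∷ w) ≈ (ι (toℕ r) + radix w) * β ⁻¹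
    radix-∷ {K} r w = begin-equality
      ι (toℕ r) * (β ⁻¹ * 1#) + sum (λ i → x i * (β ⁻¹ * (β ⁻¹) ^ suc (toℕ i)))
        ≈⟨ +-cong (*-congˡ (*-identityʳ (β ⁻¹)))
            (sum-cong-≋ λ i → solve 3 (λ x b y → x :* (b :* y) := (x :* y) :* b) refl (x i) (β ⁻¹) ((β ⁻¹) ^ suc (toℕ i))) ⟩
      ι (toℕ r) * β ⁻¹ + sum (λ i → x i * (β ⁻¹) ^ suc (toℕ i) * β ⁻¹)
        ≈⟨ +-congˡ (*-distribʳ-sum (β ⁻¹) λ i → x i * (β ⁻¹) ^ suc (toℕ i)) ⟨
      ι (toℕ r) * β ⁻¹ + radix w * β ⁻¹
        ≈⟨ solve 3 (λ x y b → x :* b :+ y :* b := (x :+ y) :* b) refl (ι (toℕ r)) (radix w) (β ⁻¹) ⟩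
      (ι (toℕ r) + radix w) * β ⁻¹                                                 ∎
      where
      x : Fin K → ℝ
      x i = ι (toℕ (lookup w i))

    β*radix-∷ : ∀ {K} r (w : Word (suc b) K) → β * radix (r ∷ w) ≈ ι (toℕ r) + radix w
    β*radix-∷ r w = trans (*-congˡ (radix-∷ r w)) (β*xβ⁻¹≈x _)

    0≤radix : ∀ {K} (w : Word (suc b) K) → 0# ≤ radix w
    0≤radix []      = ≤-refl
    0≤radix (r ∷ w) = ≤-respʳ (sym (radix-∷ r w)) (*-nonNeg (0≤-+ (0≤ι (toℕ r)) (0≤radix w)) 0≤β⁻¹)

    radix≤1 : ∀ {K} (w : Word (suc b) K) → radix w ≤ 1#
    radix≤1 []      = 0≤1
    radix≤1 (r ∷ w) = *-cancelˡ-≤ 0<β (begin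
      β * radix (r ∷ w)        ≈⟨ β*radix-∷ r w ⟩
      ι (toℕ r) + radix w      ≤⟨ +-mono-≤ (ι≤b r) (radix≤1 w) ⟩
      ι b + 1#                 ≈⟨ solve 1 (λ i → i :+ :1 := (:1 :+ i) :* :1) refl (ι b) ⟩
      β * 1#                   ∎)

    total-sum : ℕ → ℂ^ d
    total-sum K = (Q ^ᴹ K) · C

    sumWords-total : ∀ K → sumWords K (λ w → matrixOf A w · C) ≈ᵛ total-sum K
    A·sumWords : ∀ K r → sumWords K (λ w → matrixOf A (r ∷ w) · C) ≈ᵛ A r · total-sum K

    sumWords-total zero    = ≈ᵛ-refl
    sumWords-total (suc K) = ≈ᵛ-trans (sumᵛ-cong (A·sumWords K))
      (≈ᵛ-trans (≈ᵛ-sym (sumᴹ-· A (total-sum K))) (≈ᵛ-sym (*-· Q (Q ^ᴹ K) C)))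

    A·sumWords K r = ≈ᵛ-trans (sumWords-cong K λ w → matrixOf-∷ A r w C)
      (≈ᵛ-trans (≈ᵛ-sym (·-sumWords K (A r) λ w → matrixOf A w · C)) (·-cong (A r) (sumWords-total K)))

    -- Multiplied by B, the condition on s ∷ w reads s + (0.w)_B ≤ r + y with (0.w)_B in [0,1]. It
    -- always holds for s < r, becomes the condition on `w` at `y` for s = r, and fails for s > r.
    runningSum-step : ∀ K x → runningSum rep (suc K) x ≈ᵛ
                      prefix (λ s → A s · total-sum K) (toℕ (digit x)) +ᵛ A (digit x) · runningSum rep K (scaled x)
    runningSum-step K x = sumᵛ-split h (λ s → A s · total-sum K) {A r · runningSum rep K y} r below-r at-r above-r
      where
      r = digit x
      y = scaled x

      term : ∀ s (w : Word (suc b) K) → ℂ^ d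
      term s w = if does (em {radix (s ∷ w) ≤ proj₁ x}) then matrixOf A (s ∷ w) · C else 0ᵛ

      h : Fin (suc b) → ℂ^ d
      h s = sumWords K (term s)

      βx≈ : β * proj₁ x ≈ ι (toℕ r) + proj₁ y
      βx≈ = trans (solve 2 (λ t i → t := i :+ (t :- i)) refl _ (ι (toℕ r))) (+-congˡ (sym (located x)))

      ≤⇒radix≤ : ∀ s (w : Word (suc b) K) → ι (toℕ s) + radix w ≤ ι (toℕ r) + proj₁ y → radix (s ∷ w) ≤ proj₁ x
      ≤⇒radix≤ s w le = *-cancelˡ-≤ 0<β (≤-respˡ (sym (β*radix-∷ s w)) (≤-respʳ (sym βx≈) le))

      radix≤⇒≤ : ∀ s (w : Word (suc b) K) → radix (s ∷ w) ≤ proj₁ x → ι (toℕ s) + radix w ≤ ι (toℕ r) + proj₁ y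
      radix≤⇒≤ s w le = ≤-respˡ (β*radix-∷ s w) (≤-respʳ βx≈ (*-monoˡ-≤ 0≤β le))

      below-r : ∀ s → toℕ s ℕ.< toℕ r → h s ≈ᵛ A s · total-sum K
      below-r s s<r = ≈ᵛ-trans (sumWords-cong K λ w → if-true (≤⇒radix≤ s w (begin
          ι (toℕ s) + radix w        ≤⟨ +-mono-≤ ≤-refl (radix≤1 w) ⟩
          ι (toℕ s) + 1#             ≈⟨ +-comm _ _ ⟩
          ι (suc (toℕ s))            ≤⟨ ι-mono s<r ⟩
          ι (toℕ r)
            ≤⟨ ≤-by (proj₁ (proj₂ y)) (solve 2 (λ i y → i :+ y :- i := y) refl (ι (toℕ r)) (proj₁ y)) ⟩
          ι (toℕ r) + proj₁ y        ∎)))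
        (A·sumWords K s)

      prepend : ∀ w → term r w ≈ᵛ A r · (if does (em {radix w ≤ proj₁ y}) then matrixOf A w · C else 0ᵛ)
      prepend w with em {radix w ≤ proj₁ y}
      ... | yes le = ≈ᵛ-trans (if-true (≤⇒radix≤ r w (+-mono-≤ ≤-refl le))) (matrixOf-∷ A r w C)
      ... | no ≰   = ≈ᵛ-trans
        (if-false λ le → ≰ (≤-by (x≤y⇒0≤y-x (radix≤⇒≤ r w le)) (solve 3 (λ i w y → y :- w := (i :+ y) :- (i :+ w)) refl (ι (toℕ r)) (radix w) (proj₁ y))))
        (≈ᵛ-sym (·-0ᵛ (A r)))

      at-r : h r ≈ᵛ A r · runningSum rep K y
      at-r = ≈ᵛ-trans (sumWords-cong K prepend)
        (≈ᵛ-sym (·-sumWords K (A r) λ w → if does (em {radix w ≤ proj₁ y}) then matrixOf A w · C else 0ᵛ))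

      above-r : ∀ s → toℕ r ℕ.< toℕ s → h s ≈ᵛ 0ᵛ
      above-r s r<s = sumWords-zero K λ w → if-false λ le → <⇒≱ (1+r>r+y (proj₂ (proj₂ (proj₂ (locate x))))) (begin
        ι (suc (toℕ r))              ≤⟨ ι-mono r<s ⟩
        ι (toℕ s)
          ≤⟨ ≤-by (0≤radix w) (solve 2 (λ i y → i :+ y :- i := y) refl (ι (toℕ s)) (radix w)) ⟩
        ι (toℕ s) + radix w          ≤⟨ radix≤⇒≤ s w le ⟩
        ι (toℕ r) + proj₁ y          ∎)
        where
        -- If y = 1 is possible, the digit is the last one and no letter `s` exceeds it.
        1+r>r+y : proj₁ y < 1# ⊎ toℕ r ≡ b → ι (toℕ r) + proj₁ y < ι (suc (toℕ r))
        1+r>r+y (inj₁ y<1) = <-by (x<y⇒0<y-x y<1) (solve 2 (λ i y → (:1 :+ i) :- (i :+ y) := :1 :- y) refl (ι (toℕ r)) (proj₁ y))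
        1+r>r+y (inj₂ r≡b) = contradiction (ℕ.≤-trans (ℕ.≤-reflexive (≡.cong suc (≡.sym r≡b))) r<s)
                               (ℕ.<⇒≱ (Fin.toℕ<n s))

    prefix-bounded : ∀ (p : Seminorm d) (f : Fin (suc b) → ℂ^ d) → ∃ λ M → 0# ≤ M × (∀ (r : Fin (suc b)) → size p (prefix f (toℕ r)) ≤ M)
    prefix-bounded p f = maximum sizes , 0≤maximum sizes , ≤-maximum sizes
      where
      sizes : Fin (suc b) → ℝ
      sizes r = size p (prefix f (toℕ r))

    -- Makes the supremum of the distances to the limit a genuine one. The bound may depend on `K`,
    -- so a crude recursion is enough.
    runningSum-bounded : ∀ (p : Seminorm d) {q} → 0# ≤ q → (∀ r v → size p (A r · v) ≤ q * size p v) →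
                         ∀ K → ∃ λ M → ∀ x → size p (runningSum rep K x) ≤ M
    runningSum-bounded p 0≤q contracts zero    = size p (matrixOf A [] · C) , λ x →
      ≤-reflexive (size-cong p (if-true (proj₁ (proj₂ x))))
    runningSum-bounded p {q} 0≤q contracts (suc K) =
      M + q * M′ , λ x → begin
        size p (runningSum rep (suc K) x)                         ≈⟨ size-cong p (runningSum-step K x) ⟩
        size p (prefix f (toℕ (digit x)) +ᵛ A (digit x) · runningSum rep K (scaled x))
                                                                  ≤⟨ subadditive p _ _ ⟩
        size p (prefix f (toℕ (digit x))) + size p (A (digit x) · runningSum rep K (scaled x))
            ≤⟨ +-mono-≤ (proj₂ (proj₂ (prefix-bounded p f)) (digit x)) (contracts (digit x) _) ⟩
        M + q * size p (runningSum rep K (scaled x))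
          ≤⟨ +-mono-≤ ≤-refl (*-monoˡ-≤ 0≤q (proj₂ (runningSum-bounded p 0≤q contracts K) (scaled x))) ⟩
        M + q * M′                                                ∎
      where
      f : Fin (suc b) → ℂ^ d
      f s = A s · total-sum K
      M = proj₁ (prefix-bounded p f)
      M′ = proj₁ (runningSum-bounded p 0≤q contracts K)

-- Limits extracted from (ADT), and uniform convergence.

module Asymptotics (em : ExcludedMiddle 0ℓ) (𝐑 : CompleteOrderedField) where
  open Analysis em 𝐑
  open RealAnalysis em 𝐑
  open ComplexNumbers em 𝐑
  open NormedSpaces em 𝐑
  open AdaptedNorms em 𝐑
  open Dilation em 𝐑
  open RunningSums em 𝐑
  open ℂₛ using () renaming
    (solve to solveᶜ; _:=_ to _⊜_; _:+_ to _⊕_; _:*_ to _⊗_; _:-_ to _⊖_; :-_ to ⊝_; :1 to :1ᶜ)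

  O[1/K]⇒Null : ∀ {f} → f =O (λ K → ι K ⁻¹) → Null f
  O[1/K]⇒Null {f} (M , bound) = Null-≤
    (Eventually-zip (λ K f≤ 0<ιK → ≤-trans f≤ (*-monoʳ-≤ (<⇒≤ (0<x⁻¹ 0<ιK)) (x≤∣x∣ M))) bound (1 , λ K → 0<ι))
    (Null-* ∣ M ∣ (0≤∣x∣ M) ι⁻¹-null)

  Null-≤-scaled : ∀ {u v} k → 0# ≤ k → Null u → Eventually (λ K → v K ≤ k * u K) → Null v
  Null-≤-scaled k 0≤k u→0 v≤ = Null-≤ v≤ (Null-* k 0≤k u→0)

  module Rate
    (μ : ℂ) (μ≉0 : μ ≉ᶜ 0ᶜ) (R : ℕ → ℂ) (R≉0 : Eventually λ K → R K ≉ᶜ 0ᶜ)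
    (η : ℕ → ℂ) (η-null : Null λ K → ∣ η K ∣ᶜ)
    (ratio : Eventually λ K → R (suc K) *ᶜ R K ⁻¹ᶜ ≈ᶜ μ *ᶜ (1ᶜ +ᶜ η K))
    where

    inverse-ratio : ℕ → ℂ
    inverse-ratio K = R K *ᶜ R (suc K) ⁻¹ᶜ

    -- The hypothesis on R(K+1)/R(K) inverted without dividing by 1 + η(K); both the size and the
    -- limit of the inverse ratio are read off from this product.
    inverse-ratio-η : Eventually λ K → inverse-ratio K *ᶜ (1ᶜ +ᶜ η K) ≈ᶜ μ ⁻¹ᶜ
    inverse-ratio-η = Eventually-zip solve-for (Eventually-zip (λ K p q → p , q) R≉0 (Eventually-suc R≉0)) ratio
      where
      solve-for : ∀ K → R K ≉ᶜ 0ᶜ × R (suc K) ≉ᶜ 0ᶜ → R (suc K) *ᶜ R K ⁻¹ᶜ ≈ᶜ μ *ᶜ (1ᶜ +ᶜ η K) →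
                  inverse-ratio K *ᶜ (1ᶜ +ᶜ η K) ≈ᶜ μ ⁻¹ᶜ
      -- The factor μ μ⁻¹ is inserted to make the ratio hypothesis applicable; afterwards R(K) and
      -- R(K+1) cancel against their inverses.
      solve-for K (r≉0 , s≉0) eq = ℂᵣ.trans (insert (⁻¹ᶜ-inverseʳ {μ} μ≉0)) (ℂᵣ.trans
          (solveᶜ 5 (λ r s′ m e m′ → m ⊗ m′ ⊗ (r ⊗ s′ ⊗ e) ⊜ r ⊗ s′ ⊗ (m ⊗ e) ⊗ m′) ℂᵣ.refl r s′ μ (1ᶜ +ᶜ η K) (μ ⁻¹ᶜ))
        (ℂᵣ.trans (ℂᵣ.*-congʳ {μ ⁻¹ᶜ} (ℂᵣ.*-congˡ {r *ᶜ s′} (ℂᵣ.sym eq)))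
        (ℂᵣ.trans (solveᶜ 5 (λ r s′ s r′ m′ → r ⊗ s′ ⊗ (s ⊗ r′) ⊗ m′ ⊜ (r ⊗ r′) ⊗ ((s ⊗ s′) ⊗ m′)) ℂᵣ.refl r s′ s r′ (μ ⁻¹ᶜ))
        (ℂᵣ.trans (ℂᵣ.sym (insert (⁻¹ᶜ-inverseʳ {r} r≉0))) (ℂᵣ.sym (insert (⁻¹ᶜ-inverseʳ {s} s≉0)))))))
        where
        r = R K
        s = R (suc K)
        r′ = r ⁻¹ᶜ
        s′ = s ⁻¹ᶜ
        insert : ∀ {z w} → z ≈ᶜ 1ᶜ → w ≈ᶜ z *ᶜ w
        insert {z} {w} z≈1 = ℂᵣ.sym (ℂᵣ.trans (ℂᵣ.*-congʳ {w} z≈1) (ℂᵣ.*-identityˡ w))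

    -- Eventually |1 + η(K)| ≥ 1 - |η(K)| ≥ m. The choice m = 1/2 yields boundedness, while an `m`
    -- close to 1 keeps the contraction factor below 1.
    ∣inverse-ratio∣-bound : ∀ m → m < 1# → Eventually λ K → ∣ inverse-ratio K ∣ᶜ * m ≤ ∣ μ ⁻¹ᶜ ∣ᶜ
    ∣inverse-ratio∣-bound m m<1 = Eventually-zip bound inverse-ratio-η (η-null (1# - m) (x<y⇒0<y-x m<1))
      where
      bound : ∀ K → inverse-ratio K *ᶜ (1ᶜ +ᶜ η K) ≈ᶜ μ ⁻¹ᶜ → ∣ η K ∣ᶜ ≤ 1# - m → ∣ inverse-ratio K ∣ᶜ * m ≤ ∣ μ ⁻¹ᶜ ∣ᶜ
      bound K eq small = begin
        ∣ inverse-ratio K ∣ᶜ * m                       ≤⟨ *-monoˡ-≤ (0≤∣∣ᶜ (inverse-ratio K)) m≤ ⟩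
        ∣ inverse-ratio K ∣ᶜ * ∣ 1ᶜ +ᶜ η K ∣ᶜ          ≈⟨ ∣zw∣≈∣z∣∣w∣ (inverse-ratio K) (1ᶜ +ᶜ η K) ⟨
        ∣ inverse-ratio K *ᶜ (1ᶜ +ᶜ η K) ∣ᶜ
          ≈⟨ ∣∣ᶜ-cong {inverse-ratio K *ᶜ (1ᶜ +ᶜ η K)} {μ ⁻¹ᶜ} eq ⟩
        ∣ μ ⁻¹ᶜ ∣ᶜ                                     ∎
        where
        x = re (η K)
        -- The lower bound is read off from the real part, which avoids a triangle inequality for
        -- the modulus.
        m≤ : m ≤ ∣ 1ᶜ +ᶜ η K ∣ᶜ
        m≤ = begin
          m                       ≈⟨ solve 1 (λ m → m := :1 :- (:1 :- m)) refl m ⟩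
          1# - (1# - m)           ≤⟨ ≤-by (x≤y⇒0≤y-x (≤-trans (-x≤∣x∣ x) (≤-trans (∣re∣≤∣∣ᶜ (η K)) small)))
                                       (solve 2 (λ x m → (:1 :+ x) :- (:1 :- m) := m :- (:- x)) refl x (1# - m)) ⟩
          1# + x                  ≤⟨ x≤∣x∣ _ ⟩
          ∣ 1# + x ∣              ≤⟨ ∣re∣≤∣∣ᶜ (1ᶜ +ᶜ η K) ⟩
          ∣ 1ᶜ +ᶜ η K ∣ᶜ          ∎

    inverse-ratio-bounded : Eventually λ K → ∣ inverse-ratio K ∣ᶜ ≤ ∣ μ ⁻¹ᶜ ∣ᶜ * (1# + 1#)
    inverse-ratio-bounded = Eventually-map double (∣inverse-ratio∣-bound ½ ½<1)
      where
      ½<1 : ½ < 1#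
      ½<1 = ≤-<-trans (≤-reflexive (sym (*-identityˡ ½))) (x½<x 0<1)
      double : ∀ K → ∣ inverse-ratio K ∣ᶜ * ½ ≤ ∣ μ ⁻¹ᶜ ∣ᶜ → ∣ inverse-ratio K ∣ᶜ ≤ ∣ μ ⁻¹ᶜ ∣ᶜ * (1# + 1#)
      double K le = begin
        ∣ inverse-ratio K ∣ᶜ                          ≈⟨ x½+x½≈x _ ⟨
        ∣ inverse-ratio K ∣ᶜ * ½ + ∣ inverse-ratio K ∣ᶜ * ½   ≤⟨ +-mono-≤ le le ⟩
        ∣ μ ⁻¹ᶜ ∣ᶜ + ∣ μ ⁻¹ᶜ ∣ᶜ                       ≈⟨ solve 1 (λ x → x :+ x := x :* (:1 :+ :1)) refl _ ⟩
        ∣ μ ⁻¹ᶜ ∣ᶜ * (1# + 1#)                        ∎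

    0≤2∣μ⁻¹∣ : 0# ≤ ∣ μ ⁻¹ᶜ ∣ᶜ * (1# + 1#)
    0≤2∣μ⁻¹∣ = *-nonNeg (0≤∣∣ᶜ (μ ⁻¹ᶜ)) (<⇒≤ 0<2)

    -- Writing b for the inverse ratio, b(1 + η) = μ⁻¹ gives b - μ⁻¹ = -bη, and b is bounded.
    inverse-ratio-limit : Null λ K → ∣ inverse-ratio K +ᶜ -ᶜ (μ ⁻¹ᶜ) ∣ᶜ
    inverse-ratio-limit = Null-≤-scaled (∣ μ ⁻¹ᶜ ∣ᶜ * (1# + 1#)) 0≤2∣μ⁻¹∣ η-null
      (Eventually-zip bound inverse-ratio-η inverse-ratio-bounded)
      where
      bound : ∀ K → inverse-ratio K *ᶜ (1ᶜ +ᶜ η K) ≈ᶜ μ ⁻¹ᶜ → ∣ inverse-ratio K ∣ᶜ ≤ ∣ μ ⁻¹ᶜ ∣ᶜ * (1# + 1#) →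
              ∣ inverse-ratio K +ᶜ -ᶜ (μ ⁻¹ᶜ) ∣ᶜ ≤ ∣ μ ⁻¹ᶜ ∣ᶜ * (1# + 1#) * ∣ η K ∣ᶜ
      bound K eq b≤ = begin
        ∣ b +ᶜ -ᶜ (μ ⁻¹ᶜ) ∣ᶜ                      ≈⟨ ∣∣ᶜ-cong {b +ᶜ -ᶜ (μ ⁻¹ᶜ)} { -ᶜ (b *ᶜ η K)} (ℂᵣ.trans
                                                     (ℂᵣ.+-congˡ {b} (ℂᵣ.-‿cong (ℂᵣ.sym eq)))
            (solveᶜ 2 (λ b e → b ⊖ b ⊗ (:1ᶜ ⊕ e) ⊜ ⊝ (b ⊗ e)) ℂᵣ.refl b (η K))) ⟩
        ∣ -ᶜ (b *ᶜ η K) ∣ᶜ                        ≈⟨ trans (∣-z∣≈∣z∣ (b *ᶜ η K)) (∣zw∣≈∣z∣∣w∣ b (η K)) ⟩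
        ∣ b ∣ᶜ * ∣ η K ∣ᶜ                         ≤⟨ *-monoʳ-≤ (0≤∣∣ᶜ (η K)) b≤ ⟩
        ∣ μ ⁻¹ᶜ ∣ᶜ * (1# + 1#) * ∣ η K ∣ᶜ         ∎
        where b = inverse-ratio K

    module Limit
      (b d : ℕ) (rep : LinearRepresentation (suc b) d) (ν : Norm d) (V : ℂ^ d)
      (total-limit : Null λ K → Norm.‖_‖ ν
         ((R K ⁻¹ᶜ • (LinearRepresentation.Q rep ^ᴹ K) · LinearRepresentation.C rep) -ᵛ V))
      where
      open LinearRepresentation rep
      open Norm ν using (‖_‖)
      open Digits b
      open Recursion b d rep
      p₀ = fromNorm ν

      v : ℕ → ℂ^ d
      v K = R K ⁻¹ᶜ • total-sum K

      renormalise : ∀ {K} → R K ≉ᶜ 0ᶜ → ∀ (M : Matrix d) u → R (suc K) ⁻¹ᶜ • M · u ≈ᵛ inverse-ratio K • M · (R K ⁻¹ᶜ • u)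
      renormalise {K} r≉0 M u i = ℂᵣ.trans
        (ℂᵣ.sym (ℂᵣ.trans (ℂᵣ.*-congʳ {s′ *ᶜ (M · u) i} (⁻¹ᶜ-inverseʳ {R K} r≉0)) (ℂᵣ.*-identityˡ (s′ *ᶜ (M · u) i))))
        (ℂᵣ.trans (solveᶜ 4 (λ r r′ s′ x → r ⊗ r′ ⊗ (s′ ⊗ x) ⊜ r ⊗ s′ ⊗ (r′ ⊗ x)) ℂᵣ.refl (R K) (R K ⁻¹ᶜ) s′ ((M · u) i))
          (ℂᵣ.*-congˡ {inverse-ratio K} (ℂᵣ.sym (·-• M (R K ⁻¹ᶜ) u i))))
        where s′ = R (suc K) ⁻¹ᶜ

      -- In v(K+1) = (R(K)/R(K+1)) Q v(K) the left-hand side tends to `V` and the right-hand side to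
      -- μ⁻¹QV.
      Q·V≈μV : Q · V ≈ᵛ μ • V
      Q·V≈μV i = ℂᵣ.sym (ℂᵣ.trans
        (ℂᵣ.*-congˡ {μ} (V≈ i))
        (ℂᵣ.trans (ℂᵣ.sym (ℂᵣ.*-assoc μ (μ ⁻¹ᶜ) ((Q · V) i)))
          (ℂᵣ.trans (ℂᵣ.*-congʳ {(Q · V) i} (⁻¹ᶜ-inverseʳ {μ} μ≉0)) (ℂᵣ.*-identityˡ ((Q · V) i)))))
        where
        kQ = dominated (pullback Q p₀) p₀ (fromNorm-definite ν)
        k = proj₁ kQ
        c = ∣ μ ⁻¹ᶜ ∣ᶜ * (1# + 1#)

        gap : Null λ K → ‖ v (suc K) -ᵛ μ ⁻¹ᶜ • Q · V ‖
        gap = Null-≤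
          (Eventually-zip bound R≉0 inverse-ratio-bounded)
          (Null-+ (Null-* (c * k) (*-nonNeg 0≤2∣μ⁻¹∣ (proj₁ (proj₂ kQ))) total-limit)
                  (Null-* ‖ Q · V ‖ (0≤size p₀ (Q · V)) inverse-ratio-limit))
          where
          bound : ∀ K → R K ≉ᶜ 0ᶜ → ∣ inverse-ratio K ∣ᶜ ≤ c →
                  ‖ v (suc K) -ᵛ μ ⁻¹ᶜ • Q · V ‖ ≤ c * k * ‖ v K -ᵛ V ‖ + ‖ Q · V ‖ * ∣ inverse-ratio K +ᶜ -ᶜ (μ ⁻¹ᶜ) ∣ᶜ
          bound K r≉0 b≤c = begin
            ‖ v (suc K) -ᵛ μ ⁻¹ᶜ • Q · V ‖                            ≈⟨ size-cong p₀ split ⟩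
            ‖ (β′ • Q · (v K -ᵛ V)) +ᵛ (δ • Q · V) ‖                  ≤⟨ subadditive p₀ _ _ ⟩
            ‖ β′ • Q · (v K -ᵛ V) ‖ + ‖ δ • Q · V ‖
              ≤⟨ +-mono-≤ (subhomogeneous p₀ β′ _) (subhomogeneous p₀ δ (Q · V)) ⟩
            ∣ β′ ∣ᶜ * ‖ Q · (v K -ᵛ V) ‖ + ∣ δ ∣ᶜ * ‖ Q · V ‖
              ≤⟨ +-mono-≤ (*-mono-≤ 0≤2∣μ⁻¹∣ (0≤size p₀ _) b≤c (proj₂ (proj₂ kQ) (v K -ᵛ V))) (≤-reflexive (*-comm _ _)) ⟩
            c * (k * ‖ v K -ᵛ V ‖) + ‖ Q · V ‖ * ∣ δ ∣ᶜ               ≈⟨ +-congʳ (*-assoc c k _) ⟨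
            c * k * ‖ v K -ᵛ V ‖ + ‖ Q · V ‖ * ∣ δ ∣ᶜ                 ∎
            where
            β′ = inverse-ratio K
            δ = β′ +ᶜ -ᶜ (μ ⁻¹ᶜ)
            split : v (suc K) -ᵛ μ ⁻¹ᶜ • Q · V ≈ᵛ (β′ • Q · (v K -ᵛ V)) +ᵛ (δ • Q · V)
            split i = ℂᵣ.trans
              (ℂᵣ.+-congʳ (ℂᵣ.trans (ℂᵣ.*-congˡ {R (suc K) ⁻¹ᶜ} (*-· Q (Q ^ᴹ K) C i)) (renormalise {K} r≉0 Q (total-sum K) i)))
              (ℂᵣ.trans (solveᶜ 4 (λ b m x y → b ⊗ x ⊖ m ⊗ y ⊜ b ⊗ (x ⊖ y) ⊕ (b ⊖ m) ⊗ y) ℂᵣ.refl β′ (μ ⁻¹ᶜ) ((Q · v K) i) ((Q · V) i))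
                (ℂᵣ.+-congʳ (ℂᵣ.*-congˡ {β′} (ℂᵣ.sym (·--ᵛ Q (v K) V i)))))

        V≈ : V ≈ᵛ μ ⁻¹ᶜ • Q · V
        V≈ = definite-sub p₀ (fromNorm-definite ν) (Null-const⇒≤
          (Null-+ (λ ε 0<ε → Eventually-suc (total-limit ε 0<ε)) gap) λ K → begin
            ‖ V -ᵛ μ ⁻¹ᶜ • Q · V ‖                                     ≤⟨ size-sub-trans p₀ V (v (suc K)) _ ⟩
            ‖ V -ᵛ v (suc K) ‖ + ‖ v (suc K) -ᵛ μ ⁻¹ᶜ • Q · V ‖
              ≤⟨ +-mono-≤ (size-sub-sym p₀ V (v (suc K))) ≤-refl ⟩
            ‖ v (suc K) -ᵛ V ‖ + ‖ v (suc K) -ᵛ μ ⁻¹ᶜ • Q · V ‖        ∎)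

      eigenvector : sumᵛ (λ r → A r · V) ≈ᵛ μ • V
      eigenvector = ≈ᵛ-trans (≈ᵛ-sym (sumᴹ-· A V)) Q·V≈μV

      module Convergence
        (p : Seminorm d) (definite : Definite p)
        (q : ℝ) (0≤q : 0# ≤ q) (contracts : ∀ r v → size p (A r · v) ≤ q * size p v)
        (q/μ<1 : ∣ μ ⁻¹ᶜ ∣ᶜ * q < 1#)
        where
        open Operator b d A V μ μ≉0 eigenvector p definite q 0≤q contracts q/μ<1

        Fₖ : ℕ → [0,1] → ℂ^ d
        Fₖ K x = R K ⁻¹ᶜ • runningSum rep K x

        P : Fin (suc b) → Matrix d
        P r = prefixᴹ A (toℕ r)

        P-bounded : ∃ λ k → 0# ≤ k × (∀ r u → size p (P r · u) ≤ k * size p u)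
        P-bounded = maximum k , 0≤maximum k , λ r u →
          ≤-trans (proj₂ (proj₂ (dominated (pullback (P r) p) p definite)) u)
                  (*-monoʳ-≤ (0≤size p u) (≤-maximum k r))
          where
          k : Fin (suc b) → ℝ
          k r = proj₁ (dominated (pullback (P r) p) p definite)

        -- `c` eventually bounds the inverse ratios and `kP` bounds the prefix matrices; `N` bounds
        -- `prefix AV (toℕ r) +ᵛ A r · F y`, which is μF(x).
        c kP N : ℝ
        c = ∣ μ ⁻¹ᶜ ∣ᶜ * (1# + 1#)
        kP = proj₁ P-bounded
        N = proj₁ (prefix-bounded p AV) + q * proj₁ F-bounded

        0≤kP : 0# ≤ kP
        0≤kP = proj₁ (proj₂ P-bounded)

        0≤N : 0# ≤ N
        0≤N = 0≤-+ (proj₁ (proj₂ (prefix-bounded p AV))) (*-nonNeg 0≤q (proj₁ (proj₂ F-bounded)))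

        -- `a′` leaves room above the factor `a`, as |R(K)/R(K+1)| may exceed |μ⁻¹| slightly. With
        -- `m` chosen so, ma′ - a = (a′ - a)(1 - a′) ≥ 0, and |R(K)/R(K+1)| m ≤ |μ⁻¹| gives
        -- |R(K)/R(K+1)| q ≤ a′.
        a′ m : ℝ
        a′ = proj₁ (midpoint q/μ<1)
        m = 1# - (a′ - a)

        a<a′ : a < a′
        a<a′ = proj₁ (proj₂ (midpoint q/μ<1))

        a′<1 : a′ < 1#
        a′<1 = proj₂ (proj₂ (midpoint q/μ<1))

        m<1 : m < 1#
        m<1 = <-by (x<y⇒0<y-x a<a′) (solve 1 (λ g → :1 :- (:1 :- g) := g) refl (a′ - a))

        0<m : 0# < m
        0<m = <-≤-trans (x<y⇒0<y-x a′<1)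
          (≤-by 0≤a (solve 2 (λ a b → (:1 :- (b :- a)) :- (:1 :- b) := a) refl a a′))

        a≤m*a′ : a ≤ m * a′
        a≤m*a′ = ≤-by (*-nonNeg (x≤y⇒0≤y-x (<⇒≤ a<a′)) (x≤y⇒0≤y-x (<⇒≤ a′<1)))
          (solve 2 (λ a b → (:1 :- (b :- a)) :* b :- a := (b :- a) :* (:1 :- b)) refl a a′)

        error : ℕ → ℝ
        error K = c * kP * size p (v K -ᵛ V) + N * ∣ inverse-ratio K +ᶜ -ᶜ (μ ⁻¹ᶜ) ∣ᶜ

        error-null : Null error
        error-null = Null-+ (Null-* (c * kP) (*-nonNeg 0≤2∣μ⁻¹∣ 0≤kP)
            (Null-≤-scaled (proj₁ k) (proj₁ (proj₂ k)) total-limit (0 , λ K _ → proj₂ (proj₂ k) (v K -ᵛ V))))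
          (Null-* N 0≤N inverse-ratio-limit)
          where k = dominated p p₀ (fromNorm-definite ν)

        recursion : ∀ K x → R K ≉ᶜ 0ᶜ → Fₖ (suc K) x ≈ᵛ
                    inverse-ratio K • ((P (digit x) · v K) +ᵛ (A (digit x) · Fₖ K (scaled x)))
        recursion K x r≉0 i = ℂᵣ.trans
          (ℂᵣ.*-congˡ {s′} (ℂᵣ.trans (runningSum-step K x i) (ℂᵣ.+-congʳ (prefixᴹ-· A (toℕ r) (total-sum K) i))))
          (ℂᵣ.trans (ℂᵣ.distribˡ s′ ((P r · total-sum K) i) ((A r · S) i))
            (ℂᵣ.trans (ℂᵣ.+-cong (renormalise {K} r≉0 (P r) (total-sum K) i) (renormalise {K} r≉0 (A r) S i))
              (ℂᵣ.sym (ℂᵣ.distribˡ (inverse-ratio K) ((P r · v K) i) ((A r · Fₖ K (scaled x)) i)))))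
          where
          r = digit x
          s′ = R (suc K) ⁻¹ᶜ
          S = runningSum rep K (scaled x)

        -- `recursion` and `F-fixed` use the same digit and the same scaled point, so the two sides
        -- subtract term by term. The first term contracts the previous distance, the second carries
        -- the error of v(K), the third that of the ratio.
        difference : ∀ K x → R K ≉ᶜ 0ᶜ → let r = digit x; y = scaled x; β′ = inverse-ratio K in
                     Fₖ (suc K) x -ᵛ F x ≈ᵛ
                     (β′ • A r · (Fₖ K y -ᵛ F y)) +ᵛ
                       ((β′ • P r · (v K -ᵛ V)) +ᵛ ((β′ +ᶜ -ᶜ (μ ⁻¹ᶜ)) • (prefix AV (toℕ r) +ᵛ A r · F y)))
        difference K x r≉0 i = ℂᵣ.trans
          (ℂᵣ.+-cong (recursion K x r≉0 i) (ℂᵣ.-‿cong (F-fixed x i)))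
          (ℂᵣ.trans (solveᶜ 6 (λ b m x y z w → b ⊗ (x ⊕ y) ⊖ m ⊗ (z ⊕ w) ⊜ b ⊗ (y ⊖ w) ⊕ (b ⊗ (x ⊖ z) ⊕ (b ⊖ m) ⊗ (z ⊕ w)))
              ℂᵣ.refl β′ (μ ⁻¹ᶜ) ((P r · v K) i) ((A r · Fₖ K y) i) (prefix AV (toℕ r) i) ((A r · F y) i))
            (ℂᵣ.+-cong (ℂᵣ.*-congˡ {β′} (ℂᵣ.sym (·--ᵛ (A r) (Fₖ K y) (F y) i)))
              (ℂᵣ.+-congʳ (ℂᵣ.*-congˡ {β′} (ℂᵣ.trans
                (ℂᵣ.+-congˡ {(P r · v K) i} (ℂᵣ.-‿cong (prefixᴹ-· A (toℕ r) V i)))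
                (ℂᵣ.sym (·--ᵛ (P r) (v K) V i)))))))
          where
          r = digit x
          y = scaled x
          β′ = inverse-ratio K

        distance : ℕ → [0,1] → ℝ
        distance K x = size p (Fₖ K x -ᵛ F x)

        distance-step : ∀ K → R K ≉ᶜ 0ᶜ → ∣ inverse-ratio K ∣ᶜ ≤ c → ∣ inverse-ratio K ∣ᶜ * m ≤ ∣ μ ⁻¹ᶜ ∣ᶜ →
                        ∀ x → distance (suc K) x ≤ a′ * distance K (scaled x) + error K
        distance-step K r≉0 b≤c bm≤ x = begin
          distance (suc K) x                                   ≈⟨ size-cong p (difference K x r≉0) ⟩
          size p (t₁ +ᵛ (t₂ +ᵛ t₃))                            ≤⟨ subadditive p t₁ (t₂ +ᵛ t₃) ⟩
          size p t₁ + size p (t₂ +ᵛ t₃)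
            ≤⟨ +-mono-≤ t₁≤ (≤-trans (subadditive p t₂ t₃) (+-mono-≤ t₂≤ t₃≤)) ⟩
          a′ * distance K y + error K                          ∎
          where
          r = digit x
          y = scaled x
          β′ = inverse-ratio K
          δ = β′ +ᶜ -ᶜ (μ ⁻¹ᶜ)
          t₁ = β′ • A r · (Fₖ K y -ᵛ F y)
          t₂ = β′ • P r · (v K -ᵛ V)
          t₃ = δ • (prefix AV (toℕ r) +ᵛ A r · F y)

          ∣b∣q≤a′ : ∣ β′ ∣ᶜ * q ≤ a′
          ∣b∣q≤a′ = *-cancelˡ-≤ 0<m (begin
            m * (∣ β′ ∣ᶜ * q)       ≈⟨ solve 3 (λ m b q → m :* (b :* q) := b :* m :* q) refl m ∣ β′ ∣ᶜ q ⟩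
            ∣ β′ ∣ᶜ * m * q         ≤⟨ *-monoʳ-≤ 0≤q bm≤ ⟩
            a                       ≤⟨ a≤m*a′ ⟩
            m * a′                  ∎)

          t₁≤ : size p t₁ ≤ a′ * distance K y
          t₁≤ = begin
            size p t₁                               ≤⟨ subhomogeneous p β′ _ ⟩
            ∣ β′ ∣ᶜ * size p (A r · (Fₖ K y -ᵛ F y))     ≤⟨ *-monoˡ-≤ (0≤∣∣ᶜ β′) (contracts r _) ⟩
            ∣ β′ ∣ᶜ * (q * distance K y)            ≈⟨ *-assoc _ q _ ⟨
            ∣ β′ ∣ᶜ * q * distance K y              ≤⟨ *-monoʳ-≤ (0≤size p _) ∣b∣q≤a′ ⟩
            a′ * distance K y                       ∎

          t₂≤ : size p t₂ ≤ c * kP * size p (v K -ᵛ V)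
          t₂≤ = begin
            size p t₂                                    ≤⟨ subhomogeneous p β′ _ ⟩
            ∣ β′ ∣ᶜ * size p (P r · (v K -ᵛ V))
              ≤⟨ *-mono-≤ 0≤2∣μ⁻¹∣ (0≤size p _) b≤c (proj₂ (proj₂ P-bounded) r _) ⟩
            c * (kP * size p (v K -ᵛ V))                 ≈⟨ *-assoc c kP _ ⟨
            c * kP * size p (v K -ᵛ V)                   ∎

          t₃≤ : size p t₃ ≤ N * ∣ δ ∣ᶜ
          t₃≤ = begin
            size p t₃                                                           ≤⟨ subhomogeneous p δ _ ⟩
            ∣ δ ∣ᶜ * size p (prefix AV (toℕ r) +ᵛ A r · F y)
              ≤⟨ *-monoˡ-≤ (0≤∣∣ᶜ δ) (≤-trans (subadditive p _ _)
                  (+-mono-≤ (proj₂ (proj₂ (prefix-bounded p AV)) r)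
                  (≤-trans (contracts r (F y)) (*-monoˡ-≤ 0≤q (proj₂ (proj₂ F-bounded) y))))) ⟩
            ∣ δ ∣ᶜ * N                                                          ≈⟨ *-comm _ N ⟩
            N * ∣ δ ∣ᶜ                                                          ∎

        -- For an unbounded set `Sup` would be 0 and could not dominate the distances.
        distance-bounded : ∀ K → ∃ (IsUpperBound λ t → ∃ λ x → t ≈ distance K x)
        distance-bounded K = ∣ R K ⁻¹ᶜ ∣ᶜ * proj₁ S-bounded + proj₁ F-bounded , λ t (x , t≈) → begin
          t                                                            ≈⟨ t≈ ⟩
          distance K x                                                 ≤⟨ size-sub-≤ p (Fₖ K x) (F x) ⟩
          size p (Fₖ K x) + size p (F x)
            ≤⟨ +-mono-≤ (≤-trans (subhomogeneous p (R K ⁻¹ᶜ) (runningSum rep K x)) (*-monoˡ-≤ (0≤∣∣ᶜ (R K ⁻¹ᶜ)) (proj₂ S-bounded x))) (proj₂ (proj₂ F-bounded) x) ⟩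
          ∣ R K ⁻¹ᶜ ∣ᶜ * proj₁ S-bounded + proj₁ F-bounded             ∎
          where S-bounded = runningSum-bounded p 0≤q contracts K

        sup-distance : ℕ → ℝ
        sup-distance K = Sup λ t → ∃ λ x → t ≈ distance K x

        distance≤sup : ∀ K x → distance K x ≤ sup-distance K
        distance≤sup K x = x≤Sup (distance-bounded K) (x , refl)

        0≤sup-distance : ∀ K → 0# ≤ sup-distance K
        0≤sup-distance K = 0≤Sup λ t (x , t≈) → ≤-respʳ (sym t≈) (0≤size p _)

        0≤error : ∀ K → 0# ≤ error K
        0≤error K = 0≤-+ (*-nonNeg (*-nonNeg 0≤2∣μ⁻¹∣ 0≤kP) (0≤size p (v K -ᵛ V))) (*-nonNeg 0≤N (0≤∣∣ᶜ _))

        0≤a′ : 0# ≤ a′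
        0≤a′ = ≤-trans 0≤a (<⇒≤ a<a′)

        sup-distance-step : ∀ K → R K ≉ᶜ 0ᶜ → ∣ inverse-ratio K ∣ᶜ ≤ c × ∣ inverse-ratio K ∣ᶜ * m ≤ ∣ μ ⁻¹ᶜ ∣ᶜ →
                            sup-distance (suc K) ≤ a′ * sup-distance K + error K
        sup-distance-step K r≉0 (b≤c , bm≤) =
          Sup≤ (0≤-+ (*-nonNeg 0≤a′ (0≤sup-distance K)) (0≤error K)) λ t (x , t≈) → begin
            t                                          ≈⟨ t≈ ⟩
            distance (suc K) x                         ≤⟨ distance-step K r≉0 b≤c bm≤ x ⟩
            a′ * distance K (scaled x) + error K
              ≤⟨ +-mono-≤ (*-monoˡ-≤ 0≤a′ (distance≤sup K (scaled x))) ≤-refl ⟩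
            a′ * sup-distance K + error K              ∎

        ratio-bounds : Eventually λ K → ∣ inverse-ratio K ∣ᶜ ≤ c × ∣ inverse-ratio K ∣ᶜ * m ≤ ∣ μ ⁻¹ᶜ ∣ᶜ
        ratio-bounds = Eventually-zip (λ K s t → s , t) inverse-ratio-bounded (∣inverse-ratio∣-bound m m<1)

        sup-distance-null : Null sup-distance
        sup-distance-null = contraction-null sup-distance error 0≤a′ a′<1 error-null
          (Eventually-zip sup-distance-step R≉0 ratio-bounds)

        converges : ConvergesUniformly ν Fₖ F
        converges ε 0<ε = Eventually-map close
          (Null-* (proj₁ k) (proj₁ (proj₂ k)) sup-distance-null (ε * ½) (0<x½ 0<ε))
          where
          k : ∃ λ k → 0# ≤ k × (∀ u → ‖ u ‖ ≤ k * size p u)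
          k = dominated p₀ p definite
          close : ∀ K → proj₁ k * sup-distance K ≤ ε * ½ → ∀ x → ‖ Fₖ K x -ᵛ F x ‖ < ε
          close K small x = ≤-<-trans (begin
            ‖ Fₖ K x -ᵛ F x ‖                ≤⟨ proj₂ (proj₂ k) (Fₖ K x -ᵛ F x) ⟩
            proj₁ k * distance K x           ≤⟨ *-monoˡ-≤ (proj₁ (proj₂ k)) (distance≤sup K x) ⟩
            proj₁ k * sup-distance K         ≤⟨ small ⟩
            ε * ½                            ∎) (x½<x 0<ε)

-- Passage from (ADT) and (JSR) to the data of the construction.

theorem1 :
  (em : ExcludedMiddle 0ℓ) (𝐑 : CompleteOrderedField) →
  let open Analysis em 𝐑 in
  (B d : ℕ) → 2 ℕ.≤ B → 1 ℕ.≤ d →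
  (rep : LinearRepresentation B d) (ν : Norm d) →
  let open LinearRepresentation rep
      open Norm ν using (‖_‖) in
  (V : ℂ^ d) (R R′ : ℕ → ℂ) (ρ : ℝ) (ω : ℂ) →
  ¬ (V ≈ᵛ 0ᵛ) →
  Eventually (λ K → R K ≉ᶜ 0ᶜ) →
  0# < ρ →
  ∣ ω ∣ᶜ ≈ 1# →
  (λ K → ‖ ((Q ^ᴹ K) · C) -ᵛ (R K • V) ‖) =O (λ K → ∣ R′ K ∣ᶜ) →
  (∃ λ (η : ℕ → ℂ) → ((λ K → ∣ η K ∣ᶜ) =O (λ K → ι K ⁻¹)) ×
    Eventually (λ K → (R (suc K) *ᶜ (R K) ⁻¹ᶜ) ≈ᶜ ((fromℝ ρ *ᶜ ω) *ᶜ (1ᶜ +ᶜ η K)))) →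
  (∃ λ (η : ℕ → ℂ) → ((λ K → ∣ η K ∣ᶜ) =O (λ K → ι K ⁻¹)) ×
    Eventually (λ K → R′ K ≈ᶜ (R K *ᶜ η K))) →
  (λ* : ℝ) → IsJointSpectralRadius ν A λ* → λ* < ρ →
  ∃ λ (F : [0,1] → ℂ^ d) →
    Continuous ν F
    × SolvesDilation A (fromℝ ρ *ᶜ ω) V F
    × (∀ (G : [0,1] → ℂ^ d) → Continuous ν G →
        SolvesDilation A (fromℝ ρ *ᶜ ω) V G → ∀ x → G x ≈ᵛ F x)
    × ConvergesUniformly ν (λ K x → (R K) ⁻¹ᶜ • runningSum rep K x) F
theorem1 em 𝐑 (suc b) d (ℕ.s≤s 1≤b) _ rep ν V R R′ ρ ω _ R≉0 0<ρ ∣ω∣≈1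
  (M , remainder) (η , η-small , ratio) (η′ , η′-small , R′≈) λ* jsr λ*<ρ =
    F , F-continuous ν , F-solves
  , (λ G G-continuous G-solves →
      Uniqueness.unique b d 1≤b A V μ ν G F G-continuous (F-continuous ν) G-solves F-solves)
  , converges
  where
  open Analysis em 𝐑
  open RealAnalysis em 𝐑
  open ComplexNumbers em 𝐑
  open NormedSpaces em 𝐑
  open AdaptedNorms em 𝐑
  open Dilation em 𝐑
  open Asymptotics em 𝐑
  open LinearRepresentation rep
  open Norm ν using (‖_‖)

  μ : ℂ
  μ = fromℝ ρ *ᶜ ω

  ∣μ∣≈ρ : ∣ μ ∣ᶜ ≈ ρ
  ∣μ∣≈ρ = begin-equality
    ∣ μ ∣ᶜ                     ≈⟨ ∣zw∣≈∣z∣∣w∣ (fromℝ ρ) ω ⟩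
    ∣ fromℝ ρ ∣ᶜ * ∣ ω ∣ᶜ      ≈⟨ *-cong (trans (∣fromℝ∣≈∣∣ ρ) (0≤x⇒∣x∣≈x (<⇒≤ 0<ρ))) ∣ω∣≈1 ⟩
    ρ * 1#                     ≈⟨ *-identityʳ ρ ⟩
    ρ                          ∎

  μ≉0 : μ ≉ᶜ 0ᶜ
  μ≉0 = 0<∣z∣⇒z≉0 {μ} (<-respʳ (sym ∣μ∣≈ρ) 0<ρ)

  -- After division of the remainder by R(K), the factor R(K) of R′(K) = R(K)η′(K) cancels and only
  -- η′(K) is left.
  total-limit : Null λ K → ‖ (R K ⁻¹ᶜ • (Q ^ᴹ K) · C) -ᵛ V ‖
  total-limit = Null-≤
    (Eventually-zip bound (Eventually-zip (λ K s t → s , t) R≉0 remainder) R′≈)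
    (Null-* ∣ M ∣ (0≤∣x∣ M) (O[1/K]⇒Null η′-small))
    where
    bound : ∀ K → R K ≉ᶜ 0ᶜ × ‖ ((Q ^ᴹ K) · C) -ᵛ (R K • V) ‖ ≤ M * ∣ R′ K ∣ᶜ → R′ K ≈ᶜ R K *ᶜ η′ K →
            ‖ (R K ⁻¹ᶜ • (Q ^ᴹ K) · C) -ᵛ V ‖ ≤ ∣ M ∣ * ∣ η′ K ∣ᶜ
    bound K (r≉0 , rem≤) r′≈ = begin
      ‖ (r⁻¹ • (Q ^ᴹ K) · C) -ᵛ V ‖                      ≈⟨ size-cong (fromNorm ν) factor ⟩
      ‖ r⁻¹ • (((Q ^ᴹ K) · C) -ᵛ (r • V)) ‖              ≤⟨ subhomogeneous (fromNorm ν) r⁻¹ _ ⟩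
      ∣ r⁻¹ ∣ᶜ * ‖ ((Q ^ᴹ K) · C) -ᵛ (r • V) ‖           ≤⟨ *-monoˡ-≤ (0≤∣∣ᶜ r⁻¹) rem≤ ⟩
      ∣ r⁻¹ ∣ᶜ * (M * ∣ R′ K ∣ᶜ)
        ≈⟨ *-congˡ (*-congˡ (trans (∣∣ᶜ-cong {R′ K} {r *ᶜ η′ K} r′≈) (∣zw∣≈∣z∣∣w∣ r (η′ K)))) ⟩
      ∣ r⁻¹ ∣ᶜ * (M * (∣ r ∣ᶜ * ∣ η′ K ∣ᶜ))
        ≈⟨ solve 4 (λ i m r e → i :* (m :* (r :* e)) := (r :* i) :* (m :* e)) refl ∣ r⁻¹ ∣ᶜ M ∣ r ∣ᶜ ∣ η′ K ∣ᶜ ⟩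
      ∣ r ∣ᶜ * ∣ r⁻¹ ∣ᶜ * (M * ∣ η′ K ∣ᶜ)
        ≈⟨ trans (*-congʳ (∣z∣∣z⁻¹∣≈1 {r} r≉0)) (*-identityˡ _) ⟩
      M * ∣ η′ K ∣ᶜ                                      ≤⟨ *-monoʳ-≤ (0≤∣∣ᶜ (η′ K)) (x≤∣x∣ M) ⟩
      ∣ M ∣ * ∣ η′ K ∣ᶜ                                  ∎
      where
      r = R K
      r⁻¹ = R K ⁻¹ᶜ
      factor : (r⁻¹ • (Q ^ᴹ K) · C) -ᵛ V ≈ᵛ r⁻¹ • (((Q ^ᴹ K) · C) -ᵛ (r • V))
      factor i = ℂᵣ.trans
        (ℂᵣ.+-congˡ {r⁻¹ *ᶜ t} (ℂᵣ.-‿cong (ℂᵣ.sym (ℂᵣ.trans (ℂᵣ.*-congʳ {V i} (⁻¹ᶜ-inverseʳ {r} r≉0)) (ℂᵣ.*-identityˡ (V i))))))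
        (ℂₛ.solve 4 (λ r i t v → i ℂₛ.:* t ℂₛ.:- r ℂₛ.:* i ℂₛ.:* v ℂₛ.:= i ℂₛ.:* (t ℂₛ.:- r ℂₛ.:* v)) ℂᵣ.refl r r⁻¹ t (V i))
        where t = ((Q ^ᴹ K) · C) i

  norm : ∃ λ q → (0# < q × q < ρ) × ∃ λ p → Definite p × (∀ r v → size p (A r · v) ≤ q * size p v)
  norm = contracting-norm {suc b} {d} ν A λ* ρ jsr λ*<ρ 0<ρ

  q : ℝ
  q = proj₁ norm

  0≤q : 0# ≤ q
  0≤q = <⇒≤ (proj₁ (proj₁ (proj₂ norm)))

  q<ρ : q < ρ
  q<ρ = proj₂ (proj₁ (proj₂ norm))

  p : Seminorm d
  p = proj₁ (proj₂ (proj₂ norm))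

  definite : Definite p
  definite = proj₁ (proj₂ (proj₂ (proj₂ norm)))

  contracts : ∀ r v → size p (A r · v) ≤ q * size p v
  contracts = proj₂ (proj₂ (proj₂ (proj₂ norm)))

  ρ∣μ⁻¹∣≈1 : ρ * ∣ μ ⁻¹ᶜ ∣ᶜ ≈ 1#
  ρ∣μ⁻¹∣≈1 = trans (*-congʳ (sym ∣μ∣≈ρ)) (∣z∣∣z⁻¹∣≈1 {μ} μ≉0)

  ∣μ⁻¹∣q<1 : ∣ μ ⁻¹ᶜ ∣ᶜ * q < 1#
  ∣μ⁻¹∣q<1 = <-by (0<-* 0<∣μ⁻¹∣ (x<y⇒0<y-x q<ρ))
    (trans (+-congʳ (sym ρ∣μ⁻¹∣≈1)) (solve 3 (λ r i q → r :* i :- i :* q := i :* (r :- q)) refl ρ ∣ μ ⁻¹ᶜ ∣ᶜ q))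
    where
    0<∣μ⁻¹∣ : 0# < ∣ μ ⁻¹ᶜ ∣ᶜ
    0<∣μ⁻¹∣ = 0≤∣∣ᶜ (μ ⁻¹ᶜ) , λ 0≈ → 0≉1 (trans (sym (zeroʳ ρ)) (trans (*-congˡ 0≈) ρ∣μ⁻¹∣≈1))

  module RateR = Rate μ μ≉0 R R≉0 η (O[1/K]⇒Null η-small) ratio
  module LimitR = RateR.Limit b d rep ν V total-limit
  open LimitR.Convergence p definite q 0≤q contracts ∣μ⁻¹∣q<1
  open Operator b d A V μ μ≉0 LimitR.eigenvector p definite q 0≤q contracts ∣μ⁻¹∣q<1
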